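{- Assume $K$ is a perfect $A$-field and let $\phi,\psi$ be Drinfeld modules over $K$ with $\operatorname{rk}\phi<\operatorname{rk}\psi$. Then there is a short exact sequence of $\mathbf t^\sigma$-modules $$0\to\operatorname{Ext}^1_{0,\tau}(\phi,\psi)\to\operatorname{Ext}^1_\tau(\phi,\psi)\to\mathbb G_a\to0,$$ where $\operatorname{Ext}^1_{0,\tau}(\phi,\psi)$ and $\operatorname{Ext}^1_\tau(\phi,\psi)$ carry natural $\mathbf t^\sigma$-module structures (i.e. they are, as $\mathbb F_q[t]$-modules, the Mordell–Weil modules of $\mathbf t^\sigma$-modules, the first map inducing the natural inclusion) and $\mathbb G_a$ is the one-dimensional $\mathbf t^\sigma$-module $t\mapsto\theta$.
   Context: $A=\mathbb F_q[t]$; $K$ a perfect field of characteristic $p$ with $\mathbb F_q$-algebra map $\iota:A\to K$, $\theta=\iota(t)$. $K\{\tau\}$: twisted polynomials with $\tau x=x^q\tau$; $K\{\sigma\}$: twisted polynomials with $\sigma x=x^{q^{ -1}}\sigma$. A $\mathbf t$-module (resp. $\mathbf t^\sigma$-module) of dimension $d$ is an $\mathbb F_q$-algebra homomorphism $\Phi:\mathbb F_q[t]\to\mathrm{Mat}_d(K\{\tau\})$ (resp. $\mathrm{Mat}_d(K\{\sigma\})$) with $\Phi_t=(\theta I+N)+\sum_{i\ge1}M_i\tau^i$ (resp. $\sigma^i$), $N$ nilpotent; rank $=$ degree of $\Phi_t$; a Drinfeld module is a one-dimensional $\mathbf t$-module. Mordell–Weil module of a $\mathbf t^\sigma$-module: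 $K^d$ with $t$ acting via evaluation of $\Phi_t$, $\sigma$ acting as $x\mapsto x^{q^{ -1}}$. Morphisms of $\mathbf t^\sigma$-modules from $\Psi$ (dim $e$) to $\Phi$ (dim $d$): $f\in\mathrm{Mat}_{d\times e}(K\{\sigma\})$ with $f\Psi_t=\Phi_tf$; short exact sequence: composable morphisms whose underlying sequence of algebraic groups is short exact. $\mathrm{Der}(\phi,\psi)$: $\mathbb F_q$-linear $\delta:\mathbb F_q[t]\to K\{\tau\}$ with $\delta(ab)=\psi_a\delta(b)+\delta(a)\phi_b$; inner: $\delta^{(U)}(a)=U\phi_a-\psi_aU$; $\operatorname{Ext}^1_\tau(\phi,\psi)=\mathrm{Der}/\mathrm{Der}_{in}$ with $a*[\delta]=[\psi_a\delta]$; $\mathrm{Der}_0$ = those $\delta$ with $\delta(t)$ of zero constant term, $\operatorname{Ext}^1_{0,\tau}=\mathrm{Der}_0/(\mathrm{Der}_0\cap\mathrm{Der}_{in})$. -}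

module Defs where

open import Algebra.Bundles using (CommutativeRing; Ring; RawRing; Semiring; AbelianGroup; CommutativeMonoid)
open import Algebra.Apartness.Bundles using (HeytingField; HeytingCommutativeRing)
open import Algebra.Module.Bundles using (LeftModule)
open import Algebra.Morphism.Structures using (module RingMorphisms)
import Algebra.Definitions.RawMonoid as RawMonoidDefs
import Algebra.Definitions.RawSemiring as RawSemiringDefs
import Algebra.Module.Morphism.Structures as ModuleMorphisms
import Algebra.Properties.AbelianGroup as AbelianGroupProperties
import Algebra.Properties.CommutativeSemigroup as CommutativeSemigroupProperties
import Algebra.Properties.CommutativeSemiring.Binomial as Binomial
import Algebra.Properties.CommutativeSemiring.Exp as CommutativeExp
import Algebra.Properties.Group as GroupProperties
import Algebra.Properties.Monoid.Sum as MonoidSum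
import Algebra.Properties.CommutativeMonoid.Sum as CommutativeMonoidSum
import Algebra.Properties.Ring as RingProperties
import Algebra.Properties.Semiring.Exp as Exp
import Algebra.Properties.Semiring.Mult as Mult
import Algebra.Morphism.Construct.Identity as Identity
open import Data.Bool.Base using (if_then_else_)
open import Data.Fin.Base using (Fin; zero; suc; toℕ; fromℕ; inject₁)
import Data.Fin.Properties as Fin
open import Data.List.Base using (List; []; _∷_; map)
open import Data.Nat.Base as ℕ using (ℕ; zero; suc; _!; z≤n; s≤s)
open import Data.Nat.Combinatorics using (_C_; nCk≡n!/k![n-k]!; k![n∸k]!∣n!; nCn≡1)
open import Data.Nat.Divisibility using (_∣_; divides; m∣m*n; ∣⇒≤; ∣1⇒≡1)
open import Data.Nat.DivMod using (m/n*n≡m)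
open import Data.Nat.Primality using (Prime; euclidsLemma; ¬prime[1]; ¬prime[0])
import Data.Nat.Properties as ℕ
open import Data.Product.Base using (Σ; ∃; _×_; _,_; proj₁; proj₂)
open import Data.Sum.Base using (inj₁; inj₂)
open import Data.Vec.Functional using (Vector)
open import Function.Base using (id; _∘_)
open import Function.Bundles using (Inverse; _⇔_)
open import Function.Definitions using (Injective; Surjective; Bijective)
open import Level using (Level; _⊔_) renaming (suc to lsuc)
open import Relation.Binary.Bundles using (Setoid)
open import Relation.Binary.PropositionalEquality as ≡ using (_≡_)
import Relation.Binary.Reasoning.Setoid
open import Relation.Nullary.Decidable using (yes; no; ⌊_⌋)
open import Relation.Nullary.Negation using (¬_; contradiction)

private variable
  a b ℓ ℓa ℓb : Level

IsRingHom : (R : Ring a ℓa) (S : Ring b ℓb) → (Ring.Carrier R → Ring.Carrier S) → Set (a ⊔ ℓa ⊔ ℓb)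
IsRingHom R S = RingMorphisms.IsRingHomomorphism (Ring.rawRing R) (Ring.rawRing S)

module _ (R : Ring a ℓa) (S : Ring b ℓb) where
  private
    module R = Ring R
    module S = Ring S

  mkIsRingHom : (f : R.Carrier → S.Carrier) →
    (∀ {x y} → x R.≈ y → f x S.≈ f y) →
    (∀ x y → f (x R.+ y) S.≈ f x S.+ f y) →
    (∀ x y → f (x R.* y) S.≈ f x S.* f y) →
    f R.1# S.≈ S.1# → IsRingHom R S f
  mkIsRingHom f f-cong f-+ f-* f-1 = record
    { isSemiringHomomorphism = record
      { isNearSemiringHomomorphism = record
        { +-isMonoidHomomorphism = record
          { isMagmaHomomorphism = record
            { isRelHomomorphism = record { cong = f-cong }
            ; homo = f-+ }
          ; ε-homo = f-0 }
        ; *-homo = f-* }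
      ; 1#-homo = f-1 }
    ; -‿homo = λ x → GP.inverseʳ-unique (f x) (f (R.- x))
        (S.trans (S.sym (f-+ x (R.- x))) (S.trans (f-cong (R.-‿inverseʳ x)) f-0)) }
    where
    module GP = GroupProperties S.+-group
    f-0 : f R.0# S.≈ S.0#
    f-0 = GP.identityʳ-unique (f R.0#) (f R.0#)
      (S.trans (S.sym (f-+ R.0# R.0#)) (f-cong (R.+-identityʳ R.0#)))

p∤k! : ∀ {p} → Prime p → ∀ k → k ℕ.< p → ¬ (p ∣ k !)
p∤k! pr zero k<p p∣ = ¬prime[1] (≡.subst Prime (∣1⇒≡1 p∣) pr)
p∤k! pr (suc k) k<p p∣ with euclidsLemma (suc k) (k !) pr p∣
... | inj₁ p∣k = ℕ.<⇒≱ k<p (∣⇒≤ p∣k)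
... | inj₂ p∣k! = p∤k! pr k (ℕ.<-trans (ℕ.n<1+n k) k<p) p∣k!

p∣pCk : ∀ {p} → Prime p → ∀ k → 0 ℕ.< k → k ℕ.< p → p ∣ (p C k)
p∣pCk {p@(suc p-1)} pr k 0<k k<p
  with euclidsLemma (p C k) (k ! ℕ.* (p ℕ.∸ k) !) pr p∣prod
  where
  instance nz = k ℕ.!* (p ℕ.∸ k) !≢0
  eq : (p C k) ℕ.* (k ! ℕ.* (p ℕ.∸ k) !) ≡ p !
  eq = ≡.trans (≡.cong (ℕ._* (k ! ℕ.* (p ℕ.∸ k) !)) (nCk≡n!/k![n-k]! (ℕ.<⇒≤ k<p)))
         (m/n*n≡m (k![n∸k]!∣n! (ℕ.<⇒≤ k<p)))
  p∣prod : p ∣ (p C k) ℕ.* (k ! ℕ.* (p ℕ.∸ k) !)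
  p∣prod = ≡.subst (p ∣_) (≡.sym eq) (m∣m*n (p-1 !))
... | inj₁ d = d
... | inj₂ d with euclidsLemma (k !) ((p ℕ.∸ k) !) pr d
...   | inj₁ d₁ = contradiction d₁ (p∤k! pr k k<p)
...   | inj₂ d₂ = contradiction d₂ (p∤k! pr (p ℕ.∸ k) (ℕ.∸-monoʳ-< 0<k (ℕ.<⇒≤ k<p)))
p∣pCk {zero} pr k _ _ = contradiction pr ¬prime[0]

module _ (R : CommutativeRing a ℓa) where
  open CommutativeRing R hiding (zero)

  HasCharacteristic : ℕ → Set ℓa
  HasCharacteristic p = RawSemiringDefs._×_ (Semiring.rawSemiring semiring) p 1# ≈ 0#

  infixr 8 _^_
  _^_ : Carrier → ℕ → Carrier
  _^_ = RawSemiringDefs._^_ (Semiring.rawSemiring semiring)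

  -- Injectivity is automatic classically for fields, but not for rings.
  IsPerfect : ℕ → Set (a ⊔ ℓa)
  IsPerfect p = Bijective _≈_ _≈_ (_^ p)

  module Frobenius {p} (p-prime : Prime p) (char : HasCharacteristic p) where
    private
      module E = Exp semiring
      module M = Mult semiring
      module S = MonoidSum +-monoid
      open import Relation.Binary.Reasoning.Setoid setoid

    p×≈0 : ∀ {n} → p ∣ n → ∀ x → n M.× x ≈ 0#
    p×≈0 (divides k ≡.refl) x = begin
      (k ℕ.* p) M.× x          ≈⟨ M.×-assocˡ x k p ⟨
      k M.× (p M.× x)          ≈⟨ M.×-congʳ k (M.×-congʳ p (*-identityˡ x)) ⟨
      k M.× (p M.× (1# * x))   ≈⟨ M.×-congʳ k (M.×-assoc-* p 1# x) ⟨
      k M.× ((p M.× 1#) * x)   ≈⟨ M.×-congʳ k (trans (*-congʳ char) (zeroˡ x)) ⟩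
      k M.× 0#                 ≈⟨ S.sum-replicate k ⟨
      S.sum {k} (λ _ → 0#)     ≈⟨ S.sum-replicate-zero k ⟩
      0#                       ∎

    ^p-+ : ∀ x y → (x + y) ^ p ≈ x ^ p + y ^ p
    ^p-+ x y = lem p ≡.refl
      where
      term : ∀ n → Fin (suc n) → Carrier
      term n k = (n C toℕ k) M.× ((x ^ toℕ k) * (y ^ (n ℕ.∸ toℕ k)))
      lem : ∀ n → n ≡ p → (x + y) ^ n ≈ x ^ n + y ^ n
      lem zero ≡.refl = contradiction p-prime ¬prime[0]
      lem (suc m) eq = begin
        (x + y) ^ suc m
          ≈⟨ Binomial.theorem commutativeSemiring (suc m) x y ⟩
        term (suc m) zero + S.sum {suc m} (λ k → term (suc m) (suc k))
          ≈⟨ +-congˡ (S.sum-init-last {m} (λ k → term (suc m) (suc k))) ⟩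
        term (suc m) zero + (S.sum {m} (λ k → term (suc m) (suc (inject₁ k))) + term (suc m) (suc (fromℕ m)))
          ≈⟨ +-cong first (+-cong middle final) ⟩
        y ^ suc m + (0# + x ^ suc m)
          ≈⟨ +-congˡ (+-identityˡ _) ⟩
        y ^ suc m + x ^ suc m
          ≈⟨ +-comm _ _ ⟩
        x ^ suc m + y ^ suc m ∎
        where
        first : term (suc m) zero ≈ y ^ suc m
        first = trans (+-identityʳ _) (*-identityˡ _)
        middle : S.sum {m} (λ k → term (suc m) (suc (inject₁ k))) ≈ 0#
        middle = trans (S.sum-cong-≋ {m} (λ k →
            p×≈0 (≡.subst (λ r → r ∣ (suc m C suc (toℕ (inject₁ k)))) eq
              (p∣pCk (≡.subst Prime (≡.sym eq) p-prime) (suc (toℕ (inject₁ k))) (s≤s z≤n)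
                (s≤s (≡.subst (ℕ._< m) (≡.sym (Fin.toℕ-inject₁ k)) (Fin.toℕ<n k))))) _))
          (S.sum-replicate-zero m)
        final : term (suc m) (suc (fromℕ m)) ≈ x ^ suc m
        final rewrite Fin.toℕ-fromℕ m | nCn≡1 (suc m) | ℕ.n∸n≡0 m =
          trans (+-identityʳ _) (*-identityʳ _)

    ^p-isRingHom : IsRingHom ring ring (_^ p)
    ^p-isRingHom = mkIsRingHom ring ring (_^ p) (E.^-congˡ p) ^p-+
      (λ x y → CommutativeExp.^-distrib-* commutativeSemiring x y p) (1^ p)
      where
      1^ : ∀ n → 1# ^ n ≈ 1#
      1^ zero = refl
      1^ (suc n) = trans (*-identityˡ _) (1^ n)

    ^q-isRingHom : ∀ m → IsRingHom ring ring (_^ (p ℕ.^ m))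
    ^q-isRingHom zero = mkIsRingHom ring ring _ (E.^-congˡ 1)
      (λ x y → trans (*-identityʳ _) (sym (+-cong (*-identityʳ x) (*-identityʳ y))))
      (λ x y → trans (*-identityʳ _) (sym (*-cong (*-identityʳ x) (*-identityʳ y))))
      (*-identityʳ 1#)
    ^q-isRingHom (suc m) = mkIsRingHom ring ring _ (E.^-congˡ (p ℕ.* p ℕ.^ m))
      (λ x y → trans (sym (E.^-assocʳ _ p _)) (trans (I.⟦⟧-cong (F.+-homo x y))
        (trans (I.+-homo _ _) (+-cong (E.^-assocʳ x p _) (E.^-assocʳ y p _)))))
      (λ x y → trans (sym (E.^-assocʳ _ p _)) (trans (I.⟦⟧-cong (F.*-homo x y))
        (trans (I.*-homo _ _) (*-cong (E.^-assocʳ x p _) (E.^-assocʳ y p _)))))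
      (trans (sym (E.^-assocʳ _ p _)) (trans (I.⟦⟧-cong F.1#-homo) I.1#-homo))
      where
      module F = RingMorphisms.IsRingHomomorphism ^p-isRingHom
      module I = RingMorphisms.IsRingHomomorphism (^q-isRingHom m)

  module Root {p} (perfect : IsPerfect p) where
    private module E = Exp semiring

    ^q-bijective : ∀ m → Bijective _≈_ _≈_ (_^ (p ℕ.^ m))
    ^q-bijective zero = (λ {x} {y} e → trans (sym (*-identityʳ x)) (trans e (*-identityʳ y)))
                      , (λ y → y , λ {z} z≈y → trans (*-identityʳ z) z≈y)
    ^q-bijective (suc m) =
        (λ {x} {y} e → proj₁ perfect (proj₁ (^q-bijective m)
           (trans (E.^-assocʳ x p _) (trans e (sym (E.^-assocʳ y p _))))))
      , λ y → let (u , hu) = proj₂ (^q-bijective m) y ; (v , hv) = proj₂ perfect u in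
          v , λ {z} z≈v → trans (sym (E.^-assocʳ z p _)) (hu (hv z≈v))

    root : ℕ → Carrier → Carrier
    root m x = proj₁ (proj₂ (^q-bijective m) x)

    root-^q : ∀ m x → root m x ^ (p ℕ.^ m) ≈ x
    root-^q m x = proj₂ (proj₂ (^q-bijective m) x) refl

    root-isRingHom : Prime p → HasCharacteristic p → ∀ m → IsRingHom ring ring (root m)
    root-isRingHom p-prime char m = mkIsRingHom ring ring (root m)
      (λ {x} {y} e → inj (trans (root-^q m x) (trans e (sym (root-^q m y)))))
      (λ x y → inj (trans (root-^q m _) (sym (trans (H.+-homo _ _) (+-cong (root-^q m x) (root-^q m y))))))
      (λ x y → inj (trans (root-^q m _) (sym (trans (H.*-homo _ _) (*-cong (root-^q m x) (root-^q m y))))))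
      (inj (trans (root-^q m _) (sym H.1#-homo)))
      where
      module H = RingMorphisms.IsRingHomomorphism (Frobenius.^q-isRingHom p-prime char m)
      inj : Injective _≈_ _≈_ (_^ (p ℕ.^ m))
      inj = proj₁ (^q-bijective m)

-- The skew polynomial ring R[X; s], with X c = s(c) X.  The list c₀ ∷ c₁ ∷ ⋯ stands for
-- c₀ + c₁ X + ⋯, so trailing zeros are immaterial and equality is coefficientwise.
module SkewPolynomial (R : CommutativeRing a ℓa) (s : CommutativeRing.Carrier R → CommutativeRing.Carrier R)
  (s-isRingHom : IsRingHom (CommutativeRing.ring R) (CommutativeRing.ring R) s) where

  open CommutativeRing R hiding (zero)
  private
    module s = RingMorphisms.IsRingHomomorphism s-isRingHom
    module RP = RingProperties ring

  Poly : Set a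
  Poly = List Carrier

  coeff : Poly → ℕ → Carrier
  coeff []      n       = 0#
  coeff (c ∷ f) zero    = c
  coeff (c ∷ f) (suc n) = coeff f n

  infix 4 _≋_
  record _≋_ (f g : Poly) : Set ℓa where
    constructor mk≋
    field coeff-≈ : ∀ n → coeff f n ≈ coeff g n
  open _≋_ public

  constant : Carrier → Poly
  constant c = c ∷ []

  X : Poly
  X = 0# ∷ 1# ∷ []

  infixl 6 _⊕_
  _⊕_ : Poly → Poly → Poly
  []      ⊕ g       = g
  (c ∷ f) ⊕ []      = c ∷ f
  (c ∷ f) ⊕ (d ∷ g) = (c + d) ∷ (f ⊕ g)

  ⊖_ : Poly → Poly
  ⊖_ = map (-_)

  infixr 7 _·_
  _·_ : Carrier → Poly → Poly
  c · f = map (c *_) f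

  -- (c + f X) g = c g + f s(g) X, where s acts on g coefficientwise.
  infixl 7 _⊛_
  _⊛_ : Poly → Poly → Poly
  []      ⊛ g = []
  (c ∷ f) ⊛ g = (c · g) ⊕ (0# ∷ (f ⊛ map s g))

  ≋-refl : ∀ {f} → f ≋ f
  ≋-refl = mk≋ λ n → refl

  ≋-sym : ∀ {f g} → f ≋ g → g ≋ f
  ≋-sym e = mk≋ λ n → sym (coeff-≈ e n)

  ≋-trans : ∀ {f g h} → f ≋ g → g ≋ h → f ≋ h
  ≋-trans e e′ = mk≋ λ n → trans (coeff-≈ e n) (coeff-≈ e′ n)

  ≋-setoid : Setoid a ℓa
  ≋-setoid = record { _≈_ = _≋_ ; isEquivalence = record { refl = ≋-refl ; sym = ≋-sym ; trans = ≋-trans } }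

  private module ≋-Reasoning = Relation.Binary.Reasoning.Setoid ≋-setoid

  ∷-cong : ∀ {c d f g} → c ≈ d → f ≋ g → c ∷ f ≋ d ∷ g
  ∷-cong e e′ = mk≋ λ { zero → e ; (suc n) → coeff-≈ e′ n }

  head≈ : ∀ {c d f g} → c ∷ f ≋ d ∷ g → c ≈ d
  head≈ e = coeff-≈ e zero

  tail≋ : ∀ {c d f g} → c ∷ f ≋ d ∷ g → f ≋ g
  tail≋ e = mk≋ λ n → coeff-≈ e (suc n)

  0∷[]≋[] : ∀ {c f} → c ≈ 0# → f ≋ [] → c ∷ f ≋ []
  0∷[]≋[] e e′ = mk≋ λ { zero → e ; (suc n) → coeff-≈ e′ n }

  coeff-⊕ : ∀ f g n → coeff (f ⊕ g) n ≈ coeff f n + coeff g n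
  coeff-⊕ []      g       n       = sym (+-identityˡ _)
  coeff-⊕ (c ∷ f) []      n       = sym (+-identityʳ _)
  coeff-⊕ (c ∷ f) (d ∷ g) zero    = refl
  coeff-⊕ (c ∷ f) (d ∷ g) (suc n) = coeff-⊕ f g n

  coeff-map : ∀ (h : Carrier → Carrier) → h 0# ≈ 0# → ∀ f n → coeff (map h f) n ≈ h (coeff f n)
  coeff-map h h0 []      n       = sym h0
  coeff-map h h0 (c ∷ f) zero    = refl
  coeff-map h h0 (c ∷ f) (suc n) = coeff-map h h0 f n

  coeff-⊖ : ∀ f n → coeff (⊖ f) n ≈ - coeff f n
  coeff-⊖ = coeff-map (-_) RP.-0#≈0#

  coeff-· : ∀ c f n → coeff (c · f) n ≈ c * coeff f n
  coeff-· c = coeff-map (c *_) (zeroʳ c)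

  coeff-s : ∀ f n → coeff (map s f) n ≈ s (coeff f n)
  coeff-s = coeff-map s s.0#-homo

  ⊕-cong : ∀ {f f′ g g′} → f ≋ f′ → g ≋ g′ → f ⊕ g ≋ f′ ⊕ g′
  ⊕-cong {f} {f′} {g} {g′} e e′ = mk≋ λ n → trans (coeff-⊕ f g n)
    (trans (+-cong (coeff-≈ e n) (coeff-≈ e′ n)) (sym (coeff-⊕ f′ g′ n)))

  ⊕-congˡ : ∀ f {g g′} → g ≋ g′ → f ⊕ g ≋ f ⊕ g′
  ⊕-congˡ f = ⊕-cong (≋-refl {f})

  ⊖-cong : ∀ {f f′} → f ≋ f′ → ⊖ f ≋ ⊖ f′
  ⊖-cong {f} {f′} e = mk≋ λ n → trans (coeff-⊖ f n) (trans (-‿cong (coeff-≈ e n)) (sym (coeff-⊖ f′ n)))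

  ·-cong : ∀ {c d f g} → c ≈ d → f ≋ g → c · f ≋ d · g
  ·-cong {c} {d} {f} {g} e e′ = mk≋ λ n →
    trans (coeff-· c f n) (trans (*-cong e (coeff-≈ e′ n)) (sym (coeff-· d g n)))

  map-s-cong : ∀ {f g} → f ≋ g → map s f ≋ map s g
  map-s-cong {f} {g} e = mk≋ λ n → trans (coeff-s f n) (trans (s.⟦⟧-cong (coeff-≈ e n)) (sym (coeff-s g n)))

  ⊕-assoc : ∀ f g h → (f ⊕ g) ⊕ h ≋ f ⊕ (g ⊕ h)
  ⊕-assoc f g h = mk≋ λ n → trans (coeff-⊕ (f ⊕ g) h n) (trans (+-congʳ (coeff-⊕ f g n))
    (trans (+-assoc _ _ _) (sym (trans (coeff-⊕ f (g ⊕ h) n) (+-congˡ (coeff-⊕ g h n))))))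

  ⊕-comm : ∀ f g → f ⊕ g ≋ g ⊕ f
  ⊕-comm f g = mk≋ λ n → trans (coeff-⊕ f g n) (trans (+-comm _ _) (sym (coeff-⊕ g f n)))

  ⊕-identityʳ : ∀ f → f ⊕ [] ≋ f
  ⊕-identityʳ f = ⊕-comm f []

  ⊖-inverseʳ : ∀ f → f ⊕ ⊖ f ≋ []
  ⊖-inverseʳ f = mk≋ λ n → trans (coeff-⊕ f (⊖ f) n) (trans (+-congˡ (coeff-⊖ f n)) (-‿inverseʳ _))

  ⊕-abelianGroup : AbelianGroup a ℓa
  ⊕-abelianGroup = record
    { _≈_ = _≋_ ; _∙_ = _⊕_ ; ε = [] ; _⁻¹ = ⊖_
    ; isAbelianGroup = record
      { isGroup = record
        { isMonoid = record
          { isSemigroup = record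
            { isMagma = record { isEquivalence = Setoid.isEquivalence ≋-setoid ; ∙-cong = ⊕-cong }
            ; assoc = ⊕-assoc }
          ; identity = (λ _ → ≋-refl) , ⊕-identityʳ }
        ; inverse = (λ f → ≋-trans (⊕-comm (⊖ f) f) (⊖-inverseʳ f)) , ⊖-inverseʳ
        ; ⁻¹-cong = ⊖-cong }
      ; comm = ⊕-comm } }

  private module ⊕ = CommutativeSemigroupProperties (AbelianGroup.commutativeSemigroup ⊕-abelianGroup)

  ·-distribˡ : ∀ c f g → c · (f ⊕ g) ≋ (c · f) ⊕ (c · g)
  ·-distribˡ c f g = mk≋ λ n → trans (coeff-· c (f ⊕ g) n) (trans (*-congˡ (coeff-⊕ f g n))
    (trans (distribˡ _ _ _) (sym (trans (coeff-⊕ (c · f) (c · g) n) (+-cong (coeff-· c f n) (coeff-· c g n))))))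

  ·-distribʳ : ∀ c d f → (c + d) · f ≋ (c · f) ⊕ (d · f)
  ·-distribʳ c d f = mk≋ λ n → trans (coeff-· (c + d) f n) (trans (distribʳ _ _ _)
    (sym (trans (coeff-⊕ (c · f) (d · f) n) (+-cong (coeff-· c f n) (coeff-· d f n)))))

  ·-assoc : ∀ c d f → (c * d) · f ≋ c · (d · f)
  ·-assoc c d f = mk≋ λ n → trans (coeff-· (c * d) f n) (trans (*-assoc _ _ _)
    (sym (trans (coeff-· c (d · f) n) (*-congˡ (coeff-· d f n)))))

  ·-zeroˡ : ∀ {c} → c ≈ 0# → ∀ f → c · f ≋ []
  ·-zeroˡ {c} e f = mk≋ λ n → trans (coeff-· c f n) (trans (*-congʳ e) (zeroˡ _))

  ·-identityˡ : ∀ f → 1# · f ≋ f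
  ·-identityˡ f = mk≋ λ n → trans (coeff-· 1# f n) (*-identityˡ _)

  map-s-⊕ : ∀ f g → map s (f ⊕ g) ≋ map s f ⊕ map s g
  map-s-⊕ f g = mk≋ λ n → trans (coeff-s (f ⊕ g) n) (trans (s.⟦⟧-cong (coeff-⊕ f g n)) (trans (s.+-homo _ _)
    (sym (trans (coeff-⊕ (map s f) (map s g) n) (+-cong (coeff-s f n) (coeff-s g n))))))

  map-s-· : ∀ c f → map s (c · f) ≋ s c · map s f
  map-s-· c f = mk≋ λ n → trans (coeff-s (c · f) n) (trans (s.⟦⟧-cong (coeff-· c f n)) (trans (s.*-homo _ _)
    (sym (trans (coeff-· (s c) (map s f) n) (*-congˡ (coeff-s f n))))))

  0∷-⊕ : ∀ f g → 0# ∷ (f ⊕ g) ≋ (0# ∷ f) ⊕ (0# ∷ g)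
  0∷-⊕ f g = ∷-cong (sym (+-identityˡ 0#)) ≋-refl

  0∷-cong : ∀ {f g} → f ≋ g → 0# ∷ f ≋ 0# ∷ g
  0∷-cong = ∷-cong refl

  ⊛-congʳ : ∀ f {g g′} → g ≋ g′ → f ⊛ g ≋ f ⊛ g′
  ⊛-congʳ []      e = ≋-refl
  ⊛-congʳ (c ∷ f) e = ⊕-cong (·-cong refl e) (0∷-cong (⊛-congʳ f (map-s-cong e)))

  ⊛-zeroˡ : ∀ f {g} → f ≋ [] → f ⊛ g ≋ []
  ⊛-zeroˡ []      e = ≋-refl
  ⊛-zeroˡ (c ∷ f) {g} e = ⊕-cong (·-zeroˡ (coeff-≈ e zero) g)
    (0∷[]≋[] refl (⊛-zeroˡ f (mk≋ λ n → coeff-≈ e (suc n))))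

  ⊛-congˡ : ∀ f f′ {g} → f ≋ f′ → f ⊛ g ≋ f′ ⊛ g
  ⊛-congˡ []      f′       e = ≋-sym (⊛-zeroˡ f′ (≋-sym e))
  ⊛-congˡ (c ∷ f) []       e = ⊛-zeroˡ (c ∷ f) e
  ⊛-congˡ (c ∷ f) (d ∷ f′) e = ⊕-cong (·-cong (head≈ e) ≋-refl) (0∷-cong (⊛-congˡ f f′ (tail≋ e)))

  ⊛-cong : ∀ {f f′ g g′} → f ≋ f′ → g ≋ g′ → f ⊛ g ≋ f′ ⊛ g′
  ⊛-cong {f} {f′} e e′ = ≋-trans (⊛-congˡ f f′ e) (⊛-congʳ f′ e′)

  ⊛-distribʳ : ∀ h f g → (f ⊕ g) ⊛ h ≋ (f ⊛ h) ⊕ (g ⊛ h)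
  ⊛-distribʳ h []      g       = ≋-refl
  ⊛-distribʳ h (c ∷ f) []      = ≋-sym (⊕-identityʳ _)
  ⊛-distribʳ h (c ∷ f) (d ∷ g) = begin
    ((c + d) · h) ⊕ (0# ∷ ((f ⊕ g) ⊛ map s h))
      ≈⟨ ⊕-cong (·-distribʳ c d h) (≋-trans (0∷-cong (⊛-distribʳ (map s h) f g)) (0∷-⊕ (f ⊛ map s h) (g ⊛ map s h))) ⟩
    ((c · h) ⊕ (d · h)) ⊕ ((0# ∷ (f ⊛ map s h)) ⊕ (0# ∷ (g ⊛ map s h)))
      ≈⟨ ⊕.interchange (c · h) (d · h) (0# ∷ (f ⊛ map s h)) (0# ∷ (g ⊛ map s h)) ⟩
    ((c · h) ⊕ (0# ∷ (f ⊛ map s h))) ⊕ ((d · h) ⊕ (0# ∷ (g ⊛ map s h))) ∎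
    where open ≋-Reasoning

  ⊛-distribˡ : ∀ f g h → f ⊛ (g ⊕ h) ≋ (f ⊛ g) ⊕ (f ⊛ h)
  ⊛-distribˡ []      g h = ≋-refl
  ⊛-distribˡ (c ∷ f) g h = begin
    (c · (g ⊕ h)) ⊕ (0# ∷ (f ⊛ map s (g ⊕ h)))
      ≈⟨ ⊕-cong (·-distribˡ c g h) (≋-trans (0∷-cong (≋-trans (⊛-congʳ f (map-s-⊕ g h))
           (⊛-distribˡ f (map s g) (map s h)))) (0∷-⊕ (f ⊛ map s g) (f ⊛ map s h))) ⟩
    ((c · g) ⊕ (c · h)) ⊕ ((0# ∷ (f ⊛ map s g)) ⊕ (0# ∷ (f ⊛ map s h)))
      ≈⟨ ⊕.interchange (c · g) (c · h) (0# ∷ (f ⊛ map s g)) (0# ∷ (f ⊛ map s h)) ⟩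
    ((c · g) ⊕ (0# ∷ (f ⊛ map s g))) ⊕ ((c · h) ⊕ (0# ∷ (f ⊛ map s h))) ∎
    where open ≋-Reasoning

  ·-0∷ : ∀ c f → c · (0# ∷ f) ≋ 0# ∷ (c · f)
  ·-0∷ c f = ∷-cong (zeroʳ c) ≋-refl

  ·-⊛ : ∀ c f g → (c · f) ⊛ g ≋ c · (f ⊛ g)
  ·-⊛ c []      g = ≋-refl
  ·-⊛ c (d ∷ f) g = ≋-trans
    (⊕-cong (·-assoc c d g) (≋-trans (0∷-cong (·-⊛ c f (map s g))) (≋-sym (·-0∷ c _))))
    (≋-sym (·-distribˡ c (d · g) (0# ∷ (f ⊛ map s g))))

  0∷-⊛ : ∀ f g → (0# ∷ f) ⊛ g ≋ 0# ∷ (f ⊛ map s g)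
  0∷-⊛ f g = ⊕-cong (·-zeroˡ refl g) ≋-refl

  map-s-⊛ : ∀ f g → map s (f ⊛ g) ≋ map s f ⊛ map s g
  map-s-⊛ []      g = ≋-refl
  map-s-⊛ (c ∷ f) g = ≋-trans (map-s-⊕ (c · g) _)
    (⊕-cong (map-s-· c g) (∷-cong s.0#-homo (map-s-⊛ f (map s g))))

  ⊛-assoc : ∀ f g h → (f ⊛ g) ⊛ h ≋ f ⊛ (g ⊛ h)
  ⊛-assoc []      g h = ≋-refl
  ⊛-assoc (c ∷ f) g h = begin
    ((c · g) ⊕ (0# ∷ (f ⊛ map s g))) ⊛ h
      ≈⟨ ⊛-distribʳ h (c · g) _ ⟩
    ((c · g) ⊛ h) ⊕ ((0# ∷ (f ⊛ map s g)) ⊛ h)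
      ≈⟨ ⊕-cong (·-⊛ c g h) (0∷-⊛ (f ⊛ map s g) h) ⟩
    (c · (g ⊛ h)) ⊕ (0# ∷ ((f ⊛ map s g) ⊛ map s h))
      ≈⟨ ⊕-congˡ (c · (g ⊛ h)) (0∷-cong (≋-trans (⊛-assoc f (map s g) (map s h))
           (⊛-congʳ f (≋-sym (map-s-⊛ g h))))) ⟩
    (c · (g ⊛ h)) ⊕ (0# ∷ (f ⊛ map s (g ⊛ h))) ∎
    where open ≋-Reasoning

  ⊛-identityˡ : ∀ f → constant 1# ⊛ f ≋ f
  ⊛-identityˡ f = ≋-trans (⊕-cong (·-identityˡ f) (0∷[]≋[] refl ≋-refl)) (⊕-identityʳ f)

  ⊛-constant-1 : ∀ f {c} → c ≈ 1# → f ⊛ constant c ≋ f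
  ⊛-constant-1 []      e = ≋-refl
  ⊛-constant-1 (d ∷ f) e = ∷-cong (trans (+-identityʳ _) (trans (*-congˡ e) (*-identityʳ d)))
    (⊛-constant-1 f (trans (s.⟦⟧-cong e) s.1#-homo))

  polyRing : Ring a ℓa
  polyRing = record
    { _≈_ = _≋_ ; _+_ = _⊕_ ; _*_ = _⊛_ ; -_ = ⊖_ ; 0# = [] ; 1# = constant 1#
    ; isRing = record
      { +-isAbelianGroup = AbelianGroup.isAbelianGroup ⊕-abelianGroup
      ; *-cong = ⊛-cong
      ; *-assoc = ⊛-assoc
      ; *-identity = ⊛-identityˡ , λ f → ⊛-constant-1 f refl
      ; distrib = ⊛-distribˡ , ⊛-distribʳ } }

  constant-isRingHom : IsRingHom ring polyRing constant
  constant-isRingHom = mkIsRingHom ring polyRing constant (λ e → ∷-cong e ≋-refl)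
    (λ _ _ → ≋-refl)
    (λ c d → ∷-cong (sym (+-identityʳ _)) ≋-refl)
    ≋-refl

module Polynomial (R : CommutativeRing a ℓa) where

  open CommutativeRing R hiding (zero)

  open SkewPolynomial R id (Identity.isRingHomomorphism rawRing refl) public renaming (X to t)

  private
    module ⊕ = CommutativeSemigroupProperties (AbelianGroup.commutativeSemigroup ⊕-abelianGroup)

  map-id≋ : ∀ f → map id f ≋ f
  map-id≋ f = mk≋ (coeff-s f)

  ⊛-∷ : ∀ f d g → f ⊛ (d ∷ g) ≋ (d · f) ⊕ (0# ∷ (f ⊛ g))
  ⊛-∷ []      d g = mk≋ λ { zero → refl ; (suc n) → refl }
  ⊛-∷ (c ∷ f) d g = ∷-cong (+-congʳ (*-comm c d)) (begin
    (c · g) ⊕ (f ⊛ (d ∷ map id g))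
      ≈⟨ ⊕-congˡ (c · g) (≋-trans (⊛-congʳ f (∷-cong refl (map-id≋ g))) (⊛-∷ f d g)) ⟩
    (c · g) ⊕ ((d · f) ⊕ (0# ∷ (f ⊛ g)))
      ≈⟨ ⊕.x∙yz≈y∙xz (c · g) (d · f) (0# ∷ (f ⊛ g)) ⟩
    (d · f) ⊕ ((c · g) ⊕ (0# ∷ (f ⊛ g)))
      ≈⟨ ⊕-congˡ (d · f) (⊕-congˡ (c · g) (0∷-cong (⊛-congʳ f (≋-sym (map-id≋ g))))) ⟩
    (d · f) ⊕ ((c · g) ⊕ (0# ∷ (f ⊛ map id g))) ∎)
    where open Relation.Binary.Reasoning.Setoid ≋-setoid

  ⊛-comm : ∀ f g → f ⊛ g ≋ g ⊛ f
  ⊛-comm f []      = ⊛-zeroʳ f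
    where
    ⊛-zeroʳ : ∀ f → f ⊛ [] ≋ []
    ⊛-zeroʳ []      = ≋-refl
    ⊛-zeroʳ (c ∷ f) = 0∷[]≋[] refl (⊛-zeroʳ f)
  ⊛-comm f (d ∷ g) = ≋-trans (⊛-∷ f d g)
    (⊕-congˡ (d · f) (0∷-cong (≋-trans (⊛-comm f g) (⊛-congʳ g (≋-sym (map-id≋ f))))))

  polyCommutativeRing : CommutativeRing a ℓa
  polyCommutativeRing = record { isCommutativeRing = record { isRing = Ring.isRing polyRing ; *-comm = ⊛-comm } }

module Matrices (R : Ring a ℓa) where

  open Ring R hiding (zero)

  Mat : ℕ → ℕ → Set a
  Mat d e = Fin d → Fin e → Carrier

  infix 4 _≈ₘ_
  _≈ₘ_ : ∀ {d e} → Mat d e → Mat d e → Set ℓa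
  M ≈ₘ N = ∀ i j → M i j ≈ N i j

  infixl 7 _*ₘ_
  _*ₘ_ : ∀ {c d e} → Mat c d → Mat d e → Mat c e
  (M *ₘ N) i k = RawMonoidDefs.sum +-rawMonoid (λ j → M i j * N j k)

  scalar : ∀ {d} → Carrier → Mat d d
  scalar c i j = if ⌊ i Fin.≟ j ⌋ then c else 0#

  matRawRing : ℕ → RawRing a ℓa
  matRawRing d = record
    { Carrier = Mat d d ; _≈_ = _≈ₘ_
    ; _+_ = λ M N i j → M i j + N i j ; _*_ = _*ₘ_ ; -_ = λ M i j → - M i j
    ; 0# = λ _ _ → 0# ; 1# = scalar 1# }

  IsNilpotent : ∀ {d} → Mat d d → Set ℓa
  IsNilpotent {d} N = ∃ λ n → RawSemiringDefs._^_ (RawRing.rawSemiring (matRawRing d)) N n ≈ₘ RawRing.0# (matRawRing d)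

module _ {R : Ring a ℓa} (M : LeftModule R b ℓb) where
  open LeftModule M
  private
    module R = Ring R
    module G = AbelianGroupProperties +ᴹ-abelianGroup
    module C = CommutativeSemigroupProperties (AbelianGroup.commutativeSemigroup +ᴹ-abelianGroup)

  record IsSubmodule {ℓ} (P : Carrierᴹ → Set ℓ) : Set (a ⊔ b ⊔ ℓb ⊔ ℓ) where
    field
      respects  : ∀ {x y} → x ≈ᴹ y → P x → P y
      0-closed  : P 0ᴹ
      +-closed  : ∀ {x y} → P x → P y → P (x +ᴹ y)
      neg-closed : ∀ {x} → P x → P (-ᴹ x)
      *-closed  : ∀ r {x} → P x → P (r *ₗ x)

  module _ {P : Carrierᴹ → Set ℓ} (P-isSubmodule : IsSubmodule P) where
    open IsSubmodule P-isSubmodule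

    submodule : LeftModule R (b ⊔ ℓ) ℓb
    submodule = record
      { Carrierᴹ = Σ Carrierᴹ P
      ; _≈ᴹ_ = λ x y → proj₁ x ≈ᴹ proj₁ y
      ; _+ᴹ_ = λ (x , px) (y , py) → x +ᴹ y , +-closed px py
      ; _*ₗ_ = λ r (x , px) → r *ₗ x , *-closed r px
      ; 0ᴹ = 0ᴹ , 0-closed
      ; -ᴹ_ = λ (x , px) → -ᴹ x , neg-closed px
      ; isLeftModule = record
        { isLeftSemimodule = record
          { +ᴹ-isCommutativeMonoid = record
            { isMonoid = record
              { isSemigroup = record
                { isMagma = record
                  { isEquivalence = record { refl = ≈ᴹ-refl ; sym = ≈ᴹ-sym ; trans = ≈ᴹ-trans }
                  ; ∙-cong = +ᴹ-cong }
                ; assoc = λ x y z → +ᴹ-assoc _ _ _ }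
              ; identity = (λ x → +ᴹ-identityˡ _) , (λ x → +ᴹ-identityʳ _) }
            ; comm = λ x y → +ᴹ-comm _ _ }
          ; isPreleftSemimodule = record
            { *ₗ-cong = *ₗ-cong
            ; *ₗ-zeroˡ = λ x → *ₗ-zeroˡ _
            ; *ₗ-distribʳ = λ x r s → *ₗ-distribʳ _ _ _
            ; *ₗ-identityˡ = λ x → *ₗ-identityˡ _
            ; *ₗ-assoc = λ r s x → *ₗ-assoc _ _ _
            ; *ₗ-zeroʳ = λ r → *ₗ-zeroʳ _
            ; *ₗ-distribˡ = λ r x y → *ₗ-distribˡ _ _ _ } }
        ; -ᴹ‿cong = -ᴹ‿cong
        ; -ᴹ‿inverse = (λ x → -ᴹ‿inverseˡ _) , (λ x → -ᴹ‿inverseʳ _) } }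

    infix 4 _~_
    record _~_ (x y : Carrierᴹ) : Set ℓ where
      constructor mk~
      field difference : P (x +ᴹ -ᴹ y)
    open _~_ public

    private
      ≈⇒~ : ∀ {x y} → x ≈ᴹ y → x ~ y
      ≈⇒~ {x} {y} e = mk~ (respects (≈ᴹ-sym (≈ᴹ-trans (+ᴹ-cong e ≈ᴹ-refl) (-ᴹ‿inverseʳ y))) 0-closed)

      ~-sym : ∀ {x y} → x ~ y → y ~ x
      ~-sym {x} {y} (mk~ h) = mk~ (respects
        (≈ᴹ-trans (G.⁻¹-anti-homo‿- x y) ≈ᴹ-refl) (neg-closed h))

      ~-trans : ∀ {x y z} → x ~ y → y ~ z → x ~ z
      ~-trans {x} {y} {z} (mk~ h) (mk~ h′) = mk~ (respects
        (≈ᴹ-trans (+ᴹ-assoc x (-ᴹ y) (y +ᴹ -ᴹ z)) (+ᴹ-cong ≈ᴹ-refl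
          (≈ᴹ-trans (≈ᴹ-sym (+ᴹ-assoc (-ᴹ y) y (-ᴹ z))) (≈ᴹ-trans (+ᴹ-cong (-ᴹ‿inverseˡ y) ≈ᴹ-refl) (+ᴹ-identityˡ _)))))
        (+-closed h h′))

      ~-+ : ∀ {x x′ y y′} → x ~ x′ → y ~ y′ → (x +ᴹ y) ~ (x′ +ᴹ y′)
      ~-+ {x} {x′} {y} {y′} (mk~ h) (mk~ h′) = mk~ (respects
        (≈ᴹ-trans (C.interchange x (-ᴹ x′) y (-ᴹ y′)) (+ᴹ-cong ≈ᴹ-refl (G.⁻¹-∙-comm x′ y′)))
        (+-closed h h′))

      ~-neg : ∀ {x x′} → x ~ x′ → (-ᴹ x) ~ (-ᴹ x′)
      ~-neg {x} {x′} (mk~ h) = mk~ (respects (≈ᴹ-sym (G.⁻¹-∙-comm x (-ᴹ x′))) (neg-closed h))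

      ~-* : ∀ {r r′ x x′} → r R.≈ r′ → x ~ x′ → (r *ₗ x) ~ (r′ *ₗ x′)
      ~-* {r} {r′} {x} {x′} e (mk~ h) = mk~ (respects
        (≈ᴹ-trans (*ₗ-distribˡ r x (-ᴹ x′)) (+ᴹ-cong ≈ᴹ-refl
          (≈ᴹ-trans (G.inverseʳ-unique (r *ₗ x′) (r *ₗ (-ᴹ x′))
            (≈ᴹ-trans (≈ᴹ-sym (*ₗ-distribˡ r x′ (-ᴹ x′))) (≈ᴹ-trans (*ₗ-cong R.refl (-ᴹ‿inverseʳ x′)) (*ₗ-zeroʳ r))))
            (-ᴹ‿cong (*ₗ-cong e ≈ᴹ-refl)))))
        (*-closed r h))

    quotient : LeftModule R b ℓ
    quotient = record
      { Carrierᴹ = Carrierᴹ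
      ; _≈ᴹ_ = _~_
      ; _+ᴹ_ = _+ᴹ_
      ; _*ₗ_ = _*ₗ_
      ; 0ᴹ = 0ᴹ
      ; -ᴹ_ = -ᴹ_
      ; isLeftModule = record
        { isLeftSemimodule = record
          { +ᴹ-isCommutativeMonoid = record
            { isMonoid = record
              { isSemigroup = record
                { isMagma = record
                  { isEquivalence = record { refl = ≈⇒~ ≈ᴹ-refl ; sym = ~-sym ; trans = ~-trans }
                  ; ∙-cong = ~-+ }
                ; assoc = λ x y z → ≈⇒~ (+ᴹ-assoc x y z) }
              ; identity = (λ x → ≈⇒~ (+ᴹ-identityˡ x)) , (λ x → ≈⇒~ (+ᴹ-identityʳ x)) }
            ; comm = λ x y → ≈⇒~ (+ᴹ-comm x y) }
          ; isPreleftSemimodule = record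
            { *ₗ-cong = ~-*
            ; *ₗ-zeroˡ = λ x → ≈⇒~ (*ₗ-zeroˡ x)
            ; *ₗ-distribʳ = λ x r s → ≈⇒~ (*ₗ-distribʳ x r s)
            ; *ₗ-identityˡ = λ x → ≈⇒~ (*ₗ-identityˡ x)
            ; *ₗ-assoc = λ r s x → ≈⇒~ (*ₗ-assoc r s x)
            ; *ₗ-zeroʳ = λ r → ≈⇒~ (*ₗ-zeroʳ r)
            ; *ₗ-distribˡ = λ r x y → ≈⇒~ (*ₗ-distribˡ r x y) } }
        ; -ᴹ‿cong = ~-neg
        ; -ᴹ‿inverse = (λ x → ≈⇒~ (-ᴹ‿inverseˡ x)) , (λ x → ≈⇒~ (-ᴹ‿inverseʳ x)) } }

private variable
  f ℓf ℓf# k ℓk ℓk# : Level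

fieldRing : ∀ {a ℓ ℓ#} → HeytingField a ℓ ℓ# → CommutativeRing a ℓ
fieldRing F = HeytingCommutativeRing.commutativeRing (HeytingField.heytingCommutativeRing F)

-- Only the ring homomorphism ι is recorded: K is an 𝔽_q-algebra, and ι a homomorphism of
-- 𝔽_q-algebras, through the restriction of ι to the constants 𝔽_q ⊂ 𝔽_q[t].
record PerfectAField f ℓf ℓf# k ℓk ℓk# : Set (lsuc (f ⊔ ℓf ⊔ ℓf# ⊔ k ⊔ ℓk ⊔ ℓk#)) where
  field
    p m         : ℕ
    p-prime     : Prime p
    𝔽q          : HeytingField f ℓf ℓf#
    𝔽q-card     : Inverse (CommutativeRing.setoid (fieldRing 𝔽q)) (≡.setoid (Fin (p ℕ.^ m)))
    K           : HeytingField k ℓk ℓk#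
    K-char      : HasCharacteristic (fieldRing K) p
    K-perfect   : IsPerfect (fieldRing K) p
    ι           : List (HeytingField.Carrier 𝔽q) → HeytingField.Carrier K
    ι-isRingHom : IsRingHom (Polynomial.polyRing (fieldRing 𝔽q)) (CommutativeRing.ring (fieldRing K)) ι

  q : ℕ
  q = p ℕ.^ m

  K-ring : CommutativeRing k ℓk
  K-ring = fieldRing K

  module K where
    open CommutativeRing K-ring public
    open HeytingField K public using (_#_)

  module A where
    open Polynomial (fieldRing 𝔽q) public using (t; constant; polyCommutativeRing)
    open CommutativeRing polyCommutativeRing public

  θ : K.Carrier
  θ = ι A.t

  ι₀ : HeytingField.Carrier 𝔽q → K.Carrier
  ι₀ c = ι (A.constant c)

  τ : K.Carrier → K.Carrier
  τ x = _^_ K-ring x q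

  τ-isRingHom : IsRingHom K.ring K.ring τ
  τ-isRingHom = Frobenius.^q-isRingHom K-ring p-prime K-char m

  σ : K.Carrier → K.Carrier
  σ = Root.root K-ring {p} K-perfect m

  σ-isRingHom : IsRingHom K.ring K.ring σ
  σ-isRingHom = Root.root-isRingHom K-ring {p} K-perfect p-prime K-char m

-- The common shape of 𝐭-modules (s = τ) and 𝐭^σ-modules (s = σ).
module TwistedModules (𝒦 : PerfectAField f ℓf ℓf# k ℓk ℓk#)
  (s : CommutativeRing.Carrier (PerfectAField.K-ring 𝒦) → CommutativeRing.Carrier (PerfectAField.K-ring 𝒦))
  (s-isRingHom : IsRingHom (CommutativeRing.ring (PerfectAField.K-ring 𝒦)) (CommutativeRing.ring (PerfectAField.K-ring 𝒦)) s)
  where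

  open PerfectAField 𝒦

  module K[s] = SkewPolynomial K-ring s s-isRingHom
  module Matₛ = Matrices K[s].polyRing
  module Matₖ = Matrices K.ring

  record TwistedModule (d : ℕ) : Set (f ⊔ ℓf ⊔ k ⊔ ℓk) where
    field
      ⟦_⟧           : A.Carrier → Matₛ.Mat d d
      isRingHom     : RingMorphisms.IsRingHomomorphism A.rawRing (Matₛ.matRawRing d) ⟦_⟧
      𝔽q-linear     : ∀ c → ⟦ A.constant c ⟧ Matₛ.≈ₘ Matₛ.scalar (K[s].constant (ι₀ c))
      N             : Matₖ.Mat d d
      N-nilpotent   : Matₖ.IsNilpotent N
      constant-term : ∀ i j → K[s].coeff (⟦ A.t ⟧ i j) 0 K.≈ Matₖ.scalar θ i j K.+ N i j

    open RingMorphisms.IsRingHomomorphism isRingHom public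

  -- r is the degree of ⟦ t ⟧; a relation, because the degree is computable only when apartness
  -- from 0 is decidable.
  HasRank : ∀ {d} → TwistedModule d → ℕ → Set (ℓk ⊔ ℓk#)
  HasRank Φ r =
      (∃ λ i → ∃ λ j → K[s].coeff (⟦ A.t ⟧ i j) r K.# K.0#)
    × (∀ n → r ℕ.< n → ∀ i j → K[s].coeff (⟦ A.t ⟧ i j) n K.≈ K.0#)
    where open TwistedModule Φ

module TModules (𝒦 : PerfectAField f ℓf ℓf# k ℓk ℓk#) where

  open PerfectAField 𝒦 public

  open TwistedModules 𝒦 τ τ-isRingHom public using (HasRank)
    renaming (module K[s] to K⟨τ⟩; TwistedModule to TModule)
  open TwistedModules 𝒦 σ σ-isRingHom public using (module Matₖ)
    renaming (module K[s] to K⟨σ⟩; module Matₛ to Matσ; TwistedModule to TσModule)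


  𝔾ₐ : TσModule 1
  𝔾ₐ = record
    { ⟦_⟧ = λ a _ _ → K⟨σ⟩.constant (ι a)
    ; isRingHom = record
      { isSemiringHomomorphism = record
        { isNearSemiringHomomorphism = record
          { +-isMonoidHomomorphism = record
            { isMagmaHomomorphism = record
              { isRelHomomorphism = record { cong = λ e _ _ → c.⟦⟧-cong (ι.⟦⟧-cong e) }
              ; homo = λ a b _ _ → K⟨σ⟩.≋-trans (c.⟦⟧-cong (ι.+-homo a b)) (c.+-homo (ι a) (ι b)) }
            ; ε-homo = λ _ _ → K⟨σ⟩.≋-trans (c.⟦⟧-cong ι.0#-homo) c.0#-homo }
          ; *-homo = λ a b _ _ → K⟨σ⟩.≋-trans (c.⟦⟧-cong (ι.*-homo a b))
              (K⟨σ⟩.≋-trans (c.*-homo (ι a) (ι b)) (K⟨σ⟩.≋-sym (K⟨σ⟩.⊕-identityʳ _))) }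
        ; 1#-homo = λ { zero zero → c.⟦⟧-cong ι.1#-homo } }
      ; -‿homo = λ a _ _ → K⟨σ⟩.≋-trans (c.⟦⟧-cong (ι.-‿homo a)) (c.-‿homo (ι a)) }
    ; 𝔽q-linear = λ { c zero zero → K⟨σ⟩.≋-refl }
    ; N = λ _ _ → K.0#
    ; N-nilpotent = 1 , λ { zero zero → K.trans (K.+-identityʳ _) (K.zeroˡ _) }
    ; constant-term = λ { zero zero → K.sym (K.+-identityʳ θ) }
    }
    where
    module ι = RingMorphisms.IsRingHomomorphism ι-isRingHom
    module c = RingMorphisms.IsRingHomomorphism K⟨σ⟩.constant-isRingHom

  record Morphism {e d} (Ψ : TσModule e) (Φ : TσModule d) : Set (k ⊔ ℓk) where
    field
      matrix   : Matσ.Mat d e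
      commutes : (matrix Matσ.*ₘ TσModule.⟦_⟧ Ψ A.t) Matσ.≈ₘ (TσModule.⟦_⟧ Φ A.t Matσ.*ₘ matrix)

  record PerfectAlgebra : Set (lsuc (k ⊔ ℓk)) where
    field
      ring       : CommutativeRing k ℓk
      algebraMap : K.Carrier → CommutativeRing.Carrier ring
      isRingHom  : IsRingHom K.ring (CommutativeRing.ring ring) algebraMap
      perfect    : IsPerfect ring p

  K-algebra : PerfectAlgebra
  K-algebra = record
    { ring = K-ring ; algebraMap = id
    ; isRingHom = Identity.isRingHomomorphism K.rawRing K.refl ; perfect = K-perfect }

  module Points (R : PerfectAlgebra) where
    open PerfectAlgebra R
    open CommutativeRing ring hiding (ring; zero)
    private
      module h = RingMorphisms.IsRingHomomorphism isRingHom
      module KE = Exp K.semiring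
      module RE = Exp semiring
      module S = CommutativeMonoidSum +-commutativeMonoid
      module KR = Root K-ring {p} K-perfect
      module RR = Root ring {p} perfect
      open K⟨σ⟩

    σᴿ : Carrier → Carrier
    σᴿ = Root.root ring {p} perfect m

    eval : Poly → Carrier → Carrier
    eval []      x = 0#
    eval (c ∷ f) x = algebraMap c * x + eval f (σᴿ x)

    Vec : ℕ → Set k
    Vec d = Fin d → Carrier

    infix 4 _≈ᵥ_
    _≈ᵥ_ : ∀ {d} → Vec d → Vec d → Set ℓk
    x ≈ᵥ y = ∀ i → x i ≈ y i

    0ᵥ : ∀ {d} → Vec d
    0ᵥ _ = 0#

    apply : ∀ {d e} → Matσ.Mat d e → Vec e → Vec d
    apply M x i = RawMonoidDefs.sum (CommutativeMonoid.rawMonoid +-commutativeMonoid) (λ j → eval (M i j) (x j))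

    h-^ : ∀ x n → algebraMap (_^_ K-ring x n) ≈ _^_ ring (algebraMap x) n
    h-^ x zero    = h.1#-homo
    h-^ x (suc n) = trans (h.*-homo _ _) (*-congˡ (h-^ x n))

    h-× : ∀ n x → algebraMap (RawSemiringDefs._×_ (Semiring.rawSemiring K.semiring) n x)
                ≈ RawSemiringDefs._×_ (Semiring.rawSemiring semiring) n (algebraMap x)
    h-× zero    x = h.0#-homo
    h-× (suc n) x = trans (h.+-homo _ _) (+-congˡ (h-× n x))

    char : HasCharacteristic ring p
    char = trans (trans (Mult.×-congʳ semiring p (sym h.1#-homo)) (sym (h-× p K.1#)))
      (trans (h.⟦⟧-cong K-char) h.0#-homo)

    σᴿ-isRingHom : IsRingHom (CommutativeRing.ring ring) (CommutativeRing.ring ring) σᴿ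
    σᴿ-isRingHom = RR.root-isRingHom p-prime char m

    private module σᴿ = RingMorphisms.IsRingHomomorphism σᴿ-isRingHom

    σᴿ-h : ∀ c → σᴿ (algebraMap c) ≈ algebraMap (σ c)
    σᴿ-h c = proj₁ (RR.^q-bijective m) (trans (RR.root-^q m _)
      (trans (h.⟦⟧-cong (K.sym (KR.root-^q m c))) (h-^ (σ c) q)))

    eval-≋[] : ∀ f x → f ≋ [] → eval f x ≈ 0#
    eval-≋[] []      x e = refl
    eval-≋[] (c ∷ f) x e = trans (+-cong
      (trans (*-congʳ (trans (h.⟦⟧-cong (coeff-≈ e 0)) h.0#-homo)) (zeroˡ x))
      (eval-≋[] f (σᴿ x) (mk≋ λ n → coeff-≈ e (suc n)))) (+-identityˡ 0#)

    eval-cong : ∀ f g {x y} → f ≋ g → x ≈ y → eval f x ≈ eval g y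
    eval-cong []      g       {y = y} e e′ = sym (eval-≋[] g y (≋-sym e))
    eval-cong (c ∷ f) []      {x = x} e e′ = eval-≋[] (c ∷ f) x e
    eval-cong (c ∷ f) (d ∷ g) e e′ = +-cong (*-cong (h.⟦⟧-cong (head≈ e)) e′)
      (eval-cong f g (tail≋ e) (σᴿ.⟦⟧-cong e′))

    eval-+ : ∀ f x y → eval f (x + y) ≈ eval f x + eval f y
    eval-+ []      x y = sym (+-identityˡ 0#)
    eval-+ (c ∷ f) x y = trans (+-cong (distribˡ _ x y)
        (trans (eval-cong f f ≋-refl (σᴿ.+-homo x y)) (eval-+ f (σᴿ x) (σᴿ y))))
      (+-interchange _ _ _ _)
      where open CommutativeSemigroupProperties +-commutativeSemigroup renaming (interchange to +-interchange)

    eval-0 : ∀ f → eval f 0# ≈ 0#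
    eval-0 []      = refl
    eval-0 (c ∷ f) = trans (+-cong (zeroʳ _) (trans (eval-cong f f ≋-refl σᴿ.0#-homo) (eval-0 f))) (+-identityˡ 0#)

    eval-⊕ : ∀ f g x → eval (f ⊕ g) x ≈ eval f x + eval g x
    eval-⊕ []      g       x = sym (+-identityˡ _)
    eval-⊕ (c ∷ f) []      x = sym (+-identityʳ _)
    eval-⊕ (c ∷ f) (d ∷ g) x = trans (+-cong (trans (*-congʳ (h.+-homo c d)) (distribʳ x _ _)) (eval-⊕ f g (σᴿ x)))
      (+-interchange _ _ _ _)
      where open CommutativeSemigroupProperties +-commutativeSemigroup renaming (interchange to +-interchange)

    eval-· : ∀ c f x → eval (c · f) x ≈ algebraMap c * eval f x
    eval-· c []      x = sym (zeroʳ _)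
    eval-· c (d ∷ f) x = trans (+-cong (trans (*-congʳ (h.*-homo c d)) (*-assoc _ _ x)) (eval-· c f (σᴿ x)))
      (sym (distribˡ _ _ _))

    eval-0∷ : ∀ f x → eval (K.0# ∷ f) x ≈ eval f (σᴿ x)
    eval-0∷ f x = trans (+-congʳ (trans (*-congʳ h.0#-homo) (zeroˡ x))) (+-identityˡ _)

    σᴿ-eval : ∀ f x → σᴿ (eval f x) ≈ eval (map σ f) (σᴿ x)
    σᴿ-eval []      x = σᴿ.0#-homo
    σᴿ-eval (c ∷ f) x = trans (σᴿ.+-homo _ _) (+-cong
      (trans (σᴿ.*-homo _ _) (*-congʳ (σᴿ-h c))) (σᴿ-eval f (σᴿ x)))

    eval-⊛ : ∀ f g x → eval (f ⊛ g) x ≈ eval f (eval g x)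
    eval-⊛ []      g x = refl
    eval-⊛ (c ∷ f) g x = trans (eval-⊕ (c · g) _ x) (+-cong (eval-· c g x)
      (trans (eval-0∷ (f ⊛ map σ g) x) (trans (eval-⊛ f (map σ g) (σᴿ x))
        (eval-cong f f ≋-refl (sym (σᴿ-eval g x))))))

    eval-1 : ∀ x → eval (constant K.1#) x ≈ x
    eval-1 x = trans (+-identityʳ _) (trans (*-congʳ h.1#-homo) (*-identityˡ x))

    eval-sum : ∀ f {n} (x : Vec n) → eval f (S.sum x) ≈ S.sum (λ j → eval f (x j))
    eval-sum f {zero}  x = eval-0 f
    eval-sum f {suc n} x = trans (eval-+ f _ _) (+-congˡ (eval-sum f (x ∘ suc)))

    eval-sumₗ : ∀ {n} (F : Fin n → Poly) x →
      eval (RawMonoidDefs.sum (Ring.+-rawMonoid polyRing) F) x ≈ S.sum (λ j → eval (F j) x)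
    eval-sumₗ {zero}  F x = refl
    eval-sumₗ {suc n} F x = trans (eval-⊕ (F zero) _ x) (+-congˡ (eval-sumₗ (F ∘ suc) x))

    apply-cong : ∀ {d e} {M N : Matσ.Mat d e} {x y} → M Matσ.≈ₘ N → x ≈ᵥ y → apply M x ≈ᵥ apply N y
    apply-cong {M = M} {N} e e′ i = S.sum-cong-≋ λ j → eval-cong (M i j) (N i j) (e i j) (e′ j)

    apply-+ : ∀ {d e} (M : Matσ.Mat d e) x y → apply M (λ j → x j + y j) ≈ᵥ (λ i → apply M x i + apply M y i)
    apply-+ M x y i = trans (S.sum-cong-≋ λ j → eval-+ (M i j) (x j) (y j))
      (S.∑-distrib-+ (λ j → eval (M i j) (x j)) (λ j → eval (M i j) (y j)))

    apply-0 : ∀ {d e} (M : Matσ.Mat d e) → apply M 0ᵥ ≈ᵥ 0ᵥ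
    apply-0 {e = e} M i = trans (S.sum-cong-≋ λ j → eval-0 (M i j)) (S.sum-replicate-zero e)

    apply-*ₘ : ∀ {c d e} (M : Matσ.Mat c d) (N : Matσ.Mat d e) x → apply (M Matσ.*ₘ N) x ≈ᵥ apply M (apply N x)
    apply-*ₘ M N x i = trans
      (S.sum-cong-≋ λ l → trans (eval-sumₗ (λ j → M i j ⊛ N j l) (x l))
        (S.sum-cong-≋ λ j → eval-⊛ (M i j) (N j l) (x l)))
      (trans (S.∑-comm (λ l j → eval (M i j) (eval (N j l) (x l))))
        (S.sum-cong-≋ λ j → sym (eval-sum (M i j) (λ l → eval (N j l) (x l)))))

    apply-1 : ∀ {d} (x : Vec d) → apply (Matσ.scalar (constant K.1#)) x ≈ᵥ x
    apply-1 {suc d} x zero = trans (+-cong (eval-1 (x zero)) (S.sum-replicate-zero d)) (+-identityʳ _)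
    apply-1 {suc d} x (suc i) = trans (+-identityˡ _)
      (trans (S.sum-cong-≋ λ j → lem j) (apply-1 (x ∘ suc) i))
      where
      lem : ∀ j → eval (Matσ.scalar (constant K.1#) (suc i) (suc j)) (x (suc j))
                ≈ eval (Matσ.scalar (constant K.1#) i j) (x (suc j))
      lem j with i Fin.≟ j
      ... | yes _ = refl
      ... | no  _ = refl

    apply-⊕ : ∀ {d e} (M N : Matσ.Mat d e) x →
      apply (λ i j → M i j ⊕ N i j) x ≈ᵥ (λ i → apply M x i + apply N x i)
    apply-⊕ M N x i = trans (S.sum-cong-≋ λ j → eval-⊕ (M i j) (N i j) (x j))
      (S.∑-distrib-+ (λ j → eval (M i j) (x j)) (λ j → eval (N i j) (x j)))

    points : ∀ {d} → TσModule d → LeftModule A.ring k ℓk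
    points {d} Φ = record
      { Carrierᴹ = Vec d
      ; _≈ᴹ_ = _≈ᵥ_
      ; _+ᴹ_ = λ x y i → x i + y i
      ; _*ₗ_ = λ a x → apply ⟦ a ⟧ x
      ; 0ᴹ = 0ᵥ
      ; -ᴹ_ = λ x i → - x i
      ; isLeftModule = record
        { isLeftSemimodule = record
          { +ᴹ-isCommutativeMonoid = record
            { isMonoid = record
              { isSemigroup = record
                { isMagma = record
                  { isEquivalence = record
                    { refl = λ i → refl ; sym = λ e i → sym (e i) ; trans = λ e e′ i → trans (e i) (e′ i) }
                  ; ∙-cong = λ e e′ i → +-cong (e i) (e′ i) }
                ; assoc = λ x y z i → +-assoc _ _ _ }
              ; identity = (λ x i → +-identityˡ _) , (λ x i → +-identityʳ _) }
            ; comm = λ x y i → +-comm _ _ }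
          ; isPreleftSemimodule = record
            { *ₗ-cong = λ e e′ → apply-cong (⟦⟧-cong e) e′
            ; *ₗ-zeroˡ = λ x i → trans (apply-cong {N = λ _ _ → []} 0#-homo (λ _ → refl) i) (S.sum-replicate-zero d)
            ; *ₗ-distribʳ = λ x a b i → trans (apply-cong (+-homo a b) (λ _ → refl) i) (apply-⊕ ⟦ a ⟧ ⟦ b ⟧ x i)
            ; *ₗ-identityˡ = λ x i → trans (apply-cong 1#-homo (λ _ → refl) i) (apply-1 x i)
            ; *ₗ-assoc = λ a b x i → trans (apply-cong (*-homo a b) (λ _ → refl) i) (apply-*ₘ ⟦ a ⟧ ⟦ b ⟧ x i)
            ; *ₗ-zeroʳ = λ a → apply-0 ⟦ a ⟧
            ; *ₗ-distribˡ = λ a x y → apply-+ ⟦ a ⟧ x y } }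
        ; -ᴹ‿cong = λ e i → -‿cong (e i)
        ; -ᴹ‿inverse = (λ x i → -‿inverseˡ _) , (λ x i → -‿inverseʳ _) } }
      where open TσModule Φ

  open Points K-algebra public using () renaming (points to MordellWeil)

  -- The groups underlying 𝐭^σ-modules are powers of the perfect additive group, so exactness
  -- is tested on the points over perfect K-algebras R.  Surjectivity of R-points is no
  -- stronger than surjectivity as a map of fpqc sheaves, because the kernel is the
  -- additive group underlying Φ₁ and its torsors over Spec R are trivial.
  record IsShortExact {c d e} {Φ₁ : TσModule c} {Φ₂ : TσModule d} {Φ₃ : TσModule e}
    (f : Morphism Φ₁ Φ₂) (g : Morphism Φ₂ Φ₃) : Set (lsuc (k ⊔ ℓk)) where
    field
      injective : ∀ R → let open Points R in
        Injective _≈ᵥ_ _≈ᵥ_ (apply (Morphism.matrix f))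
      exact : ∀ R → let open Points R in
        ∀ y → apply (Morphism.matrix g) y ≈ᵥ 0ᵥ ⇔ ∃ λ x → apply (Morphism.matrix f) x ≈ᵥ y
      surjective : ∀ R → let open Points R in
        Surjective _≈ᵥ_ _≈ᵥ_ (apply (Morphism.matrix g))

  DrinfeldModule : Set (f ⊔ ℓf ⊔ k ⊔ ℓk)
  DrinfeldModule = TModule 1

  infix 9 _⟨_⟩
  _⟨_⟩ : DrinfeldModule → A.Carrier → K⟨τ⟩.Poly
  φ ⟨ a ⟩ = TModule.⟦_⟧ φ a zero zero

  module Extensions (φ ψ : DrinfeldModule) where

    open K⟨τ⟩
    private
      module P = Ring polyRing
      module PP = RingProperties polyRing
      module φ = TModule φ
      module ψ = TModule ψ
      module C = CommutativeSemigroupProperties (AbelianGroup.commutativeSemigroup ⊕-abelianGroup)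

    record Derivation : Set (f ⊔ ℓf ⊔ k ⊔ ℓk) where
      field
        δ         : A.Carrier → Poly
        cong      : ∀ {a b} → a A.≈ b → δ a ≋ δ b
        +-homo    : ∀ a b → δ (a A.+ b) ≋ δ a ⊕ δ b
        𝔽q-linear : ∀ c a → δ (A.constant c A.* a) ≋ constant (ι₀ c) ⊛ δ a
        leibniz   : ∀ a b → δ (a A.* b) ≋ (ψ ⟨ a ⟩ ⊛ δ b) ⊕ (δ a ⊛ φ ⟨ b ⟩)

    open Derivation public

    private
      ψ-* : ∀ a b → ψ ⟨ a A.* b ⟩ ≋ ψ ⟨ a ⟩ ⊛ ψ ⟨ b ⟩
      ψ-* a b = ≋-trans (ψ.*-homo a b zero zero) (⊕-identityʳ _)

      ψ-comm : ∀ a b → ψ ⟨ a ⟩ ⊛ ψ ⟨ b ⟩ ≋ ψ ⟨ b ⟩ ⊛ ψ ⟨ a ⟩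
      ψ-comm a b = ≋-trans (≋-sym (ψ-* a b))
        (≋-trans (ψ.⟦⟧-cong (A.*-comm a b) zero zero) (ψ-* b a))

      ψ-swap : ∀ a b f → ψ ⟨ a ⟩ ⊛ (ψ ⟨ b ⟩ ⊛ f) ≋ ψ ⟨ b ⟩ ⊛ (ψ ⟨ a ⟩ ⊛ f)
      ψ-swap a b f = ≋-trans (≋-sym (⊛-assoc (ψ ⟨ a ⟩) (ψ ⟨ b ⟩) f))
        (≋-trans (⊛-cong (ψ-comm a b) ≋-refl) (⊛-assoc (ψ ⟨ b ⟩) (ψ ⟨ a ⟩) f))

      ψ-const : ∀ c → ψ ⟨ A.constant c ⟩ ≋ constant (ι₀ c)
      ψ-const c = ψ.𝔽q-linear c zero zero

      const-swap : ∀ a c f → ψ ⟨ a ⟩ ⊛ (constant (ι₀ c) ⊛ f) ≋ constant (ι₀ c) ⊛ (ψ ⟨ a ⟩ ⊛ f)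
      const-swap a c f = ≋-trans (⊛-congʳ (ψ ⟨ a ⟩) (⊛-cong (≋-sym (ψ-const c)) ≋-refl))
        (≋-trans (ψ-swap a (A.constant c) f) (⊛-cong (ψ-const c) ≋-refl))

    0ᴰ : Derivation
    0ᴰ = record
      { δ = λ _ → []
      ; cong = λ _ → ≋-refl
      ; +-homo = λ _ _ → ≋-refl
      ; 𝔽q-linear = λ c _ → ≋-sym (P.zeroʳ (constant (ι₀ c)))
      ; leibniz = λ a _ → ≋-sym (≋-trans (⊕-identityʳ _) (P.zeroʳ (ψ ⟨ a ⟩))) }

    infixl 6 _+ᴰ_
    _+ᴰ_ : Derivation → Derivation → Derivation
    D +ᴰ E = record
      { δ = λ a → δ D a ⊕ δ E a
      ; cong = λ e → ⊕-cong (cong D e) (cong E e)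
      ; +-homo = λ a b → ≋-trans (⊕-cong (+-homo D a b) (+-homo E a b))
          (C.interchange (δ D a) (δ D b) (δ E a) (δ E b))
      ; 𝔽q-linear = λ c a → ≋-trans (⊕-cong (𝔽q-linear D c a) (𝔽q-linear E c a))
          (≋-sym (⊛-distribˡ (constant (ι₀ c)) (δ D a) (δ E a)))
      ; leibniz = λ a b → ≋-trans (⊕-cong (leibniz D a b) (leibniz E a b))
          (≋-trans (C.interchange (ψ ⟨ a ⟩ ⊛ δ D b) (δ D a ⊛ φ ⟨ b ⟩) (ψ ⟨ a ⟩ ⊛ δ E b) (δ E a ⊛ φ ⟨ b ⟩))
            (⊕-cong (≋-sym (⊛-distribˡ (ψ ⟨ a ⟩) (δ D b) (δ E b)))
                    (≋-sym (⊛-distribʳ (φ ⟨ b ⟩) (δ D a) (δ E a))))) }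

    -ᴰ_ : Derivation → Derivation
    -ᴰ D = record
      { δ = λ a → ⊖ δ D a
      ; cong = λ e → ⊖-cong (cong D e)
      ; +-homo = λ a b → ≋-trans (⊖-cong (+-homo D a b)) (≋-sym (PP.-‿+-comm (δ D a) (δ D b)))
      ; 𝔽q-linear = λ c a → ≋-trans (⊖-cong (𝔽q-linear D c a)) (PP.-‿distribʳ-* (constant (ι₀ c)) (δ D a))
      ; leibniz = λ a b → ≋-trans (⊖-cong (leibniz D a b))
          (≋-trans (≋-sym (PP.-‿+-comm (ψ ⟨ a ⟩ ⊛ δ D b) (δ D a ⊛ φ ⟨ b ⟩)))
            (⊕-cong (PP.-‿distribʳ-* (ψ ⟨ a ⟩) (δ D b)) (PP.-‿distribˡ-* (δ D a) (φ ⟨ b ⟩)))) }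

    infixr 7 _*ᴰ_
    _*ᴰ_ : A.Carrier → Derivation → Derivation
    a *ᴰ D = record
      { δ = λ b → ψ ⟨ a ⟩ ⊛ δ D b
      ; cong = λ e → ⊛-congʳ (ψ ⟨ a ⟩) (cong D e)
      ; +-homo = λ b c → ≋-trans (⊛-congʳ (ψ ⟨ a ⟩) (+-homo D b c)) (⊛-distribˡ (ψ ⟨ a ⟩) (δ D b) (δ D c))
      ; 𝔽q-linear = λ c b → ≋-trans (⊛-congʳ (ψ ⟨ a ⟩) (𝔽q-linear D c b)) (const-swap a c (δ D b))
      ; leibniz = λ b c → ≋-trans (⊛-congʳ (ψ ⟨ a ⟩) (leibniz D b c))
          (≋-trans (⊛-distribˡ (ψ ⟨ a ⟩) (ψ ⟨ b ⟩ ⊛ δ D c) (δ D b ⊛ φ ⟨ c ⟩))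
            (⊕-cong (ψ-swap a b (δ D c)) (≋-sym (⊛-assoc (ψ ⟨ a ⟩) (δ D b) (φ ⟨ c ⟩))))) }

    Der : LeftModule A.ring (f ⊔ ℓf ⊔ k ⊔ ℓk) (f ⊔ ℓk)
    Der = record
      { Carrierᴹ = Derivation
      ; _≈ᴹ_ = λ D E → ∀ a → δ D a ≋ δ E a
      ; _+ᴹ_ = _+ᴰ_
      ; _*ₗ_ = _*ᴰ_
      ; 0ᴹ = 0ᴰ
      ; -ᴹ_ = -ᴰ_
      ; isLeftModule = record
        { isLeftSemimodule = record
          { +ᴹ-isCommutativeMonoid = record
            { isMonoid = record
              { isSemigroup = record
                { isMagma = record
                  { isEquivalence = record
                    { refl = λ a → ≋-refl ; sym = λ e a → ≋-sym (e a) ; trans = λ e e′ a → ≋-trans (e a) (e′ a) }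
                  ; ∙-cong = λ e e′ a → ⊕-cong (e a) (e′ a) }
                ; assoc = λ D E F a → ⊕-assoc (δ D a) (δ E a) (δ F a) }
              ; identity = (λ D a → ≋-refl) , (λ D a → ⊕-identityʳ (δ D a)) }
            ; comm = λ D E a → ⊕-comm (δ D a) (δ E a) }
          ; isPreleftSemimodule = record
            { *ₗ-cong = λ e e′ a → ⊛-cong (ψ.⟦⟧-cong e zero zero) (e′ a)
            ; *ₗ-zeroˡ = λ D a → ⊛-zeroˡ (ψ ⟨ A.0# ⟩) (ψ.0#-homo zero zero)
            ; *ₗ-distribʳ = λ D a b c → ≋-trans (⊛-cong (ψ.+-homo a b zero zero) ≋-refl)
                (⊛-distribʳ (δ D c) (ψ ⟨ a ⟩) (ψ ⟨ b ⟩))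
            ; *ₗ-identityˡ = λ D a → ≋-trans (⊛-cong (ψ.1#-homo zero zero) ≋-refl) (⊛-identityˡ (δ D a))
            ; *ₗ-assoc = λ a b D c → ≋-trans (⊛-cong (ψ-* a b) ≋-refl) (⊛-assoc (ψ ⟨ a ⟩) (ψ ⟨ b ⟩) (δ D c))
            ; *ₗ-zeroʳ = λ a b → P.zeroʳ (ψ ⟨ a ⟩)
            ; *ₗ-distribˡ = λ a D E b → ⊛-distribˡ (ψ ⟨ a ⟩) (δ D b) (δ E b) } }
        ; -ᴹ‿cong = λ e a → ⊖-cong (e a)
        ; -ᴹ‿inverse = (λ D a → P.-‿inverseˡ (δ D a)) , (λ D a → P.-‿inverseʳ (δ D a)) } }

    IsInner : Derivation → Set (f ⊔ k ⊔ ℓk)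
    IsInner D = ∃ λ U → ∀ a → δ D a ≋ (U ⊛ φ ⟨ a ⟩) ⊕ (⊖ (ψ ⟨ a ⟩ ⊛ U))

    HasZeroConstantTerm : Derivation → Set ℓk
    HasZeroConstantTerm D = coeff (δ D A.t) 0 K.≈ K.0#

    IsInner-isSubmodule : IsSubmodule Der IsInner
    IsInner-isSubmodule = record
      { respects = λ e (U , h) → U , λ a → ≋-trans (≋-sym (e a)) (h a)
      ; 0-closed = [] , λ a → ≋-sym (⊖-cong (P.zeroʳ (ψ ⟨ a ⟩)))
      ; +-closed = λ (U , h) (V , h′) → U ⊕ V , λ a → ≋-trans (⊕-cong (h a) (h′ a))
          (≋-trans (C.interchange (U ⊛ φ ⟨ a ⟩) (⊖ (ψ ⟨ a ⟩ ⊛ U)) (V ⊛ φ ⟨ a ⟩) (⊖ (ψ ⟨ a ⟩ ⊛ V)))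
            (⊕-cong (≋-sym (⊛-distribʳ (φ ⟨ a ⟩) U V))
              (≋-trans (PP.-‿+-comm (ψ ⟨ a ⟩ ⊛ U) (ψ ⟨ a ⟩ ⊛ V)) (⊖-cong (≋-sym (⊛-distribˡ (ψ ⟨ a ⟩) U V))))))
      ; neg-closed = λ (U , h) → ⊖ U , λ a → ≋-trans (⊖-cong (h a))
          (≋-trans (≋-sym (PP.-‿+-comm (U ⊛ φ ⟨ a ⟩) (⊖ (ψ ⟨ a ⟩ ⊛ U))))
            (⊕-cong (PP.-‿distribˡ-* U (φ ⟨ a ⟩)) (⊖-cong (PP.-‿distribʳ-* (ψ ⟨ a ⟩) U))))
      ; *-closed = λ b (U , h) → ψ ⟨ b ⟩ ⊛ U , λ a → ≋-trans (⊛-congʳ (ψ ⟨ b ⟩) (h a))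
          (≋-trans (⊛-distribˡ (ψ ⟨ b ⟩) (U ⊛ φ ⟨ a ⟩) (⊖ (ψ ⟨ a ⟩ ⊛ U)))
            (⊕-cong (≋-sym (⊛-assoc (ψ ⟨ b ⟩) U (φ ⟨ a ⟩)))
              (≋-trans (≋-sym (PP.-‿distribʳ-* (ψ ⟨ b ⟩) (ψ ⟨ a ⟩ ⊛ U))) (⊖-cong (ψ-swap b a U))))) }

    Der₀-isSubmodule : IsSubmodule Der HasZeroConstantTerm
    Der₀-isSubmodule = record
      { respects = λ e h → K.trans (K.sym (coeff-≈ (e A.t) 0)) h
      ; 0-closed = K.refl
      ; +-closed = λ {D} {E} h h′ → K.trans (coeff-⊕ (δ D A.t) (δ E A.t) 0)
          (K.trans (K.+-cong h h′) (K.+-identityˡ K.0#))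
      ; neg-closed = λ {D} h → K.trans (coeff-⊖ (δ D A.t) 0) (K.trans (K.-‿cong h) -0≈0)
      ; *-closed = λ a {D} h → coeff₀-⊛ (ψ ⟨ a ⟩) (δ D A.t) h }
      where
      -0≈0 = RingProperties.-0#≈0# K.ring
      coeff₀-⊛ : ∀ f g → coeff g 0 K.≈ K.0# → coeff (f ⊛ g) 0 K.≈ K.0#
      coeff₀-⊛ []      g h = K.refl
      coeff₀-⊛ (c ∷ f) g h = K.trans (coeff-⊕ (c · g) (K.0# ∷ (f ⊛ map τ g)) 0)
        (K.trans (K.+-identityʳ _) (K.trans (coeff-· c g 0) (K.trans (K.*-congˡ h) (K.zeroʳ c))))

    Der₀ : LeftModule A.ring (f ⊔ ℓf ⊔ k ⊔ ℓk) (f ⊔ ℓk)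
    Der₀ = submodule Der Der₀-isSubmodule

    Der₀∩Der-in-isSubmodule : IsSubmodule Der₀ (λ D → IsInner (proj₁ D))
    Der₀∩Der-in-isSubmodule = record
      { respects = λ {x} {y} → I.respects {proj₁ x} {proj₁ y}
      ; 0-closed = I.0-closed
      ; +-closed = λ {x} {y} → I.+-closed {proj₁ x} {proj₁ y}
      ; neg-closed = λ {x} → I.neg-closed {proj₁ x}
      ; *-closed = λ a {x} → I.*-closed a {proj₁ x} }
      where module I = IsSubmodule IsInner-isSubmodule

    Ext : LeftModule A.ring (f ⊔ ℓf ⊔ k ⊔ ℓk) (f ⊔ k ⊔ ℓk)
    Ext = quotient Der IsInner-isSubmodule

    Ext₀ : LeftModule A.ring (f ⊔ ℓf ⊔ k ⊔ ℓk) (f ⊔ k ⊔ ℓk)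
    Ext₀ = quotient Der₀ Der₀∩Der-in-isSubmodule

    inclusion : LeftModule.Carrierᴹ Ext₀ → LeftModule.Carrierᴹ Ext
    inclusion = proj₁

infix 4 _≅_
record _≅_ {R : Ring a ℓa} (M : LeftModule R b ℓb) (N : LeftModule R k ℓk) : Set (a ⊔ b ⊔ ℓb ⊔ k ⊔ ℓk) where
  field
    to : LeftModule.Carrierᴹ M → LeftModule.Carrierᴹ N
    isIsomorphism : ModuleMorphisms.LeftModuleMorphisms.IsLeftModuleIsomorphism
      (LeftModule.rawLeftModule M) (LeftModule.rawLeftModule N) to

{-# OPTIONS --safe #-}
-- A derivation δ is determined by δ(t), so Ext is K{τ} modulo the elements U φ_t − ψ_t U.  Since
-- rk φ < rk ψ = s and K is perfect, the leading coefficient of ψ_t U can be prescribed, so every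
-- class has a unique representative Σ_{i<s} τ^i y_i; these y_i are the coordinates on Ext.  As
-- t acts by ψ_t x ≡ x φ_t = Σ_{i,j} τ^(i+j) σ^j(φ_j y_i) with φ_j the coefficients of φ_t, writing
-- coefficients on the right makes t act through K{σ}, with constant term θ.  Because φ_t and ψ_t
-- share the constant term θ, the elements U φ_t − ψ_t U have none: y_0 is invariant under
-- reduction, t multiplies it by θ, and Ext_0 is the submodule y_0 = 0.
module Submission where

open import Defs
open import Level using (Level)
open import Data.Nat.Base using (ℕ; _<_)
open import Data.Product.Base using (Σ; ∃; ∃₂; _×_)
open import Algebra.Module.Bundles using (LeftModule)
open import Algebra.Apartness.Bundles using (HeytingField)
import Algebra.Apartness.Properties.HeytingCommutativeRing as HeytingProperties
open import Algebra.Bundles using (CommutativeRing; Ring; RawRing; AbelianGroup)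
import Algebra.Definitions.RawSemiring as RawSemiringDefs
import Algebra.Module.Morphism.Structures as ModuleMorphisms
open import Algebra.Morphism.Structures using (module RingMorphisms)
import Algebra.Properties.AbelianGroup as AbelianGroupProperties
import Algebra.Properties.CommutativeMonoid.Sum as CommutativeMonoidSum
import Algebra.Properties.CommutativeSemigroup as CommutativeSemigroupProperties
import Algebra.Properties.Group as GroupProperties
import Algebra.Properties.Ring as RingProperties
import Algebra.Properties.Semiring.Sum as SemiringSum
open import Data.Fin.Base using (Fin; zero; suc; toℕ; punchIn)
open import Data.Fin.Permutation using (Permutation′; permutation)
import Data.Fin.Properties as Fin
open import Data.List.Base using ([]; _∷_; map; length)
open import Data.Nat.Base as ℕ using (zero; suc; z≤n; s≤s)
import Data.Nat.Properties as ℕ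
open import Data.Product.Base using (_,_; proj₁; proj₂)
open import Data.Sum.Base using (_⊎_; inj₁; inj₂)
open import Function.Base using (_∘_; id)
open import Function.Bundles using (Inverse; mk⇔)
open import Relation.Binary.PropositionalEquality as ≡ using (_≡_)
import Relation.Binary.Reasoning.Setoid
open import Relation.Nullary.Decidable using (Dec; yes; no; map′; decidable-stable)
open import Relation.Nullary.Negation using (¬_; contradiction)

-- `K` has a tight apartness but no decision procedure, so neither degrees in K{τ} nor the vanishing
-- of coefficients can be tested. Reduction therefore runs a number of rounds fixed in advance,
-- eliminating the current top term whether or not it is zero, and uniqueness descends on an upper
-- bound for the degree of U. Fixed rounds also make reduction a composition of operators in K{σ},
-- so that t acts by a matrix over K{σ}.
--
-- Reducing x φ_t rather than ψ_t x makes the constant term in σ visible: a term τ^k with k ≥ s in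
-- τ^i y φ_t comes from φ_j with j = k - i ≥ 1, hence carries σ^j. Each round composes a remainder
-- operator with such a term, and constant terms in K{σ} multiply, so nothing is added to θ on the
-- diagonal and the nilpotent part is 0.
--
-- The derivation with prescribed δ(t) and the module with prescribed matrix both need the constants
-- of 𝔽_q to be central in the twisted rings, that is c^q = c. Since 𝔽_q is given only as a Heyting
-- field with q elements, this is proved by a product over all its elements.

private variable
  a b c′ f k ℓ ℓa ℓb ℓc ℓ# ℓf ℓf# ℓk ℓk# : Level

-- Heyting fields, and Fermat's theorem in a finite one

module HeytingFieldProperties (F : HeytingField a ℓa ℓ#) where
  open HeytingField F using (_#_; tight; #⇒invertible)
  open CommutativeRing (fieldRing F) hiding (zero)
  open HeytingProperties (HeytingField.heytingCommutativeRing F) public using (1#0; x#0y#0→xy#0; x-0≈x; #-congʳ)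
  open Relation.Binary.Reasoning.Setoid setoid

  ¬#0⇒≈0 : ∀ {x} → ¬ (x # 0#) → x ≈ 0#
  ¬#0⇒≈0 {x} = proj₁ (tight x 0#)

  1≉0 : ¬ (1# ≈ 0#)
  1≉0 e = proj₂ (tight 1# 0#) e 1#0

  recip : ∀ {x} → x # 0# → ∃ λ y → y * x ≈ 1#
  recip {x} x#0 = let (y , yx , _) = #⇒invertible x#0 in
    y , trans (*-congˡ (sym (x-0≈x x))) yx

  #0-*-cancelˡ : ∀ {x y z} → x # 0# → x * y ≈ x * z → y ≈ z
  #0-*-cancelˡ {x} {y} {z} x#0 e = let (x⁻¹ , x⁻¹x) = recip x#0 in begin
    y              ≈⟨ *-identityˡ y ⟨
    1# * y         ≈⟨ *-congʳ x⁻¹x ⟨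
    x⁻¹ * x * y    ≈⟨ *-assoc _ _ _ ⟩
    x⁻¹ * (x * y)  ≈⟨ *-congˡ e ⟩
    x⁻¹ * (x * z)  ≈⟨ *-assoc _ _ _ ⟨
    x⁻¹ * x * z    ≈⟨ *-congʳ x⁻¹x ⟩
    1# * z         ≈⟨ *-identityˡ z ⟩
    z              ∎

module FiniteField (F : HeytingField a ℓa ℓ#) {q : ℕ}
  (card : Inverse (CommutativeRing.setoid (fieldRing F)) (≡.setoid (Fin q))) where

  open HeytingField F using (_#_)
  open CommutativeRing (fieldRing F) hiding (zero)
  open HeytingFieldProperties F
  private
    module C = Inverse card
    module Π = CommutativeMonoidSum *-commutativeMonoid
    open Relation.Binary.Reasoning.Setoid setoid
    infixr 8 _^′_
    _^′_ : Carrier → ℕ → Carrier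
    _^′_ = _^_ (fieldRing F)

  infix 4 _≟_
  _≟_ : ∀ x y → Dec (x ≈ y)
  x ≟ y = map′ (λ e → trans (sym (C.strictlyInverseʳ x)) (trans (C.from-cong e) (C.strictlyInverseʳ y)))
    C.to-cong (C.to x Fin.≟ C.to y)

  -- By tightness `¬ (x ≈ 0#)` only yields the double negation of `x # 0#`, hence no inverse; that
  -- suffices here because the conclusion is decidable.
  ≉0-*-cancelˡ : ∀ {x y z} → ¬ (x ≈ 0#) → x * y ≈ x * z → y ≈ z
  ≉0-*-cancelˡ {x} {y} {z} x≉0 e = decidable-stable (y ≟ z)
    λ y≉z → x≉0 (¬#0⇒≈0 λ x#0 → y≉z (#0-*-cancelˡ x#0 e))

  private
    at : Fin q → Carrier
    at = C.from

    -- Putting 1 in place of the zero entry lets a product over all of `Fin q` stand for the product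
    -- over the nonzero elements.
    unlessZero : (x : Carrier) → Carrier → Carrier
    unlessZero x y with x ≟ 0#
    ... | yes _ = 1#
    ... | no  _ = y

    unlessZero-yes : ∀ {x y} → x ≈ 0# → unlessZero x y ≈ 1#
    unlessZero-yes {x} e with x ≟ 0#
    ... | yes _ = refl
    ... | no x≉0 = contradiction e x≉0

    unlessZero-no : ∀ {x y} → ¬ (x ≈ 0#) → unlessZero x y ≈ y
    unlessZero-no {x} x≉0 with x ≟ 0#
    ... | yes e = contradiction e x≉0
    ... | no _ = refl

    unlessZero-≉0 : ∀ x → ¬ (unlessZero x x ≈ 0#)
    unlessZero-≉0 x e with x ≟ 0#
    ... | yes _ = 1≉0 e
    ... | no x≉0 = x≉0 e

    product-≉0 : ∀ {n} (f : Fin n → Carrier) → (∀ i → ¬ (f i ≈ 0#)) → ¬ (Π.sum f ≈ 0#)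
    product-≉0 {zero}  f h e = 1≉0 e
    product-≉0 {suc n} f h e = product-≉0 (f ∘ suc) (h ∘ suc)
      (≉0-*-cancelˡ (h zero) (trans e (sym (zeroʳ (f zero)))))

    -- Exactly one of the n factors is 1 and the others are y; the extra y in front makes up for it.
    product-unlessZero : ∀ {n} (x : Fin n → Carrier) z → x z ≈ 0# → (∀ i → x i ≈ 0# → i ≡ z) → ∀ y →
      y * Π.sum (λ i → unlessZero (x i) y) ≈ y ^′ n
    product-unlessZero {suc n} x z xz≈0 unique y = *-congˡ (begin
      Π.sum (λ i → unlessZero (x i) y)
        ≈⟨ Π.sum-remove {i = z} (λ i → unlessZero (x i) y) ⟩
      unlessZero (x z) y * Π.sum (λ i → unlessZero (x (punchIn z i)) y)
        ≈⟨ *-cong (unlessZero-yes xz≈0)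
             (Π.sum-cong-≋ λ i → unlessZero-no λ e → Fin.punchInᵢ≢i z i (unique _ e)) ⟩
      1# * Π.sum (λ (i : Fin n) → y)
        ≈⟨ *-identityˡ _ ⟩
      Π.sum (λ (i : Fin n) → y)
        ≈⟨ Π.sum-replicate n ⟩
      y ^′ n ∎)

    -- Multiplication by a permutes the field, so the product P of the nonzero elements
    -- satisfies P = a^(q-1) P.
    ^q-#0 : ∀ {a} → a # 0# → a ^′ q ≈ a
    ^q-#0 {a} a#0 = begin
      a ^′ q        ≈⟨ product-unlessZero at z at-z unique a ⟨
      a * Π.sum h   ≈⟨ *-congˡ (≉0-*-cancelˡ (product-≉0 g (unlessZero-≉0 ∘ at)) P-h) ⟩
      a * 1#        ≈⟨ *-identityʳ a ⟩
      a             ∎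
      where
      a⁻¹ = proj₁ (recip a#0)
      a⁻¹a = proj₂ (recip a#0)
      π : Permutation′ q
      π = permutation (λ i → C.to (a * at i)) (λ i → C.to (a⁻¹ * at i))
        (λ i → ≡.trans (C.to-cong (trans (*-congˡ (C.strictlyInverseʳ _)) (trans (sym (*-assoc _ _ _))
          (trans (*-congʳ (trans (*-comm a a⁻¹) a⁻¹a)) (*-identityˡ _))))) (C.strictlyInverseˡ i))
        (λ i → ≡.trans (C.to-cong (trans (*-congˡ (C.strictlyInverseʳ _)) (trans (sym (*-assoc _ _ _))
          (trans (*-congʳ a⁻¹a) (*-identityˡ _))))) (C.strictlyInverseˡ i))
      z : Fin q
      z = C.to 0#
      at-z : at z ≈ 0#
      at-z = C.strictlyInverseʳ 0#
      unique : ∀ i → at i ≈ 0# → i ≡ z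
      unique i e = ≡.trans (≡.sym (C.strictlyInverseˡ i)) (C.to-cong e)
      g h : Fin q → Carrier
      g i = unlessZero (at i) (at i)
      h i = unlessZero (at i) a
      aat≈0 : ∀ {i} → at i ≈ 0# → at (C.to (a * at i)) ≈ 0#
      aat≈0 e = trans (C.strictlyInverseʳ _) (trans (*-congˡ e) (zeroʳ a))
      -- The index of 0 is fixed by the permutation, and there the equation reads 1 = 1 · 1; at
      -- every other index a · `at i` is again nonzero.
      gπ : ∀ i → g (C.to (a * at i)) ≈ g i * h i
      gπ i with at i ≟ 0#
      ... | yes e = trans (unlessZero-yes (aat≈0 e)) (sym (*-identityˡ 1#))
      ... | no e = trans (unlessZero-no λ e′ → e (#0-*-cancelˡ a#0
          (trans (trans (sym (C.strictlyInverseʳ _)) e′) (sym (zeroʳ a)))))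
          (trans (C.strictlyInverseʳ _) (*-comm a (at i)))
      P-h : Π.sum g * Π.sum h ≈ Π.sum g * 1#
      P-h = begin
        Π.sum g * Π.sum h                   ≈⟨ Π.∑-distrib-+ g h ⟨
        Π.sum (λ i → g i * h i)             ≈⟨ Π.sum-cong-≋ gπ ⟨
        Π.sum (λ i → g (C.to (a * at i)))   ≈⟨ Π.sum-permute g π ⟨
        Π.sum g                             ≈⟨ *-identityʳ _ ⟨
        Π.sum g * 1#                        ∎

  -- Apartness need not be decidable, but the equation is, so a # 0 may be assumed.
  fermat : ∀ a → a ^′ q ≈ a
  fermat a = decidable-stable (a ^′ q ≟ a) λ a^q≉a →
    a^q≉a (≈0⇒ (¬#0⇒≈0 λ a#0 → a^q≉a (^q-#0 a#0)))
    where
    -- An element of `Fin n` rules out n = 0, where the power would be 1; for n = q the index of 0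
    -- provides it.
    0^ : ∀ {n} → Fin n → ∀ {a} → a ≈ 0# → a ^′ n ≈ 0#
    0^ {suc n} _ e = trans (*-congʳ e) (zeroˡ _)
    ≈0⇒ : a ≈ 0# → a ^′ q ≈ a
    ≈0⇒ e = trans (0^ (C.to 0#) e) (sym e)

-- Matrix rings over a noncommutative ring

module MatrixRing (R : Ring a ℓa) where
  open Ring R hiding (zero)
  open Matrices R
  private
    module S = SemiringSum semiring

  sum-scalar-* : ∀ {d} x (v : Fin d → Carrier) i → S.sum (λ j → scalar x i j * v j) ≈ x * v i
  sum-scalar-* {suc d} x v zero = trans
    (+-congˡ (trans (S.sum-cong-≋ λ j → zeroˡ (v (suc j))) (S.sum-replicate-zero d)))
    (+-identityʳ _)
  sum-scalar-* {suc d} x v (suc i) = trans (+-cong (zeroˡ _) (S.sum-cong-≋ lemma))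
    (trans (+-identityˡ _) (sum-scalar-* x (v ∘ suc) i))
    where
    lemma : ∀ j → scalar x (suc i) (suc j) * v (suc j) ≈ scalar x i j * v (suc j)
    lemma j with i Fin.≟ j
    ... | yes _ = refl
    ... | no  _ = refl

  sum-*-scalar : ∀ {d} x (v : Fin d → Carrier) k → S.sum (λ j → v j * scalar x j k) ≈ v k * x
  sum-*-scalar {suc d} x v zero = trans
    (+-congˡ (trans (S.sum-cong-≋ λ j → zeroʳ (v (suc j))) (S.sum-replicate-zero d)))
    (+-identityʳ _)
  sum-*-scalar {suc d} x v (suc k) = trans (+-cong (zeroʳ _) (S.sum-cong-≋ lemma))
    (trans (+-identityˡ _) (sum-*-scalar x (v ∘ suc) k))
    where
    lemma : ∀ j → v (suc j) * scalar x (suc j) (suc k) ≈ v (suc j) * scalar x j k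
    lemma j with j Fin.≟ k
    ... | yes _ = refl
    ... | no  _ = refl

  scalar-cong : ∀ {d x y} → x ≈ y → scalar {d} x ≈ₘ scalar y
  scalar-cong e i j with i Fin.≟ j
  ... | yes _ = e
  ... | no  _ = refl

  scalar-+ : ∀ {d} x y → scalar {d} (x + y) ≈ₘ (λ i j → scalar x i j + scalar y i j)
  scalar-+ x y i j with i Fin.≟ j
  ... | yes _ = refl
  ... | no  _ = sym (+-identityˡ 0#)

  scalar-* : ∀ {d} x y → scalar {d} (x * y) ≈ₘ scalar x *ₘ scalar y
  scalar-* x y i k = trans (lemma i k) (sym (sum-scalar-* x (λ j → scalar y j k) i))
    where
    lemma : ∀ {d} (i k : Fin d) → scalar (x * y) i k ≈ x * scalar y i k
    lemma i k with i Fin.≟ k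
    ... | yes _ = refl
    ... | no  _ = sym (zeroʳ x)

  *ₘ-assoc : ∀ {m n o p} (L : Mat m n) (M : Mat n o) (N : Mat o p) → (L *ₘ M) *ₘ N ≈ₘ L *ₘ (M *ₘ N)
  *ₘ-assoc L M N i l = begin
    S.sum (λ k → S.sum (λ j → L i j * M j k) * N k l)
      ≈⟨ S.sum-cong-≋ (λ k → S.*-distribʳ-sum (N k l) (λ j → L i j * M j k)) ⟩
    S.sum (λ k → S.sum (λ j → L i j * M j k * N k l))
      ≈⟨ S.∑-comm (λ k j → L i j * M j k * N k l) ⟩
    S.sum (λ j → S.sum (λ k → L i j * M j k * N k l))
      ≈⟨ S.sum-cong-≋ (λ j → S.sum-cong-≋ (λ k → *-assoc (L i j) (M j k) (N k l))) ⟩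
    S.sum (λ j → S.sum (λ k → L i j * (M j k * N k l)))
      ≈⟨ S.sum-cong-≋ (λ j → S.*-distribˡ-sum (L i j) (λ k → M j k * N k l)) ⟨
    S.sum (λ j → L i j * S.sum (λ k → M j k * N k l)) ∎
    where open Relation.Binary.Reasoning.Setoid setoid

  -- Its raw ring is `matRawRing d` by definition, so a homomorphism into it has the type that
  -- `TwistedModule` asks for.
  matRing : ℕ → Ring a ℓa
  matRing d = record
    { Carrier = Mat d d ; _≈_ = _≈ₘ_
    ; _+_ = λ M N i j → M i j + N i j ; _*_ = _*ₘ_ ; -_ = λ M i j → - M i j
    ; 0# = λ _ _ → 0# ; 1# = scalar 1#
    ; isRing = record
      { +-isAbelianGroup = record
        { isGroup = record
          { isMonoid = record
            { isSemigroup = record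
              { isMagma = record
                { isEquivalence = record
                  { refl = λ _ _ → refl ; sym = λ e i j → sym (e i j) ; trans = λ e e′ i j → trans (e i j) (e′ i j) }
                ; ∙-cong = λ e e′ i j → +-cong (e i j) (e′ i j) }
              ; assoc = λ _ _ _ _ _ → +-assoc _ _ _ }
            ; identity = (λ _ _ _ → +-identityˡ _) , (λ _ _ _ → +-identityʳ _) }
          ; inverse = (λ _ _ _ → -‿inverseˡ _) , (λ _ _ _ → -‿inverseʳ _)
          ; ⁻¹-cong = λ e i j → -‿cong (e i j) }
        ; comm = λ _ _ _ _ → +-comm _ _ }
      ; *-cong = λ e e′ i k → S.sum-cong-≋ λ j → *-cong (e i j) (e′ j k)
      ; *-assoc = *ₘ-assoc
      ; *-identity =
          (λ N i k → trans (sum-scalar-* 1# (λ j → N j k) i) (*-identityˡ (N i k)))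
        , (λ N i k → trans (sum-*-scalar 1# (N i) k) (*-identityʳ (N i k)))
      ; distrib =
          (λ L M N i k → trans (S.sum-cong-≋ λ j → distribˡ (L i j) (M j k) (N j k))
            (S.∑-distrib-+ (λ j → L i j * M j k) (λ j → L i j * N j k)))
        , (λ L M N i k → trans (S.sum-cong-≋ λ j → distribʳ (L j k) (M i j) (N i j))
            (S.∑-distrib-+ (λ j → M i j * L j k) (λ j → N i j * L j k))) } }

  scalar-isRingHom : ∀ d → IsRingHom R (matRing d) scalar
  scalar-isRingHom d = mkIsRingHom R (matRing d) scalar scalar-cong scalar-+ scalar-* (λ _ _ → refl)

-- The universal property of R[t], and linearity over R[t]

module PolynomialProperties (R : CommutativeRing a ℓa) where
  open CommutativeRing R using (0#; 1#; +-identityʳ)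
  open Polynomial R

  t-⊛ : ∀ f → t ⊛ f ≋ 0# ∷ f
  t-⊛ f = ≋-trans (0∷-⊛ (constant 1#) f) (0∷-cong (≋-trans (⊛-identityˡ (map id f)) (map-id≋ f)))

  ∷-decompose : ∀ c f → c ∷ f ≋ constant c ⊕ (t ⊛ f)
  ∷-decompose c f = ≋-trans (∷-cong (CommutativeRing.sym R (+-identityʳ c)) ≋-refl)
    (⊕-congˡ (constant c) (≋-sym (t-⊛ f)))

module PolynomialEvaluation (R : CommutativeRing a ℓa) (S : Ring b ℓb)
  {h : CommutativeRing.Carrier R → Ring.Carrier S} (h-isRingHom : IsRingHom (CommutativeRing.ring R) S h)
  (x : Ring.Carrier S) (h-comm : ∀ c → Ring._≈_ S (Ring._*_ S (h c) x) (Ring._*_ S x (h c))) where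

  open Polynomial R using (Poly; polyRing; constant; _·_; _⊕_; _⊛_; _≋_; mk≋; coeff-≈; ≋-sym; ≋-refl; map-id≋; t; tail≋; head≈)
  open Ring S hiding (zero)
  private
    module R = CommutativeRing R
    module h = RingMorphisms.IsRingHomomorphism h-isRingHom
    module C = CommutativeSemigroupProperties (Ring.+-commutativeSemigroup S)
    open Relation.Binary.Reasoning.Setoid setoid

  evaluate : Poly → Carrier
  evaluate []      = 0#
  evaluate (c ∷ f) = h c + x * evaluate f

  private
    evaluate-≋[] : ∀ f → f ≋ [] → evaluate f ≈ 0#
    evaluate-≋[] []      e = refl
    evaluate-≋[] (c ∷ f) e = trans (+-cong (trans (h.⟦⟧-cong (coeff-≈ e 0)) h.0#-homo)
      (trans (*-congˡ (evaluate-≋[] f (mk≋ λ n → coeff-≈ e (suc n)))) (zeroʳ x))) (+-identityˡ 0#)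

    evaluate-cong : ∀ f g → f ≋ g → evaluate f ≈ evaluate g
    evaluate-cong []      g       e = sym (evaluate-≋[] g (≋-sym e))
    evaluate-cong (c ∷ f) []      e = evaluate-≋[] (c ∷ f) e
    evaluate-cong (c ∷ f) (d ∷ g) e = +-cong (h.⟦⟧-cong (head≈ e)) (*-congˡ (evaluate-cong f g (tail≋ e)))

    evaluate-⊕ : ∀ f g → evaluate (f ⊕ g) ≈ evaluate f + evaluate g
    evaluate-⊕ []      g       = sym (+-identityˡ _)
    evaluate-⊕ (c ∷ f) []      = sym (+-identityʳ _)
    evaluate-⊕ (c ∷ f) (d ∷ g) = trans
      (+-cong (h.+-homo c d) (trans (*-congˡ (evaluate-⊕ f g)) (distribˡ x _ _)))
      (C.interchange _ _ _ _)

    -- `S` is not commutative: `h-comm` moves `h c` past the powers of `x` in the Horner form.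
    evaluate-· : ∀ c f → evaluate (c · f) ≈ h c * evaluate f
    evaluate-· c []      = sym (zeroʳ _)
    evaluate-· c (d ∷ f) = begin
      h (c R.* d) + x * evaluate (c · f)       ≈⟨ +-cong (h.*-homo c d) (*-congˡ (evaluate-· c f)) ⟩
      h c * h d + x * (h c * evaluate f)       ≈⟨ +-congˡ (*-assoc _ _ _) ⟨
      h c * h d + x * h c * evaluate f         ≈⟨ +-congˡ (*-congʳ (h-comm c)) ⟨
      h c * h d + h c * x * evaluate f         ≈⟨ +-congˡ (*-assoc _ _ _) ⟩
      h c * h d + h c * (x * evaluate f)       ≈⟨ distribˡ _ _ _ ⟨
      h c * (h d + x * evaluate f)             ∎

    evaluate-⊛ : ∀ f g → evaluate (f ⊛ g) ≈ evaluate f * evaluate g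
    evaluate-⊛ []      g = sym (zeroˡ _)
    evaluate-⊛ (c ∷ f) g = begin
      evaluate ((c · g) ⊕ (R.0# ∷ (f ⊛ map id g)))
        ≈⟨ evaluate-⊕ (c · g) _ ⟩
      evaluate (c · g) + (h R.0# + x * evaluate (f ⊛ map id g))
        ≈⟨ +-cong (evaluate-· c g) (trans (+-congʳ h.0#-homo) (+-identityˡ _)) ⟩
      h c * evaluate g + x * evaluate (f ⊛ map id g)
        ≈⟨ +-congˡ (*-congˡ (trans (evaluate-⊛ f (map id g)) (*-congˡ (evaluate-cong _ g (map-id≋ g))))) ⟩
      h c * evaluate g + x * (evaluate f * evaluate g)
        ≈⟨ +-congˡ (*-assoc _ _ _) ⟨
      h c * evaluate g + x * evaluate f * evaluate g
        ≈⟨ distribʳ _ _ _ ⟨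
      (h c + x * evaluate f) * evaluate g ∎

  evaluate-constant : ∀ c → evaluate (constant c) ≈ h c
  evaluate-constant c = trans (+-congˡ (zeroʳ x)) (+-identityʳ _)

  evaluate-isRingHom : IsRingHom polyRing S evaluate
  evaluate-isRingHom = mkIsRingHom polyRing S evaluate (evaluate-cong _ _) evaluate-⊕ evaluate-⊛
    (trans (evaluate-constant R.1#) h.1#-homo)

  evaluate-t : evaluate t ≈ x
  evaluate-t = trans (+-cong h.0#-homo (trans (*-congˡ (trans (evaluate-constant R.1#) h.1#-homo)) (*-identityʳ x)))
    (+-identityˡ x)

module _ {R : Ring a ℓa} (M : LeftModule R b ℓb) (N : LeftModule R c′ ℓc) where
  private
    module M = LeftModule M
    module N = LeftModule N

  IsLinear : (M.Carrierᴹ → N.Carrierᴹ) → Set _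
  IsLinear = ModuleMorphisms.LeftModuleMorphisms.IsLeftModuleHomomorphism M.rawLeftModule N.rawLeftModule

  mkIsLinear : (f : M.Carrierᴹ → N.Carrierᴹ) →
    (∀ {x y} → x M.≈ᴹ y → f x N.≈ᴹ f y) →
    (∀ x y → f (x M.+ᴹ y) N.≈ᴹ f x N.+ᴹ f y) →
    (∀ r x → f (r M.*ₗ x) N.≈ᴹ r N.*ₗ f x) → IsLinear f
  mkIsLinear f f-cong f-+ f-* = record
    { +ᴹ-isGroupHomomorphism = record
      { isMonoidHomomorphism = record
        { isMagmaHomomorphism = record
          { isRelHomomorphism = record { cong = f-cong }
          ; homo = f-+ }
        ; ε-homo = f-0 }
      ; ⁻¹-homo = λ x → G.inverseʳ-unique (f x) (f (M.-ᴹ x))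
          (N.≈ᴹ-trans (N.≈ᴹ-sym (f-+ x (M.-ᴹ x))) (N.≈ᴹ-trans (f-cong (M.-ᴹ‿inverseʳ x)) f-0)) }
    ; *ₗ-homo = f-* }
    where
    module G = AbelianGroupProperties N.+ᴹ-abelianGroup
    f-0 : f M.0ᴹ N.≈ᴹ N.0ᴹ
    f-0 = G.identityʳ-unique (f M.0ᴹ) (f M.0ᴹ)
      (N.≈ᴹ-trans (N.≈ᴹ-sym (f-+ M.0ᴹ M.0ᴹ)) (f-cong (M.+ᴹ-identityʳ M.0ᴹ)))

module _ (R : CommutativeRing a ℓa) (M : LeftModule (Polynomial.polyRing R) b ℓb)
  (N : LeftModule (Polynomial.polyRing R) c′ ℓc) where
  private
    module R = CommutativeRing R
    module M = LeftModule M
    module N = LeftModule N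
    open Polynomial R using (constant; t; _⊕_; _⊛_; ≋-refl)
    open PolynomialProperties R using (∷-decompose)

  -- The constants and t generate R[t]: a scalar c + t p is handled by induction on p.
  mkIsLinearₜ : (f : M.Carrierᴹ → N.Carrierᴹ) →
    (∀ {x y} → x M.≈ᴹ y → f x N.≈ᴹ f y) →
    (∀ x y → f (x M.+ᴹ y) N.≈ᴹ f x N.+ᴹ f y) →
    (∀ c x → f (constant c M.*ₗ x) N.≈ᴹ constant c N.*ₗ f x) →
    (∀ x → f (t M.*ₗ x) N.≈ᴹ t N.*ₗ f x) → IsLinear M N f
  mkIsLinearₜ f f-cong f-+ f-const f-t = mkIsLinear M N f f-cong f-+ f-*
    where
    module G = AbelianGroupProperties N.+ᴹ-abelianGroup
    open Relation.Binary.Reasoning.Setoid N.≈ᴹ-setoid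
    f-* : ∀ p x → f (p M.*ₗ x) N.≈ᴹ p N.*ₗ f x
    f-* []      x = begin
      f ([] M.*ₗ x)  ≈⟨ f-cong (M.*ₗ-zeroˡ x) ⟩
      f M.0ᴹ         ≈⟨ G.identityʳ-unique (f M.0ᴹ) (f M.0ᴹ)
                          (N.≈ᴹ-trans (N.≈ᴹ-sym (f-+ M.0ᴹ M.0ᴹ)) (f-cong (M.+ᴹ-identityʳ M.0ᴹ))) ⟩
      N.0ᴹ           ≈⟨ N.*ₗ-zeroˡ (f x) ⟨
      [] N.*ₗ f x    ∎
    f-* (c ∷ p) x = begin
      f ((c ∷ p) M.*ₗ x)
        ≈⟨ f-cong (M.*ₗ-cong (∷-decompose c p) M.≈ᴹ-refl) ⟩
      f ((constant c ⊕ (t ⊛ p)) M.*ₗ x)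
        ≈⟨ f-cong (M.≈ᴹ-trans (M.*ₗ-distribʳ x (constant c) (t ⊛ p)) (M.+ᴹ-congˡ (M.*ₗ-assoc t p x))) ⟩
      f (constant c M.*ₗ x M.+ᴹ t M.*ₗ (p M.*ₗ x))
        ≈⟨ f-+ _ _ ⟩
      f (constant c M.*ₗ x) N.+ᴹ f (t M.*ₗ (p M.*ₗ x))
        ≈⟨ N.+ᴹ-cong (f-const c x) (N.≈ᴹ-trans (f-t _) (N.*ₗ-cong ≋-refl (f-* p x))) ⟩
      constant c N.*ₗ f x N.+ᴹ t N.*ₗ (p N.*ₗ f x)
        ≈⟨ N.≈ᴹ-trans (N.*ₗ-distribʳ (f x) (constant c) (t ⊛ p)) (N.+ᴹ-congˡ (N.*ₗ-assoc t p (f x))) ⟨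
      (constant c ⊕ (t ⊛ p)) N.*ₗ f x
        ≈⟨ N.*ₗ-cong (∷-decompose c p) N.≈ᴹ-refl ⟨
      (c ∷ p) N.*ₗ f x ∎

-- Twisted polynomials with coefficients on the right

shift : {B : Set b} → B → ℕ → (ℕ → B) → ℕ → B
shift z zero    g i       = g i
shift z (suc n) g zero    = z
shift z (suc n) g (suc i) = shift z n g i

-- Splits an index into i < n or i = n + j without subtraction. `P` sees index and value together,
-- so nothing is transported along an equation of indices.
shift-elim : {B : Set b} (P : ℕ → B → Set ℓ) {z : B} (n : ℕ) {g : ℕ → B} →
  (∀ i → i ℕ.< n → P i z) → (∀ j → P (n ℕ.+ j) (g j)) → ∀ i → P i (shift z n g i)
shift-elim P zero    below above i       = above i
shift-elim P (suc n) below above zero    = below zero (s≤s z≤n)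
shift-elim P (suc n) below above (suc i) = shift-elim (P ∘ suc) n (λ i i<n → below (suc i) (s≤s i<n)) above i

shift-+ : {B : Set b} {z : B} (n : ℕ) {g : ℕ → B} (j : ℕ) → shift z n g (n ℕ.+ j) ≡ g j
shift-+ zero    j = ≡.refl
shift-+ (suc n) j = shift-+ n j

module SkewPolynomialProperties (R : CommutativeRing a ℓa)
  (s : CommutativeRing.Carrier R → CommutativeRing.Carrier R)
  (s-isRingHom : IsRingHom (CommutativeRing.ring R) (CommutativeRing.ring R) s) where

  open CommutativeRing R hiding (zero)
  open SkewPolynomial R s s-isRingHom
  private
    module s = RingMorphisms.IsRingHomomorphism s-isRingHom
    open Relation.Binary.Reasoning.Setoid setoid

  s^ : ℕ → Carrier → Carrier
  s^ zero    x = x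
  s^ (suc n) x = s (s^ n x)

  s^-isRingHom : ∀ n → IsRingHom ring ring (s^ n)
  s^-isRingHom zero    = mkIsRingHom ring ring id id (λ _ _ → refl) (λ _ _ → refl) refl
  s^-isRingHom (suc n) = mkIsRingHom ring ring _ (s.⟦⟧-cong ∘ H.⟦⟧-cong)
    (λ x y → trans (s.⟦⟧-cong (H.+-homo x y)) (s.+-homo _ _))
    (λ x y → trans (s.⟦⟧-cong (H.*-homo x y)) (s.*-homo _ _))
    (trans (s.⟦⟧-cong H.1#-homo) s.1#-homo)
    where module H = RingMorphisms.IsRingHomomorphism (s^-isRingHom n)

  module s^ n = RingMorphisms.IsRingHomomorphism (s^-isRingHom n)

  s^-s : ∀ n x → s^ n (s x) ≡ s^ (suc n) x
  s^-s zero    x = ≡.refl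
  s^-s (suc n) x = ≡.cong s (s^-s n x)

  s^-+ : ∀ m n x → s^ (m ℕ.+ n) x ≡ s^ m (s^ n x)
  s^-+ zero    n x = ≡.refl
  s^-+ (suc m) n x = ≡.cong s (s^-+ m n x)

  s^-injective : (∀ {x y} → s x ≈ s y → x ≈ y) → ∀ n {x y} → s^ n x ≈ s^ n y → x ≈ y
  s^-injective inj zero    e = e
  s^-injective inj (suc n) e = s^-injective inj n (inj e)

  coeff-≥length : ∀ f n → length f ℕ.≤ n → coeff f n ≈ 0#
  coeff-≥length []      n       _         = refl
  coeff-≥length (c ∷ f) (suc n) (s≤s l≤n) = coeff-≥length f n l≤n

  coeff-constant-⊛ : ∀ c f n → coeff (constant c ⊛ f) n ≈ c * coeff f n
  coeff-constant-⊛ c f n = trans (coeff-≈ (≋-trans (⊕-congˡ (c · f) (0∷[]≋[] refl ≋-refl)) (⊕-identityʳ _)) n)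
    (coeff-· c f n)

  coeff₀-⊛ : ∀ f g → coeff (f ⊛ g) 0 ≈ coeff f 0 * coeff g 0
  coeff₀-⊛ []      g = sym (zeroˡ _)
  coeff₀-⊛ (c ∷ f) g = trans (coeff-⊕ (c · g) _ 0) (trans (+-identityʳ _) (coeff-· c g 0))

  ⊛-constant-comm : ∀ {c} → s c ≈ c → ∀ f → f ⊛ constant c ≋ constant c ⊛ f
  ⊛-constant-comm e []      = ≋-sym (0∷[]≋[] refl ≋-refl)
  ⊛-constant-comm {c} e (d ∷ f) = ∷-cong (+-congʳ (*-comm d c)) (≋-trans
    (⊛-congʳ f (∷-cong e ≋-refl))
    (≋-trans (⊛-constant-comm e f)
      (⊕-congˡ (c · f) (0∷[]≋[] refl ≋-refl))))

  -- In degree m + n only f_m X^m g_n X^n = f_m s^m(g_n) X^(m+n) survives. As m and n are mere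
  -- degree bounds, leading coefficients may vanish.
  coeff-⊛-top : ∀ f g m n → (∀ i → m ℕ.< i → coeff f i ≈ 0#) → (∀ i → n ℕ.< i → coeff g i ≈ 0#) →
    coeff (f ⊛ g) (m ℕ.+ n) ≈ coeff f m * s^ m (coeff g n)
  coeff-⊛-top []      g m n hf hg = sym (zeroˡ _)
  coeff-⊛-top (c ∷ f) g zero n hf hg = begin
    coeff ((c · g) ⊕ (0# ∷ (f ⊛ map s g))) n
      ≈⟨ coeff-≈ (≋-trans (⊕-congˡ (c · g) (0∷[]≋[] refl (⊛-zeroˡ f (mk≋ λ i → hf (suc i) (s≤s z≤n)))))
           (⊕-identityʳ _)) n ⟩
    coeff (c · g) n
      ≈⟨ coeff-· c g n ⟩
    c * coeff g n ∎
  coeff-⊛-top (c ∷ f) g (suc m) n hf hg = begin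
    coeff ((c · g) ⊕ (0# ∷ (f ⊛ map s g))) (suc m ℕ.+ n)
      ≈⟨ coeff-⊕ (c · g) _ (suc m ℕ.+ n) ⟩
    coeff (c · g) (suc m ℕ.+ n) + coeff (f ⊛ map s g) (m ℕ.+ n)
      ≈⟨ +-cong (trans (coeff-· c g _) (trans (*-congˡ (hg _ (ℕ.m<n+m n (s≤s z≤n)))) (zeroʳ c)))
           (coeff-⊛-top f (map s g) m n (λ i m<i → hf (suc i) (s≤s m<i))
             λ i n<i → trans (coeff-s g i) (trans (s.⟦⟧-cong (hg i n<i)) s.0#-homo)) ⟩
    0# + coeff f m * s^ m (coeff (map s g) n)
      ≈⟨ +-identityˡ _ ⟩
    coeff f m * s^ m (coeff (map s g) n)
      ≈⟨ *-congˡ (trans (s^.⟦⟧-cong m (coeff-s g n)) (reflexive (s^-s m _))) ⟩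
    coeff f m * s^ (suc m) (coeff g n) ∎

  -- X^n c, with the coefficient on the right
  monomial : ℕ → Carrier → Poly
  monomial zero    c = constant c
  monomial (suc n) c = 0# ∷ map s (monomial n c)

  monomial-cong : ∀ n {c d} → c ≈ d → monomial n c ≋ monomial n d
  monomial-cong zero    e = ∷-cong e ≋-refl
  monomial-cong (suc n) e = 0∷-cong (map-s-cong (monomial-cong n e))

  monomial-⊖ : ∀ n c → monomial n (- c) ≋ ⊖ monomial n c
  monomial-⊖ zero    c = ≋-refl
  monomial-⊖ (suc n) c = ∷-cong (sym (RingProperties.-0#≈0# ring)) (mk≋ λ i →
    trans (coeff-s (monomial n (- c)) i) (trans (s.⟦⟧-cong (trans (coeff-≈ (monomial-⊖ n c) i) (coeff-⊖ (monomial n c) i)))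
      (trans (s.-‿homo _) (sym (trans (coeff-⊖ (map s (monomial n c)) i) (-‿cong (coeff-s (monomial n c) i)))))))

  map-s-monomial : ∀ n c → map s (monomial n c) ≋ monomial n (s c)
  map-s-monomial zero    c = ≋-refl
  map-s-monomial (suc n) c = ∷-cong s.0#-homo (map-s-cong (map-s-monomial n c))

  suc-monomial-⊛ : ∀ n c g → monomial (suc n) c ⊛ g ≋ 0# ∷ map s (monomial n c ⊛ g)
  suc-monomial-⊛ n c g = ≋-trans (0∷-⊛ (map s (monomial n c)) g) (0∷-cong (≋-sym (map-s-⊛ (monomial n c) g)))

  coeff-monomial-⊛-< : ∀ n c g {i} → i ℕ.< n → coeff (monomial n c ⊛ g) i ≈ 0#
  coeff-monomial-⊛-< (suc n) c g {zero}  _         = coeff-≈ (suc-monomial-⊛ n c g) 0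
  coeff-monomial-⊛-< (suc n) c g {suc i} (s≤s i<n) = trans (coeff-≈ (suc-monomial-⊛ n c g) (suc i))
    (trans (coeff-s (monomial n c ⊛ g) i) (trans (s.⟦⟧-cong (coeff-monomial-⊛-< n c g i<n)) s.0#-homo))

  coeff-monomial-⊛ : ∀ n c g j → coeff (monomial n c ⊛ g) (n ℕ.+ j) ≈ s^ n (c * coeff g j)
  coeff-monomial-⊛ zero    c g j = coeff-constant-⊛ c g j
  coeff-monomial-⊛ (suc n) c g j = trans (coeff-≈ (suc-monomial-⊛ n c g) (suc n ℕ.+ j))
    (trans (coeff-s (monomial n c ⊛ g) (n ℕ.+ j)) (s.⟦⟧-cong (coeff-monomial-⊛ n c g j)))

  coeff-monomial-< : ∀ n c {i} → i ℕ.< n → coeff (monomial n c) i ≈ 0#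
  coeff-monomial-< (suc n) c {zero}  _         = refl
  coeff-monomial-< (suc n) c {suc i} (s≤s i<n) = trans (coeff-s (monomial n c) i)
    (trans (s.⟦⟧-cong (coeff-monomial-< n c i<n)) s.0#-homo)

  coeff-monomial-≡ : ∀ n c → coeff (monomial n c) n ≈ s^ n c
  coeff-monomial-≡ zero    c = refl
  coeff-monomial-≡ (suc n) c = trans (coeff-s (monomial n c) n) (s.⟦⟧-cong (coeff-monomial-≡ n c))

  coeff-⊛-monomial-< : ∀ n c g {i} → i ℕ.< n → coeff (g ⊛ monomial n c) i ≈ 0#
  coeff-⊛-monomial-< n c []      i<n = refl
  coeff-⊛-monomial-< n c (d ∷ g) {i} i<n = trans (coeff-⊕ (d · monomial n c) _ i)
    (trans (+-cong (trans (coeff-· d (monomial n c) i) (trans (*-congˡ (coeff-monomial-< n c i<n)) (zeroʳ d)))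
      (tail i i<n)) (+-identityˡ 0#))
    where
    tail : ∀ i → i ℕ.< n → coeff (0# ∷ (g ⊛ map s (monomial n c))) i ≈ 0#
    tail zero    _   = refl
    tail (suc i) i<n = trans (coeff-≈ (⊛-congʳ g (map-s-monomial n c)) i)
      (coeff-⊛-monomial-< n (s c) g (ℕ.<-trans (ℕ.n<1+n i) i<n))

  coeff-monomial-> : ∀ n c j → coeff (monomial n c) (n ℕ.+ suc j) ≈ 0#
  coeff-monomial-> zero    c j = refl
  coeff-monomial-> (suc n) c j = trans (coeff-s (monomial n c) (n ℕ.+ suc j))
    (trans (s.⟦⟧-cong (coeff-monomial-> n c j)) s.0#-homo)

  -- Here the twist reaches c alone, g_j X^j X^n c = g_j s^(n+j)(c) X^(n+j), whereas in
  -- `coeff-monomial-⊛` it also reaches g_j. Peeling one coefficient off g replaces c by s c.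
  coeff-⊛-monomial : ∀ n c g j → coeff (g ⊛ monomial n c) (n ℕ.+ j) ≈ coeff g j * s^ (n ℕ.+ j) c
  coeff-⊛-monomial n c []      j = sym (zeroˡ _)
  coeff-⊛-monomial n c (d ∷ g) zero = begin
    coeff ((d · monomial n c) ⊕ (0# ∷ (g ⊛ map s (monomial n c)))) (n ℕ.+ 0)
      ≡⟨ ≡.cong (coeff ((d · monomial n c) ⊕ (0# ∷ (g ⊛ map s (monomial n c))))) (ℕ.+-identityʳ n) ⟩
    coeff ((d · monomial n c) ⊕ (0# ∷ (g ⊛ map s (monomial n c)))) n
      ≈⟨ coeff-⊕ (d · monomial n c) _ n ⟩
    coeff (d · monomial n c) n + coeff (0# ∷ (g ⊛ map s (monomial n c))) n
      ≈⟨ +-cong (trans (coeff-· d (monomial n c) n) (*-congˡ (coeff-monomial-≡ n c))) (tail n ℕ.≤-refl) ⟩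
    d * s^ n c + 0#
      ≈⟨ +-identityʳ _ ⟩
    d * s^ n c
      ≡⟨ ≡.cong (λ m → d * s^ m c) (≡.sym (ℕ.+-identityʳ n)) ⟩
    d * s^ (n ℕ.+ 0) c ∎
    where
    tail : ∀ i → i ℕ.≤ n → coeff (0# ∷ (g ⊛ map s (monomial n c))) i ≈ 0#
    tail zero    _   = refl
    tail (suc i) i<n = trans (coeff-≈ (⊛-congʳ g (map-s-monomial n c)) i)
      (coeff-⊛-monomial-< n (s c) g i<n)
  coeff-⊛-monomial n c (d ∷ g) (suc j) = begin
    coeff ((d · monomial n c) ⊕ (0# ∷ (g ⊛ map s (monomial n c)))) (n ℕ.+ suc j)
      ≈⟨ coeff-⊕ (d · monomial n c) _ (n ℕ.+ suc j) ⟩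
    coeff (d · monomial n c) (n ℕ.+ suc j) + coeff (0# ∷ (g ⊛ map s (monomial n c))) (n ℕ.+ suc j)
      ≈⟨ +-cong (trans (coeff-· d (monomial n c) (n ℕ.+ suc j)) (trans (*-congˡ (coeff-monomial-> n c j)) (zeroʳ d)))
           (reflexive (≡.cong (coeff (0# ∷ (g ⊛ map s (monomial n c)))) (ℕ.+-suc n j))) ⟩
    0# + coeff (g ⊛ map s (monomial n c)) (n ℕ.+ j)
      ≈⟨ trans (+-identityˡ _) (coeff-≈ (⊛-congʳ g (map-s-monomial n c)) (n ℕ.+ j)) ⟩
    coeff (g ⊛ monomial n (s c)) (n ℕ.+ j)
      ≈⟨ coeff-⊛-monomial n (s c) g j ⟩
    coeff g j * s^ (n ℕ.+ j) (s c)
      ≡⟨ ≡.cong (coeff g j *_) (≡.trans (s^-s (n ℕ.+ j) c) (≡.cong (λ m → s^ m c) (≡.sym (ℕ.+-suc n j)))) ⟩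
    coeff g j * s^ (n ℕ.+ suc j) c ∎

  -- x₀ + X x₁ + ⋯ + X^(d-1) x_(d-1)
  embed : ∀ {d} → (Fin d → Carrier) → Poly
  embed {zero}  x = []
  embed {suc d} x = x zero ∷ map s (embed (x ∘ suc))

  embed-cong : ∀ {d} {x y : Fin d → Carrier} → (∀ i → x i ≈ y i) → embed x ≋ embed y
  embed-cong {zero}  e = ≋-refl
  embed-cong {suc d} e = ∷-cong (e zero) (map-s-cong (embed-cong (e ∘ suc)))

  embed-+ : ∀ {d} (x y : Fin d → Carrier) → embed (λ i → x i + y i) ≋ embed x ⊕ embed y
  embed-+ {zero}  x y = ≋-refl
  embed-+ {suc d} x y = ∷-cong refl (≋-trans (map-s-cong (embed-+ (x ∘ suc) (y ∘ suc)))
    (map-s-⊕ (embed (x ∘ suc)) (embed (y ∘ suc))))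

  -- A constant fixed by s passes through every X^i, so right and left multiplication agree.
  embed-constant-* : ∀ {c} → s c ≈ c → ∀ {d} (x : Fin d → Carrier) →
    embed (λ i → c * x i) ≋ constant c ⊛ embed x
  embed-constant-* {c} e x = ≋-trans (lemma x)
    (≋-sym (≋-trans (⊕-congˡ (c · embed x) (0∷[]≋[] refl ≋-refl)) (⊕-identityʳ _)))
    where
    lemma : ∀ {d} (x : Fin d → Carrier) → embed (λ i → c * x i) ≋ c · embed x
    lemma {zero}  x = ≋-refl
    lemma {suc d} x = ∷-cong refl (≋-trans (map-s-cong (lemma (x ∘ suc)))
      (≋-trans (map-s-· c _) (·-cong e ≋-refl)))

  embed-injective : (∀ {x y} → s x ≈ s y → x ≈ y) →
    ∀ {d} (x y : Fin d → Carrier) → embed x ≋ embed y → ∀ i → x i ≈ y i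
  embed-injective inj x y e zero    = coeff-≈ e 0
  embed-injective inj x y e (suc i) = embed-injective inj (x ∘ suc) (y ∘ suc)
    (mk≋ λ n → inj (trans (sym (coeff-s (embed (x ∘ suc)) n))
      (trans (coeff-≈ e (suc n)) (coeff-s (embed (y ∘ suc)) n)))) i

  coeff-embed-≥ : ∀ {d} (x : Fin d → Carrier) {n} → d ℕ.≤ n → coeff (embed x) n ≈ 0#
  coeff-embed-≥ {zero}  x _ = refl
  coeff-embed-≥ {suc d} x {suc n} (s≤s d≤n) = trans (coeff-s (embed (x ∘ suc)) n)
    (trans (s.⟦⟧-cong (coeff-embed-≥ (x ∘ suc) d≤n)) s.0#-homo)

  -- Indexing by ℕ lets the bound d shrink during reduction without reindexing the coordinates.
  truncate : ℕ → (ℕ → Carrier) → Poly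
  truncate d y = embed {d} (y ∘ toℕ)

  coeff-truncate : ∀ d y → (∀ n → d ℕ.≤ n → y n ≈ 0#) → ∀ n → coeff (truncate d y) n ≈ s^ n (y n)
  coeff-truncate zero    y h n       = sym (trans (s^.⟦⟧-cong n (h n z≤n)) (s^.0#-homo n))
  coeff-truncate (suc d) y h zero    = refl
  coeff-truncate (suc d) y h (suc n) = trans (coeff-s (truncate d (y ∘ suc)) n)
    (s.⟦⟧-cong (coeff-truncate d (y ∘ suc) (λ n d≤n → h (suc n) (s≤s d≤n)) n))

  ≋-truncate : ∀ f d y → (∀ n → d ℕ.≤ n → y n ≈ 0#) → (∀ n → coeff f n ≈ s^ n (y n)) → f ≋ truncate d y
  ≋-truncate f d y h e = mk≋ λ n → trans (e n) (sym (coeff-truncate d y h n))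

  truncate-suc : ∀ d y → truncate (suc d) y ≋ truncate d y ⊕ monomial d (y d)
  truncate-suc zero    y = ≋-refl
  truncate-suc (suc d) y = ∷-cong (sym (+-identityʳ _))
    (≋-trans (map-s-cong (truncate-suc d (y ∘ suc)))
      (map-s-⊕ (truncate d (y ∘ suc)) (monomial d (y (suc d)))))

  private
    module S = SemiringSum semiring
    module PS = SemiringSum (Ring.semiring polyRing)

  coeff-sum : ∀ {d} (F : Fin d → Poly) n → coeff (PS.sum F) n ≈ S.sum (λ i → coeff (F i) n)
  coeff-sum {zero}  F n = refl
  coeff-sum {suc d} F n = trans (coeff-⊕ (F zero) _ n) (+-congˡ (coeff-sum (F ∘ suc) n))

  s^-sum : ∀ n {d} (x : Fin d → Carrier) → s^ n (S.sum x) ≈ S.sum (s^ n ∘ x)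
  s^-sum n {zero}  x = s^.0#-homo n
  s^-sum n {suc d} x = trans (s^.+-homo n _ _) (+-congˡ (s^-sum n (x ∘ suc)))

  embed-monomials : ∀ {d} (x : Fin d → Carrier) → embed x ≋ PS.sum (λ i → monomial (toℕ i) (x i))
  embed-monomials {zero}  x = ≋-refl
  embed-monomials {suc d} x = ≋-trans
    (∷-cong (sym (+-identityʳ _)) (map-s-cong (embed-monomials (x ∘ suc))))
    (⊕-congˡ (constant (x zero)) (X-sum (λ i → monomial (toℕ i) (x (suc i)))))
    where
    X-sum : ∀ {d} (F : Fin d → Poly) → 0# ∷ map s (PS.sum F) ≋ PS.sum (λ i → 0# ∷ map s (F i))
    X-sum {zero}  F = 0∷[]≋[] refl ≋-refl
    X-sum {suc d} F = ≋-trans (0∷-cong (map-s-⊕ (F zero) (PS.sum (F ∘ suc))))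
      (≋-trans (0∷-⊕ (map s (F zero)) (map s (PS.sum (F ∘ suc)))) (⊕-congˡ (0# ∷ map s (F zero)) (X-sum (F ∘ suc))))

  coeff-embed-⊛ : ∀ {d} (x : Fin d → Carrier) g n →
    coeff (embed x ⊛ g) n ≈ S.sum (λ i → coeff (monomial (toℕ i) (x i) ⊛ g) n)
  coeff-embed-⊛ x g n = trans
    (coeff-≈ (≋-trans (⊛-cong (embed-monomials x) ≋-refl)
      (PS.*-distribʳ-sum g (λ i → monomial (toℕ i) (x i)))) n)
    (coeff-sum (λ i → monomial (toℕ i) (x i) ⊛ g) n)

-- 𝐭^σ-modules from matrices, and their Mordell-Weil modules

module TModuleProperties (𝒦 : PerfectAField f ℓf ℓf# k ℓk ℓk#) where
  open TModules 𝒦 public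
  module 𝔽 = CommutativeRing (fieldRing 𝔽q)
  module ι = RingMorphisms.IsRingHomomorphism ι-isRingHom
  module τ = RingMorphisms.IsRingHomomorphism τ-isRingHom
  module σ = RingMorphisms.IsRingHomomorphism σ-isRingHom
  module τP = SkewPolynomialProperties K-ring τ τ-isRingHom
  module σP = SkewPolynomialProperties K-ring σ σ-isRingHom
  open τP public using () renaming (s^ to τ^; module s^ to τ^)
  open σP public using () renaming (s^ to σ^; module s^ to σ^)

  τσ : ∀ x → τ (σ x) K.≈ x
  τσ = Root.root-^q K-ring {p} K-perfect m

  τ-injective : ∀ {x y} → τ x K.≈ τ y → x K.≈ y
  τ-injective = proj₁ (Root.^q-bijective K-ring {p} K-perfect m)

  τ^σ^ : ∀ n x → τ^ n (σ^ n x) K.≈ x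
  τ^σ^ zero    x = K.refl
  τ^σ^ (suc n) x = K.trans (τ.⟦⟧-cong (K.reflexive (≡.cong (τ^ n) (≡.sym (σP.s^-s n x)))))
    (K.trans (τ.⟦⟧-cong (τ^σ^ n (σ x))) (τσ x))

  ι₀-isRingHom : IsRingHom (CommutativeRing.ring (fieldRing 𝔽q)) K.ring ι₀
  ι₀-isRingHom = mkIsRingHom (CommutativeRing.ring (fieldRing 𝔽q)) K.ring ι₀
    (ι.⟦⟧-cong ∘ c.⟦⟧-cong)
    (λ x y → K.trans (ι.⟦⟧-cong (c.+-homo x y)) (ι.+-homo _ _))
    (λ x y → K.trans (ι.⟦⟧-cong (c.*-homo x y)) (ι.*-homo _ _))
    (K.trans (ι.⟦⟧-cong c.1#-homo) ι.1#-homo)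
    where module c = RingMorphisms.IsRingHomomorphism (Polynomial.constant-isRingHom (fieldRing 𝔽q))

  module ι₀ = RingMorphisms.IsRingHomomorphism ι₀-isRingHom

  -- `fermat` in 𝔽_q, carried over by the ring homomorphism `ι₀`.
  τ-ι₀ : ∀ c → τ (ι₀ c) K.≈ ι₀ c
  τ-ι₀ c = K.trans (K.sym (ι₀-^ q)) (ι₀.⟦⟧-cong (FiniteField.fermat 𝔽q 𝔽q-card c))
    where
    ι₀-^ : ∀ n → ι₀ (_^_ (fieldRing 𝔽q) c n) K.≈ _^_ K-ring (ι₀ c) n
    ι₀-^ zero    = ι₀.1#-homo
    ι₀-^ (suc n) = K.trans (ι₀.*-homo _ _) (K.*-congˡ (ι₀-^ n))

  σ-ι₀ : ∀ c → σ (ι₀ c) K.≈ ι₀ c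
  σ-ι₀ c = τ-injective (K.trans (τσ (ι₀ c)) (K.sym (τ-ι₀ c)))

  private
    module MR = MatrixRing K⟨σ⟩.polyRing
    constant-ι₀-isRingHom : IsRingHom (CommutativeRing.ring (fieldRing 𝔽q)) K⟨σ⟩.polyRing (K⟨σ⟩.constant ∘ ι₀)
    constant-ι₀-isRingHom = mkIsRingHom (CommutativeRing.ring (fieldRing 𝔽q)) K⟨σ⟩.polyRing (K⟨σ⟩.constant ∘ ι₀)
      (λ e → c.⟦⟧-cong (ι₀.⟦⟧-cong e))
      (λ x y → K⟨σ⟩.≋-trans (c.⟦⟧-cong (ι₀.+-homo x y)) (c.+-homo (ι₀ x) (ι₀ y)))
      (λ x y → K⟨σ⟩.≋-trans (c.⟦⟧-cong (ι₀.*-homo x y)) (c.*-homo (ι₀ x) (ι₀ y)))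
      (c.⟦⟧-cong ι₀.1#-homo)
      where module c = RingMorphisms.IsRingHomomorphism K⟨σ⟩.constant-isRingHom
    module cι = RingMorphisms.IsRingHomomorphism constant-ι₀-isRingHom

  module FromMatrix {d} (M : Matσ.Mat d d)
    (M₀ : ∀ i j → K⟨σ⟩.coeff (M i j) 0 K.≈ Matₖ.scalar θ i j) where
    private
      module sc = RingMorphisms.IsRingHomomorphism (MR.scalar-isRingHom d)
      h : 𝔽.Carrier → Matσ.Mat d d
      h c = Matσ.scalar (K⟨σ⟩.constant (ι₀ c))
      h-isRingHom : IsRingHom (CommutativeRing.ring (fieldRing 𝔽q)) (MR.matRing d) h
      h-isRingHom = mkIsRingHom (CommutativeRing.ring (fieldRing 𝔽q)) (MR.matRing d) h
        (λ e → sc.⟦⟧-cong (cι.⟦⟧-cong e))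
        (λ x y → Ring.trans (MR.matRing d) (sc.⟦⟧-cong (cι.+-homo x y)) (sc.+-homo _ _))
        (λ x y → Ring.trans (MR.matRing d) (sc.⟦⟧-cong (cι.*-homo x y)) (sc.*-homo _ _))
        (Ring.trans (MR.matRing d) (sc.⟦⟧-cong cι.1#-homo) sc.1#-homo)
      -- Scalar matrices over 𝔽_q are central because σ fixes their entries.
      h-comm : ∀ c → h c Matσ.*ₘ M Matσ.≈ₘ M Matσ.*ₘ h c
      h-comm c i l = K⟨σ⟩.≋-trans (MR.sum-scalar-* (K⟨σ⟩.constant (ι₀ c)) (λ j → M j l) i)
        (K⟨σ⟩.≋-trans (K⟨σ⟩.≋-sym (σP.⊛-constant-comm (σ-ι₀ c) (M i l)))
          (K⟨σ⟩.≋-sym (MR.sum-*-scalar (K⟨σ⟩.constant (ι₀ c)) (M i) l)))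
      module E = PolynomialEvaluation (fieldRing 𝔽q) (MR.matRing d) h-isRingHom M h-comm

    tσModule : TσModule d
    tσModule = record
      { ⟦_⟧ = E.evaluate
      ; isRingHom = E.evaluate-isRingHom
      ; 𝔽q-linear = E.evaluate-constant
      ; N = λ _ _ → K.0#
      ; N-nilpotent = 1 , Ring.zeroˡ (MatrixRing.matRing K.ring d) (Matₖ.scalar K.1#)
      ; constant-term = λ i j → K.trans (K⟨σ⟩.coeff-≈ (E.evaluate-t i j) 0)
          (K.trans (M₀ i j) (K.sym (K.+-identityʳ _))) }

    ⟦t⟧ : TσModule.⟦_⟧ tσModule A.t Matσ.≈ₘ M
    ⟦t⟧ = E.evaluate-t

  private module P = Points K-algebra

  apply-constant : ∀ {d} (Φ : TσModule d) c x i →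
    P.apply (TσModule.⟦_⟧ Φ (A.constant c)) x i K.≈ ι₀ c K.* x i
  apply-constant Φ c x i = K.trans (P.apply-cong (TσModule.𝔽q-linear Φ c) (λ _ → K.refl) i)
    (K.trans (S.sum-cong-≋ λ j → lemma i j) (MatrixRing.sum-scalar-* K.ring (ι₀ c) x i))
    where
    module S = SemiringSum K.semiring
    lemma : ∀ i j → P.eval (Matσ.scalar (K⟨σ⟩.constant (ι₀ c)) i j) (x j) K.≈ Matₖ.scalar (ι₀ c) i j K.* x j
    lemma i j with i Fin.≟ j
    ... | yes _ = K.+-identityʳ _
    ... | no  _ = K.sym (K.zeroˡ (x j))

  eval-monomial : ∀ n c x → P.eval (σP.monomial n c) x K.≈ σ^ n (c K.* x)
  eval-monomial zero    c x = K.+-identityʳ _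
  eval-monomial (suc n) c x = K.trans (P.eval-0∷ (map σ (σP.monomial n c)) x)
    (K.trans (K.sym (P.σᴿ-eval (σP.monomial n c) x)) (σ.⟦⟧-cong (eval-monomial n c x)))

  -- `commutes` takes care of t only. Evaluating a σ-polynomial is merely additive on K, so
  -- linearity over 𝔽_q rests on σ fixing `ι₀ c`.
  apply-Morphism-isLinear : ∀ {d e} {Ψ : TσModule e} {Φ : TσModule d} (g : Morphism Ψ Φ) →
    IsLinear (MordellWeil Ψ) (MordellWeil Φ) (P.apply (Morphism.matrix g))
  apply-Morphism-isLinear {Ψ = Ψ} {Φ} g = mkIsLinearₜ (fieldRing 𝔽q) (MordellWeil Ψ) (MordellWeil Φ) (P.apply G)
    (P.apply-cong {M = G} (λ _ _ → K⟨σ⟩.≋-refl))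
    (P.apply-+ G)
    (λ c x → λ i → K.trans (P.apply-cong {M = G} (λ _ _ → K⟨σ⟩.≋-refl) (apply-constant Ψ c x) i)
      (K.trans (lemma c x i) (K.sym (apply-constant Φ c (P.apply G x) i))))
    (λ x i → K.trans (K.sym (P.apply-*ₘ G (TσModule.⟦_⟧ Ψ A.t) x i))
      (K.trans (P.apply-cong (Morphism.commutes g) (λ _ → K.refl) i)
        (P.apply-*ₘ (TσModule.⟦_⟧ Φ A.t) G x i)))
    where
    G = Morphism.matrix g
    module S = SemiringSum K.semiring
    eval-ι₀ : ∀ c f x → P.eval f (ι₀ c K.* x) K.≈ ι₀ c K.* P.eval f x
    eval-ι₀ c []      x = K.sym (K.zeroʳ _)
    eval-ι₀ c (d ∷ f) x = K.trans (K.+-cong (C.x∙yz≈y∙xz d (ι₀ c) x)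
        (K.trans (P.eval-cong f f K⟨σ⟩.≋-refl (K.trans (σ.*-homo _ _) (K.*-congʳ (σ-ι₀ c))))
          (eval-ι₀ c f (σ x))))
      (K.sym (K.distribˡ _ _ _))
      where module C = CommutativeSemigroupProperties K.*-commutativeSemigroup
    lemma : ∀ c x i → P.apply G (λ j → ι₀ c K.* x j) i K.≈ ι₀ c K.* P.apply G x i
    lemma c x i = K.trans (S.sum-cong-≋ λ j → eval-ι₀ c (G i j) (x j))
      (K.sym (S.*-distribˡ-sum (ι₀ c) (λ j → P.eval (G i j) (x j))))

-- Drinfeld modules, derivations and classes in Ext

module DrinfeldProperties (𝒦 : PerfectAField f ℓf ℓf# k ℓk ℓk#) where
  open TModuleProperties 𝒦
  open K⟨τ⟩

  ⟨⟩-* : ∀ (φ : DrinfeldModule) a b → φ ⟨ a A.* b ⟩ ≋ φ ⟨ a ⟩ ⊛ φ ⟨ b ⟩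
  ⟨⟩-* φ a b = ≋-trans (TModule.*-homo φ a b zero zero) (⊕-identityʳ _)

  ⟨⟩-∷ : ∀ (φ : DrinfeldModule) c a → φ ⟨ c ∷ a ⟩ ≋ constant (ι₀ c) ⊕ (φ ⟨ A.t ⟩ ⊛ φ ⟨ a ⟩)
  ⟨⟩-∷ φ c a = ≋-trans (TModule.⟦⟧-cong φ (PolynomialProperties.∷-decompose (fieldRing 𝔽q) c a) zero zero)
    (≋-trans (TModule.+-homo φ (A.constant c) (A.t A.* a) zero zero)
      (⊕-cong (TModule.𝔽q-linear φ c zero zero) (⟨⟩-* φ A.t a)))

  -- A nilpotent 1 × 1 matrix over a field is 0: were its entry apart from 0, so would be all its
  -- powers; tightness turns this into equality.
  coeff₀-⟨t⟩ : ∀ (φ : DrinfeldModule) → coeff (φ ⟨ A.t ⟩) 0 K.≈ θ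
  coeff₀-⟨t⟩ φ = K.trans (constant-term zero zero)
    (K.trans (K.+-congˡ (HK.¬#0⇒≈0 λ N#0 → HK.1≉0 (contradict (^-#0 N#0 (proj₁ N-nilpotent))))) (K.+-identityʳ θ))
    where
    open TModule φ
    module HK = HeytingFieldProperties K
    power : ℕ → Matₖ.Mat 1 1
    power n = RawSemiringDefs._^_ (RawRing.rawSemiring (Matₖ.matRawRing 1)) N n
    ^-#0 : N zero zero K.# K.0# → ∀ n → power n zero zero K.# K.0#
    ^-#0 N#0 zero    = HK.1#0
    ^-#0 N#0 (suc n) = HK.#-congʳ (K.sym (K.+-identityʳ _)) (HK.x#0y#0→xy#0 N#0 (^-#0 N#0 n))
    contradict : power (proj₁ N-nilpotent) zero zero K.# K.0# → K.1# K.≈ K.0#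
    contradict h = K.trans (K.sym (proj₂ (HK.recip h)))
      (K.trans (K.*-congˡ (proj₂ N-nilpotent zero zero)) (K.zeroʳ _))

  comm-ι₀ : ∀ c f → f ⊛ constant (ι₀ c) ≋ constant (ι₀ c) ⊛ f
  comm-ι₀ c = τP.⊛-constant-comm (τ-ι₀ c)

  swap-ι₀ : ∀ c f g → f ⊛ (constant (ι₀ c) ⊛ g) ≋ constant (ι₀ c) ⊛ (f ⊛ g)
  swap-ι₀ c f g = ≋-trans (≋-sym (⊛-assoc f (constant (ι₀ c)) g))
    (≋-trans (⊛-cong (comm-ι₀ c f) ≋-refl) (⊛-assoc (constant (ι₀ c)) f g))

  module DerivationProperties (φ ψ : DrinfeldModule) where
    open Extensions φ ψ
    private
      module P = Ring polyRing
      module G = GroupProperties P.+-group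
      module C = CommutativeSemigroupProperties (AbelianGroup.commutativeSemigroup ⊕-abelianGroup)
      module E = LeftModule Ext
      module FP = Polynomial (fieldRing 𝔽q)
      open Relation.Binary.Reasoning.Setoid ≋-setoid

    φₜ ψₜ : Poly
    φₜ = φ ⟨ A.t ⟩
    ψₜ = ψ ⟨ A.t ⟩

    module _ (h : Poly) where
      private
        -- The recursion is forced by the Leibniz rule for t · a and by the vanishing of derivations
        -- on constants, as `δ-∷` shows.
        δₕ : A.Carrier → Poly
        δₕ []      = []
        δₕ (c ∷ a) = (ψₜ ⊛ δₕ a) ⊕ (h ⊛ φ ⟨ a ⟩)

        δₕ-≋[] : ∀ a → a FP.≋ [] → δₕ a ≋ []
        δₕ-≋[] []      e = ≋-refl
        δₕ-≋[] (c ∷ a) e = ⊕-cong (≋-trans (⊛-congʳ ψₜ (δₕ-≋[] a a≋[])) (P.zeroʳ ψₜ))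
          (≋-trans (⊛-congʳ h (≋-trans (TModule.⟦⟧-cong φ a≋[] zero zero) (TModule.0#-homo φ zero zero))) (P.zeroʳ h))
          where
          a≋[] : a FP.≋ []
          a≋[] = FP.mk≋ λ n → FP.coeff-≈ e (suc n)

        δₕ-cong : ∀ a b → a FP.≋ b → δₕ a ≋ δₕ b
        δₕ-cong []      b       e = ≋-sym (δₕ-≋[] b (FP.≋-sym e))
        δₕ-cong (c ∷ a) []      e = δₕ-≋[] (c ∷ a) e
        δₕ-cong (c ∷ a) (d ∷ b) e = ⊕-cong (⊛-congʳ ψₜ (δₕ-cong a b (FP.tail≋ e)))
          (⊛-congʳ h (TModule.⟦⟧-cong φ (FP.tail≋ e) zero zero))

        δₕ-+ : ∀ a b → δₕ (a A.+ b) ≋ δₕ a ⊕ δₕ b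
        δₕ-+ []      b       = ≋-refl
        δₕ-+ (c ∷ a) []      = ≋-sym (⊕-identityʳ _)
        δₕ-+ (c ∷ a) (d ∷ b) = ≋-trans
          (⊕-cong (≋-trans (⊛-congʳ ψₜ (δₕ-+ a b)) (⊛-distribˡ ψₜ (δₕ a) (δₕ b)))
            (≋-trans (⊛-congʳ h (TModule.+-homo φ a b zero zero)) (⊛-distribˡ h (φ ⟨ a ⟩) (φ ⟨ b ⟩))))
          (C.interchange (ψₜ ⊛ δₕ a) (ψₜ ⊛ δₕ b) (h ⊛ φ ⟨ a ⟩) (h ⊛ φ ⟨ b ⟩))

        constant-* : ∀ c a → A.constant c A.* a FP.≋ c FP.· a
        constant-* c a = FP.≋-trans (FP.⊕-congˡ (c FP.· a) (FP.0∷[]≋[] 𝔽.refl FP.≋-refl)) (FP.⊕-identityʳ _)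

        δₕ-· : ∀ c a → δₕ (c FP.· a) ≋ constant (ι₀ c) ⊛ δₕ a
        δₕ-· c []      = ≋-sym (P.zeroʳ (constant (ι₀ c)))
        δₕ-· c (d ∷ a) = begin
          (ψₜ ⊛ δₕ (c FP.· a)) ⊕ (h ⊛ φ ⟨ c FP.· a ⟩)
            ≈⟨ ⊕-cong (≋-trans (⊛-congʳ ψₜ (δₕ-· c a)) (swap-ι₀ c ψₜ (δₕ a)))
                 (≋-trans (⊛-congʳ h φ-·) (swap-ι₀ c h (φ ⟨ a ⟩))) ⟩
          (constant (ι₀ c) ⊛ (ψₜ ⊛ δₕ a)) ⊕ (constant (ι₀ c) ⊛ (h ⊛ φ ⟨ a ⟩))
            ≈⟨ ⊛-distribˡ (constant (ι₀ c)) (ψₜ ⊛ δₕ a) (h ⊛ φ ⟨ a ⟩) ⟨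
          constant (ι₀ c) ⊛ ((ψₜ ⊛ δₕ a) ⊕ (h ⊛ φ ⟨ a ⟩)) ∎
          where
          φ-· : φ ⟨ c FP.· a ⟩ ≋ constant (ι₀ c) ⊛ φ ⟨ a ⟩
          φ-· = ≋-trans (TModule.⟦⟧-cong φ (FP.≋-sym (constant-* c a)) zero zero)
            (≋-trans (⟨⟩-* φ (A.constant c) a) (⊛-cong (TModule.𝔽q-linear φ c zero zero) ≋-refl))

        -- Induction on a alone, through ψ_(c + t a) = ι₀ c + ψ_t ψ_a; the constant part passes
        -- through `δₕ` because it is central.
        δₕ-leibniz : ∀ a b → δₕ (a A.* b) ≋ (ψ ⟨ a ⟩ ⊛ δₕ b) ⊕ (δₕ a ⊛ φ ⟨ b ⟩)
        δₕ-leibniz [] b = ≋-sym (≋-trans (⊕-identityʳ _) (⊛-zeroˡ (ψ ⟨ [] ⟩) (TModule.0#-homo ψ zero zero)))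
        δₕ-leibniz (c ∷ a) b = begin
          δₕ ((c ∷ a) A.* b)
            ≈⟨ δₕ-+ (c FP.· b) (𝔽.0# ∷ (a A.* map id b)) ⟩
          δₕ (c FP.· b) ⊕ ((ψₜ ⊛ δₕ (a A.* map id b)) ⊕ (h ⊛ φ ⟨ a A.* map id b ⟩))
            ≈⟨ ⊕-cong (δₕ-· c b) (⊕-cong
                 (⊛-congʳ ψₜ (≋-trans (δₕ-cong _ _ (FP.⊛-congʳ a (FP.map-id≋ b))) (δₕ-leibniz a b)))
                 (⊛-congʳ h (≋-trans (TModule.⟦⟧-cong φ (FP.⊛-congʳ a (FP.map-id≋ b)) zero zero) (⟨⟩-* φ a b)))) ⟩
          (constant (ι₀ c) ⊛ δₕ b) ⊕ ((ψₜ ⊛ ((ψ ⟨ a ⟩ ⊛ δₕ b) ⊕ (δₕ a ⊛ φ ⟨ b ⟩))) ⊕ (h ⊛ (φ ⟨ a ⟩ ⊛ φ ⟨ b ⟩)))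
            ≈⟨ ⊕-congˡ (constant (ι₀ c) ⊛ δₕ b) (⊕-cong
                 (≋-trans (⊛-distribˡ ψₜ (ψ ⟨ a ⟩ ⊛ δₕ b) (δₕ a ⊛ φ ⟨ b ⟩))
                   (⊕-cong (≋-sym (⊛-assoc ψₜ (ψ ⟨ a ⟩) (δₕ b))) (≋-sym (⊛-assoc ψₜ (δₕ a) (φ ⟨ b ⟩)))))
                 (≋-sym (⊛-assoc h (φ ⟨ a ⟩) (φ ⟨ b ⟩)))) ⟩
          (constant (ι₀ c) ⊛ δₕ b)
            ⊕ ((((ψₜ ⊛ ψ ⟨ a ⟩) ⊛ δₕ b) ⊕ ((ψₜ ⊛ δₕ a) ⊛ φ ⟨ b ⟩)) ⊕ ((h ⊛ φ ⟨ a ⟩) ⊛ φ ⟨ b ⟩))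
            ≈⟨ ⊕-congˡ (constant (ι₀ c) ⊛ δₕ b)
                 (⊕-assoc ((ψₜ ⊛ ψ ⟨ a ⟩) ⊛ δₕ b) ((ψₜ ⊛ δₕ a) ⊛ φ ⟨ b ⟩) ((h ⊛ φ ⟨ a ⟩) ⊛ φ ⟨ b ⟩)) ⟩
          (constant (ι₀ c) ⊛ δₕ b)
            ⊕ (((ψₜ ⊛ ψ ⟨ a ⟩) ⊛ δₕ b) ⊕ (((ψₜ ⊛ δₕ a) ⊛ φ ⟨ b ⟩) ⊕ ((h ⊛ φ ⟨ a ⟩) ⊛ φ ⟨ b ⟩)))
            ≈⟨ ⊕-assoc (constant (ι₀ c) ⊛ δₕ b) ((ψₜ ⊛ ψ ⟨ a ⟩) ⊛ δₕ b)
                 (((ψₜ ⊛ δₕ a) ⊛ φ ⟨ b ⟩) ⊕ ((h ⊛ φ ⟨ a ⟩) ⊛ φ ⟨ b ⟩)) ⟨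
          ((constant (ι₀ c) ⊛ δₕ b) ⊕ ((ψₜ ⊛ ψ ⟨ a ⟩) ⊛ δₕ b))
            ⊕ (((ψₜ ⊛ δₕ a) ⊛ φ ⟨ b ⟩) ⊕ ((h ⊛ φ ⟨ a ⟩) ⊛ φ ⟨ b ⟩))
            ≈⟨ ⊕-cong (≋-trans (⊛-cong (⟨⟩-∷ ψ c a) ≋-refl) (⊛-distribʳ (δₕ b) (constant (ι₀ c)) (ψₜ ⊛ ψ ⟨ a ⟩)))
                 (⊛-distribʳ (φ ⟨ b ⟩) (ψₜ ⊛ δₕ a) (h ⊛ φ ⟨ a ⟩)) ⟨
          (ψ ⟨ c ∷ a ⟩ ⊛ δₕ b) ⊕ (((ψₜ ⊛ δₕ a) ⊕ (h ⊛ φ ⟨ a ⟩)) ⊛ φ ⟨ b ⟩) ∎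

      derivation : Derivation
      derivation = record
        { δ = δₕ
        ; cong = δₕ-cong _ _
        ; +-homo = δₕ-+
        ; 𝔽q-linear = λ c a → ≋-trans (δₕ-cong _ _ (constant-* c a)) (δₕ-· c a)
        ; leibniz = δₕ-leibniz }

      derivation-t : δ derivation A.t ≋ h
      derivation-t = ⊕-cong
        (≋-trans (⊛-congʳ ψₜ (⊕-cong (P.zeroʳ ψₜ)
          (≋-trans (⊛-congʳ h (TModule.0#-homo φ zero zero)) (P.zeroʳ h)))) (P.zeroʳ ψₜ))
        (≋-trans (⊛-congʳ h (TModule.1#-homo φ zero zero)) (⊛-constant-1 h K.refl))

    δ-[] : ∀ D → δ D [] ≋ []
    δ-[] D = G.identityʳ-unique (δ D []) (δ D []) (≋-sym (+-homo D [] []))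

    -- Leibniz for 1 · 1 gives δ(1) = δ(1) + δ(1), so δ(1) = 0, and 𝔽_q-linearity extends this to
    -- all constants.
    δ-constant : ∀ D c → δ D (A.constant c) ≋ []
    δ-constant D c = begin
      δ D (A.constant c)                   ≈⟨ cong D (A.*-identityʳ (A.constant c)) ⟨
      δ D (A.constant c A.* A.1#)          ≈⟨ 𝔽q-linear D c A.1# ⟩
      constant (ι₀ c) ⊛ δ D A.1#           ≈⟨ ⊛-congʳ (constant (ι₀ c)) δ-1 ⟩
      constant (ι₀ c) ⊛ []                 ≈⟨ P.zeroʳ (constant (ι₀ c)) ⟩
      []                                   ∎
      where
      δ-1 : δ D A.1# ≋ []
      δ-1 = G.identityʳ-unique (δ D A.1#) (δ D A.1#) (≋-sym (begin
        δ D A.1#                                           ≈⟨ cong D (A.*-identityʳ A.1#) ⟨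
        δ D (A.1# A.* A.1#)                                ≈⟨ leibniz D A.1# A.1# ⟩
        (ψ ⟨ A.1# ⟩ ⊛ δ D A.1#) ⊕ (δ D A.1# ⊛ φ ⟨ A.1# ⟩)
          ≈⟨ ⊕-cong (≋-trans (⊛-cong (TModule.1#-homo ψ zero zero) ≋-refl) (⊛-identityˡ (δ D A.1#)))
               (≋-trans (⊛-congʳ (δ D A.1#) (TModule.1#-homo φ zero zero)) (⊛-constant-1 (δ D A.1#) K.refl)) ⟩
        δ D A.1# ⊕ δ D A.1#                                ∎))

    δ-∷ : ∀ D c a → δ D (c ∷ a) ≋ (ψₜ ⊛ δ D a) ⊕ (δ D A.t ⊛ φ ⟨ a ⟩)
    δ-∷ D c a = ≋-trans (cong D (PolynomialProperties.∷-decompose (fieldRing 𝔽q) c a))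
      (≋-trans (+-homo D (A.constant c) (A.t A.* a)) (⊕-cong (δ-constant D c) (leibniz D A.t a)))

    -- The identity δ(a) = U φ_a − ψ_a U is propagated from t in the form δ(a) + ψ_a U = U φ_a.
    isInner-from-t : ∀ D U → δ D A.t ≋ (U ⊛ φₜ) ⊕ (⊖ (ψₜ ⊛ U)) → IsInner D
    isInner-from-t D U e = U , λ a → G.x≈z//y (δ D a) (ψ ⟨ a ⟩ ⊛ U) (U ⊛ φ ⟨ a ⟩) (sum-form a)
      where
      sum-form-t : δ D A.t ⊕ (ψₜ ⊛ U) ≋ U ⊛ φₜ
      sum-form-t = ≋-trans (⊕-cong e ≋-refl) (≋-trans (⊕-assoc (U ⊛ φₜ) (⊖ (ψₜ ⊛ U)) (ψₜ ⊛ U))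
        (≋-trans (⊕-congˡ (U ⊛ φₜ) (P.-‿inverseˡ (ψₜ ⊛ U))) (⊕-identityʳ _)))
      sum-form : ∀ a → δ D a ⊕ (ψ ⟨ a ⟩ ⊛ U) ≋ U ⊛ φ ⟨ a ⟩
      sum-form [] = ≋-trans (⊕-cong (δ-[] D) (⊛-zeroˡ (ψ ⟨ [] ⟩) (TModule.0#-homo ψ zero zero)))
        (≋-sym (≋-trans (⊛-congʳ U (TModule.0#-homo φ zero zero)) (P.zeroʳ U)))
      sum-form (c ∷ a) = begin
        δ D (c ∷ a) ⊕ (ψ ⟨ c ∷ a ⟩ ⊛ U)
          ≈⟨ ⊕-cong (δ-∷ D c a) (≋-trans (⊛-cong (⟨⟩-∷ ψ c a) ≋-refl)
               (≋-trans (⊛-distribʳ U κ (ψₜ ⊛ B)) (⊕-comm (κ ⊛ U) ((ψₜ ⊛ B) ⊛ U)))) ⟩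
        ((ψₜ ⊛ δ D a) ⊕ (δ D A.t ⊛ A′)) ⊕ (((ψₜ ⊛ B) ⊛ U) ⊕ (κ ⊛ U))
          ≈⟨ ⊕-assoc ((ψₜ ⊛ δ D a) ⊕ (δ D A.t ⊛ A′)) ((ψₜ ⊛ B) ⊛ U) (κ ⊛ U) ⟨
        (((ψₜ ⊛ δ D a) ⊕ (δ D A.t ⊛ A′)) ⊕ ((ψₜ ⊛ B) ⊛ U)) ⊕ (κ ⊛ U)
          ≈⟨ ⊕-cong (C.xy∙z≈xz∙y (ψₜ ⊛ δ D a) (δ D A.t ⊛ A′) ((ψₜ ⊛ B) ⊛ U)) ≋-refl ⟩
        (((ψₜ ⊛ δ D a) ⊕ ((ψₜ ⊛ B) ⊛ U)) ⊕ (δ D A.t ⊛ A′)) ⊕ (κ ⊛ U)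
          ≈⟨ ⊕-cong (⊕-cong first ≋-refl) (≋-sym (comm-ι₀ c U)) ⟩
        (((ψₜ ⊛ U) ⊛ A′) ⊕ (δ D A.t ⊛ A′)) ⊕ (U ⊛ κ)
          ≈⟨ ⊕-cong (≋-trans (⊕-comm ((ψₜ ⊛ U) ⊛ A′) (δ D A.t ⊛ A′))
               (≋-sym (⊛-distribʳ A′ (δ D A.t) (ψₜ ⊛ U)))) ≋-refl ⟩
        ((δ D A.t ⊕ (ψₜ ⊛ U)) ⊛ A′) ⊕ (U ⊛ κ)
          ≈⟨ ⊕-cong (≋-trans (⊛-cong sum-form-t ≋-refl) (⊛-assoc U φₜ A′)) ≋-refl ⟩
        (U ⊛ (φₜ ⊛ A′)) ⊕ (U ⊛ κ)
          ≈⟨ ≋-trans (⊕-comm (U ⊛ (φₜ ⊛ A′)) (U ⊛ κ)) (≋-sym (⊛-distribˡ U κ (φₜ ⊛ A′))) ⟩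
        U ⊛ (κ ⊕ (φₜ ⊛ A′))
          ≈⟨ ⊛-congʳ U (⟨⟩-∷ φ c a) ⟨
        U ⊛ φ ⟨ c ∷ a ⟩ ∎
        where
        κ = constant (ι₀ c)
        A′ = φ ⟨ a ⟩
        B = ψ ⟨ a ⟩
        first : (ψₜ ⊛ δ D a) ⊕ ((ψₜ ⊛ B) ⊛ U) ≋ (ψₜ ⊛ U) ⊛ A′
        first = begin
          (ψₜ ⊛ δ D a) ⊕ ((ψₜ ⊛ B) ⊛ U)   ≈⟨ ⊕-congˡ (ψₜ ⊛ δ D a) (⊛-assoc ψₜ B U) ⟩
          (ψₜ ⊛ δ D a) ⊕ (ψₜ ⊛ (B ⊛ U))   ≈⟨ ⊛-distribˡ ψₜ (δ D a) (B ⊛ U) ⟨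
          ψₜ ⊛ (δ D a ⊕ (B ⊛ U))          ≈⟨ ⊛-congʳ ψₜ (sum-form a) ⟩
          ψₜ ⊛ (U ⊛ A′)                   ≈⟨ ⊛-assoc ψₜ U A′ ⟨
          (ψₜ ⊛ U) ⊛ A′                   ∎

    infix 4 _≈ₑ_
    _≈ₑ_ : Derivation → Derivation → Set _
    _≈ₑ_ = E._≈ᴹ_

    ≈ₑ-inner : ∀ D D′ U → δ D A.t ⊕ (⊖ δ D′ A.t) ≋ (U ⊛ φₜ) ⊕ (⊖ (ψₜ ⊛ U)) → D ≈ₑ D′
    ≈ₑ-inner D D′ U e = mk~ (isInner-from-t (D +ᴰ (-ᴰ D′)) U e)

    -- The case U = 0 of `≈ₑ-inner`. It reduces the identities in Ext below to the values at t.
    ≈ₑ-at-t : ∀ D D′ → δ D A.t ≋ δ D′ A.t → D ≈ₑ D′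
    ≈ₑ-at-t D D′ e = ≈ₑ-inner D D′ [] (begin
      δ D A.t ⊕ (⊖ δ D′ A.t)    ≈⟨ ⊕-cong e ≋-refl ⟩
      δ D′ A.t ⊕ (⊖ δ D′ A.t)   ≈⟨ ⊖-inverseʳ (δ D′ A.t) ⟩
      []                        ≈⟨ ⊖-cong (P.zeroʳ ψₜ) ⟨
      ⊖ (ψₜ ⊛ [])               ∎)

    derivation-cong : ∀ {g h} → g ≋ h → derivation g ≈ₑ derivation h
    derivation-cong {g} {h} e = ≈ₑ-at-t (derivation g) (derivation h)
      (≋-trans (derivation-t g) (≋-trans e (≋-sym (derivation-t h))))

    derivation-⊕ : ∀ g h → derivation (g ⊕ h) ≈ₑ derivation g +ᴰ derivation h
    derivation-⊕ g h = ≈ₑ-at-t (derivation (g ⊕ h)) (derivation g +ᴰ derivation h)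
      (≋-trans (derivation-t (g ⊕ h)) (≋-sym (⊕-cong (derivation-t g) (derivation-t h))))

    derivation-* : ∀ a h → derivation (ψ ⟨ a ⟩ ⊛ h) ≈ₑ a *ᴰ derivation h
    derivation-* a h = ≈ₑ-at-t (derivation (ψ ⟨ a ⟩ ⊛ h)) (a *ᴰ derivation h)
      (≋-trans (derivation-t (ψ ⟨ a ⟩ ⊛ h)) (≋-sym (⊛-congʳ (ψ ⟨ a ⟩) (derivation-t h))))

    derivation-δ : ∀ D → derivation (δ D A.t) ≈ₑ D
    derivation-δ D = ≈ₑ-at-t (derivation (δ D A.t)) D (derivation-t (δ D A.t))

    -- The inner derivation of U, read as a relation: in Ext the action of t may be computed by
    -- multiplying with φ_t on the right.
    derivation-commutator : ∀ U → derivation (U ⊛ φₜ) ≈ₑ derivation (ψₜ ⊛ U)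
    derivation-commutator U = ≈ₑ-inner (derivation (U ⊛ φₜ)) (derivation (ψₜ ⊛ U)) U
      (⊕-cong (derivation-t (U ⊛ φₜ)) (⊖-cong (derivation-t (ψₜ ⊛ U))))

    ≈ₑ⇒inner : ∀ {D D′} → D ≈ₑ D′ → ∃ λ U → δ D A.t ⊕ (⊖ δ D′ A.t) ≋ (U ⊛ φₜ) ⊕ (⊖ (ψₜ ⊛ U))
    ≈ₑ⇒inner (mk~ (U , e)) = U , e A.t

-- Division by ψ_t modulo inner derivations

module Reduction (𝒦 : PerfectAField f ℓf ℓf# k ℓk ℓk#) (φ ψ : TModules.DrinfeldModule 𝒦)
  {r s : ℕ} (φ-rank : TModules.HasRank 𝒦 φ r) (ψ-rank : TModules.HasRank 𝒦 ψ s) (r<s : r ℕ.< s) where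

  open TModuleProperties 𝒦
  open DrinfeldProperties 𝒦
  open Extensions φ ψ
  open DerivationProperties φ ψ
  open K⟨τ⟩
  private
    module E = LeftModule Ext
    module P = Points K-algebra
    module S = SemiringSum K.semiring
    module KP = RingProperties K.ring
    module HK = HeytingFieldProperties K
    open Relation.Binary.Reasoning.Setoid K.setoid

    φ-coeff ψ-coeff : ℕ → K.Carrier
    φ-coeff = coeff φₜ
    ψ-coeff = coeff ψₜ

    φ-coeff-≥ : ∀ {n} → s ℕ.≤ n → φ-coeff n K.≈ K.0#
    φ-coeff-≥ s≤n = proj₂ φ-rank _ (ℕ.<-≤-trans r<s s≤n) zero zero

    ψ-coeff-> : ∀ {n} → s ℕ.< n → ψ-coeff n K.≈ K.0#
    ψ-coeff-> s<n = proj₂ ψ-rank _ s<n zero zero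

    ψ-lead#0 : ψ-coeff s K.# K.0#
    ψ-lead#0 with proj₁ ψ-rank
    ... | zero , zero , ψₛ#0 = ψₛ#0

    w : K.Carrier
    w = proj₁ (HK.recip ψ-lead#0)

  -- The part of degree n + j of U φ_t - ψ_t U for U = τ^n u, read off from τ^n u φ_j τ^j = τ^(n+j)
  -- σ^j(φ_j u) and ψ_j τ^(n+j) u = τ^(n+j) σ^(n+j)(ψ_j) u. The last factor is the map from c to u.
  remainder-term : ℕ → ℕ → K⟨σ⟩.Poly
  remainder-term n j = (σP.monomial j (φ-coeff j) K⟨σ⟩.⊕ K⟨σ⟩.constant (K.- σ^ (n ℕ.+ j) (ψ-coeff j)))
    K⟨σ⟩.⊛ K⟨σ⟩.constant (σ^ (n ℕ.+ s) w)

  -- τ^(n+s) c ≡ Σ_{i<n+s} τ^i (remainder n i)(c) modulo the inner derivation of U = τ^n u,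
  -- where u = σ^(n+s)(1/ψ_s) c makes ψ_t U have leading term τ^(n+s) c.
  remainder : ℕ → ℕ → K⟨σ⟩.Poly
  remainder n = shift [] n (remainder-term n)

  private
    module Remainder (n : ℕ) (c : K.Carrier) where
      u = σ^ (n ℕ.+ s) w K.* c

      remainder-value : ℕ → K.Carrier
      remainder-value i = P.eval (remainder n i) c

      remainder-above : ∀ j → remainder-value (n ℕ.+ j)
        K.≈ σ^ j (φ-coeff j K.* u) K.+ (K.- σ^ (n ℕ.+ j) (ψ-coeff j)) K.* u
      remainder-above j = begin
        P.eval (remainder n (n ℕ.+ j)) c
          ≡⟨ ≡.cong (λ f → P.eval f c) (shift-+ n j) ⟩
        P.eval ((σP.monomial j (φ-coeff j) K⟨σ⟩.⊕ K⟨σ⟩.constant x) K⟨σ⟩.⊛ K⟨σ⟩.constant (σ^ (n ℕ.+ s) w)) c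
          ≈⟨ P.eval-⊛ (σP.monomial j (φ-coeff j) K⟨σ⟩.⊕ K⟨σ⟩.constant x) _ c ⟩
        P.eval (σP.monomial j (φ-coeff j) K⟨σ⟩.⊕ K⟨σ⟩.constant x) (u K.+ K.0#)
          ≈⟨ P.eval-cong (σP.monomial j (φ-coeff j) K⟨σ⟩.⊕ K⟨σ⟩.constant x) _ K⟨σ⟩.≋-refl (K.+-identityʳ u) ⟩
        P.eval (σP.monomial j (φ-coeff j) K⟨σ⟩.⊕ K⟨σ⟩.constant x) u
          ≈⟨ P.eval-⊕ (σP.monomial j (φ-coeff j)) _ u ⟩
        P.eval (σP.monomial j (φ-coeff j)) u K.+ (x K.* u K.+ K.0#)
          ≈⟨ K.+-cong (eval-monomial j (φ-coeff j) u) (K.+-identityʳ _) ⟩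
        σ^ j (φ-coeff j K.* u) K.+ x K.* u ∎
        where x = K.- σ^ (n ℕ.+ j) (ψ-coeff j)

      -- Since r < s, the coefficient φ_s vanishes; what is left is -σ^(n+s)(ψ_s) u, and u was
      -- chosen to make this -c.
      remainder-top : remainder-value (n ℕ.+ s) K.≈ K.- c
      remainder-top = begin
        remainder-value (n ℕ.+ s)
          ≈⟨ remainder-above s ⟩
        σ^ s (φ-coeff s K.* u) K.+ (K.- σ^ (n ℕ.+ s) (ψ-coeff s)) K.* u
          ≈⟨ K.+-cong (K.trans (σ^.⟦⟧-cong s (K.trans (K.*-congʳ (φ-coeff-≥ ℕ.≤-refl)) (K.zeroˡ u))) (σ^.0#-homo s))
               (K.sym (KP.-‿distribˡ-* _ u)) ⟩
        K.0# K.+ K.- (σ^ (n ℕ.+ s) (ψ-coeff s) K.* (σ^ (n ℕ.+ s) w K.* c))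
          ≈⟨ K.+-identityˡ _ ⟩
        K.- (σ^ (n ℕ.+ s) (ψ-coeff s) K.* (σ^ (n ℕ.+ s) w K.* c))
          ≈⟨ K.-‿cong (K.*-assoc _ _ c) ⟨
        K.- (σ^ (n ℕ.+ s) (ψ-coeff s) K.* σ^ (n ℕ.+ s) w K.* c)
          ≈⟨ K.-‿cong (K.*-congʳ (σ^.*-homo (n ℕ.+ s) _ _)) ⟨
        K.- (σ^ (n ℕ.+ s) (ψ-coeff s K.* w) K.* c)
          ≈⟨ K.-‿cong (K.trans (K.*-congʳ (K.trans (σ^.⟦⟧-cong (n ℕ.+ s)
               (K.trans (K.*-comm _ w) (proj₂ (HK.recip ψ-lead#0)))) (σ^.1#-homo (n ℕ.+ s)))) (K.*-identityˡ c)) ⟩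
        K.- c ∎

      remainder->top : ∀ i → n ℕ.+ s ℕ.< i → remainder-value i K.≈ K.0#
      remainder->top i n+s<i with ℕ.m≤n⇒∃[o]m+o≡n (ℕ.≤-trans (ℕ.m≤m+n n s) (ℕ.<⇒≤ n+s<i))
      ... | j , ≡.refl = begin
        remainder-value (n ℕ.+ j)
          ≈⟨ remainder-above j ⟩
        σ^ j (φ-coeff j K.* u) K.+ (K.- σ^ (n ℕ.+ j) (ψ-coeff j)) K.* u
          ≈⟨ K.+-cong
               (K.trans (σ^.⟦⟧-cong j (K.trans (K.*-congʳ (φ-coeff-≥ (ℕ.<⇒≤ s<j))) (K.zeroˡ u))) (σ^.0#-homo j))
               (K.trans (K.*-congʳ (K.trans (K.-‿cong (K.trans (σ^.⟦⟧-cong (n ℕ.+ j) (ψ-coeff-> s<j))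
                 (σ^.0#-homo (n ℕ.+ j)))) KP.-0#≈0#)) (K.zeroˡ u)) ⟩
        K.0# K.+ K.0#
          ≈⟨ K.+-identityˡ _ ⟩
        K.0# ∎
        where
        s<j : s ℕ.< j
        s<j = ℕ.+-cancelˡ-< n s j n+s<i

      U = τP.monomial n u

      -- One term more than in the final relation: index n + s still holds -c, which `monomial-≈ₑ`
      -- splits off. Below degree n both products vanish.
      remainder-inner : (U ⊛ φₜ) ⊕ (⊖ (ψₜ ⊛ U)) ≋ τP.truncate (suc (n ℕ.+ s)) remainder-value
      remainder-inner = τP.≋-truncate _ (suc (n ℕ.+ s)) remainder-value remainder->top
        (shift-elim (λ i p → coeff ((U ⊛ φₜ) ⊕ (⊖ (ψₜ ⊛ U))) i K.≈ τ^ i (P.eval p c)) n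
          (λ i i<n → begin
            coeff ((U ⊛ φₜ) ⊕ (⊖ (ψₜ ⊛ U))) i
              ≈⟨ split i ⟩
            coeff (U ⊛ φₜ) i K.+ K.- coeff (ψₜ ⊛ U) i
              ≈⟨ K.+-cong (τP.coeff-monomial-⊛-< n u φₜ i<n)
                   (K.trans (K.-‿cong (τP.coeff-⊛-monomial-< n u ψₜ i<n)) KP.-0#≈0#) ⟩
            K.0# K.+ K.0#
              ≈⟨ K.+-identityˡ _ ⟩
            K.0#
              ≈⟨ τ^.0#-homo i ⟨
            τ^ i K.0# ∎)
          (λ j → begin
            coeff ((U ⊛ φₜ) ⊕ (⊖ (ψₜ ⊛ U))) (n ℕ.+ j)
              ≈⟨ split (n ℕ.+ j) ⟩
            coeff (U ⊛ φₜ) (n ℕ.+ j) K.+ K.- coeff (ψₜ ⊛ U) (n ℕ.+ j)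
              ≈⟨ K.+-cong (τP.coeff-monomial-⊛ n u φₜ j) (K.-‿cong (τP.coeff-⊛-monomial n u ψₜ j)) ⟩
            τ^ n (u K.* φ-coeff j) K.+ K.- (ψ-coeff j K.* τ^ (n ℕ.+ j) u)
              ≈⟨ K.+-cong (φ-term j) (ψ-term j) ⟩
            τ^ (n ℕ.+ j) (σ^ j (φ-coeff j K.* u)) K.+ τ^ (n ℕ.+ j) ((K.- σ^ (n ℕ.+ j) (ψ-coeff j)) K.* u)
              ≈⟨ τ^.+-homo (n ℕ.+ j) _ _ ⟨
            τ^ (n ℕ.+ j) (σ^ j (φ-coeff j K.* u) K.+ (K.- σ^ (n ℕ.+ j) (ψ-coeff j)) K.* u)
              ≈⟨ τ^.⟦⟧-cong (n ℕ.+ j) (remainder-above j) ⟨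
            τ^ (n ℕ.+ j) (remainder-value (n ℕ.+ j))
              ≡⟨ ≡.cong (λ p → τ^ (n ℕ.+ j) (P.eval p c)) (shift-+ n j) ⟩
            τ^ (n ℕ.+ j) (P.eval (remainder-term n j) c) ∎))
        where
        split : ∀ i → coeff ((U ⊛ φₜ) ⊕ (⊖ (ψₜ ⊛ U))) i K.≈ coeff (U ⊛ φₜ) i K.+ K.- coeff (ψₜ ⊛ U) i
        split i = K.trans (coeff-⊕ (U ⊛ φₜ) _ i) (K.+-congˡ (coeff-⊖ (ψₜ ⊛ U) i))
        φ-term : ∀ j → τ^ n (u K.* φ-coeff j) K.≈ τ^ (n ℕ.+ j) (σ^ j (φ-coeff j K.* u))
        φ-term j = begin
          τ^ n (u K.* φ-coeff j)                   ≈⟨ τ^.⟦⟧-cong n (K.*-comm u _) ⟩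
          τ^ n (φ-coeff j K.* u)                   ≈⟨ τ^.⟦⟧-cong n (τ^σ^ j _) ⟨
          τ^ n (τ^ j (σ^ j (φ-coeff j K.* u)))     ≡⟨ τP.s^-+ n j _ ⟨
          τ^ (n ℕ.+ j) (σ^ j (φ-coeff j K.* u))    ∎
        ψ-term : ∀ j → K.- (ψ-coeff j K.* τ^ (n ℕ.+ j) u)
          K.≈ τ^ (n ℕ.+ j) ((K.- σ^ (n ℕ.+ j) (ψ-coeff j)) K.* u)
        ψ-term j = begin
          K.- (ψ-coeff j K.* τ^ N u)               ≈⟨ KP.-‿distribˡ-* _ _ ⟩
          (K.- ψ-coeff j) K.* τ^ N u               ≈⟨ K.*-congʳ (K.-‿cong (τ^σ^ N _)) ⟨
          (K.- τ^ N (σ^ N (ψ-coeff j))) K.* τ^ N u ≈⟨ K.*-congʳ (τ^.-‿homo N _) ⟨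
          τ^ N (K.- σ^ N (ψ-coeff j)) K.* τ^ N u   ≈⟨ τ^.*-homo N _ _ ⟨
          τ^ N ((K.- σ^ N (ψ-coeff j)) K.* u)      ∎
          where N = n ℕ.+ j

      -- The inner element is T - M, its top term being -M; hence the symmetric form of `≈ₑ-inner`.
      monomial-≈ₑ : derivation (τP.monomial (n ℕ.+ s) c) ≈ₑ derivation (τP.truncate (n ℕ.+ s) remainder-value)
      monomial-≈ₑ = E.≈ᴹ-sym {derivation T} {derivation M} (≈ₑ-inner (derivation T) (derivation M) U
        (≋-trans (⊕-cong (derivation-t T) (⊖-cong (derivation-t M))) (≋-sym (≋-trans remainder-inner
          (≋-trans (τP.truncate-suc (n ℕ.+ s) remainder-value)
            (⊕-congˡ T (≋-trans (τP.monomial-cong (n ℕ.+ s) remainder-top) (τP.monomial-⊖ (n ℕ.+ s) c))))))))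
        where
        M = τP.monomial (n ℕ.+ s) c
        T = τP.truncate (n ℕ.+ s) remainder-value

  open Remainder using (remainder-value; monomial-≈ₑ)

  -- Round by round replaces τ^(n+s-1), ..., τ^s by their remainders, from the top down. Entries at
  -- s and above are discarded by the final truncation.
  reduce : ℕ → (ℕ → K.Carrier) → ℕ → K.Carrier
  reduce zero    y = y
  reduce (suc n) y = reduce n λ i → y i K.+ P.eval (remainder n i) (y (n ℕ.+ s))

  reduce-≈ₑ : ∀ n y → derivation (τP.truncate (n ℕ.+ s) y) ≈ₑ derivation (τP.truncate s (reduce n y))
  reduce-≈ₑ zero    y = E.≈ᴹ-refl
  reduce-≈ₑ (suc n) y = ER.begin
    derivation (τP.truncate (suc n ℕ.+ s) y)
      ER.≈⟨ derivation-cong (τP.truncate-suc (n ℕ.+ s) y) ⟩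
    derivation (Y ⊕ τP.monomial (n ℕ.+ s) c)
      ER.≈⟨ derivation-⊕ Y (τP.monomial (n ℕ.+ s) c) ⟩
    derivation Y +ᴰ derivation (τP.monomial (n ℕ.+ s) c)
      ER.≈⟨ E.+ᴹ-congˡ {x = derivation Y} (monomial-≈ₑ n c) ⟩
    derivation Y +ᴰ derivation (τP.truncate (n ℕ.+ s) (remainder-value n c))
      ER.≈⟨ derivation-⊕ Y (τP.truncate (n ℕ.+ s) (remainder-value n c)) ⟨
    derivation (Y ⊕ τP.truncate (n ℕ.+ s) (remainder-value n c))
      ER.≈⟨ derivation-cong (τP.embed-+ {n ℕ.+ s} (y ∘ toℕ) (remainder-value n c ∘ toℕ)) ⟨
    derivation (τP.truncate (n ℕ.+ s) (λ i → y i K.+ remainder-value n c i))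
      ER.≈⟨ reduce-≈ₑ n _ ⟩
    derivation (τP.truncate s (reduce (suc n) y)) ER.∎
    where
    module ER = Relation.Binary.Reasoning.Setoid E.≈ᴹ-setoid
    c = y (n ℕ.+ s)
    Y = τP.truncate (n ℕ.+ s) y

  -- `reduce` on operators instead of values: `p i` maps one fixed coordinate to the coefficient of
  -- τ^i, and evaluation becomes composition.
  reduceσ : ℕ → (ℕ → K⟨σ⟩.Poly) → ℕ → K⟨σ⟩.Poly
  reduceσ zero    p = p
  reduceσ (suc n) p = reduceσ n λ i → p i K⟨σ⟩.⊕ remainder n i K⟨σ⟩.⊛ p (n ℕ.+ s)

  reduce-cong : ∀ n {y z} → (∀ i → y i K.≈ z i) → ∀ i → reduce n y i K.≈ reduce n z i
  reduce-cong zero    e = e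
  reduce-cong (suc n) e = reduce-cong n λ i → K.+-cong (e i)
    (P.eval-cong (remainder n i) _ K⟨σ⟩.≋-refl (e (n ℕ.+ s)))

  -- Remainders are additive, so reducing a sum over the coordinates reduces each column on its own;
  -- this yields a matrix.
  reduce-eval : ∀ n {d} (p : Fin d → ℕ → K⟨σ⟩.Poly) (x : Fin d → K.Carrier) k →
    reduce n (λ k → S.sum λ i → P.eval (p i k) (x i)) k K.≈ S.sum λ i → P.eval (reduceσ n (p i) k) (x i)
  reduce-eval zero    p x k = K.refl
  reduce-eval (suc n) p x k = K.trans (reduce-cong n (λ k → K.trans
      (K.+-congˡ (P.eval-sum (remainder n k) (λ i → P.eval (p i (n ℕ.+ s)) (x i))))
      (K.trans (K.sym (S.∑-distrib-+ (λ i → P.eval (p i k) (x i)) _))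
        (S.sum-cong-≋ λ i → K.trans (K.+-congˡ (K.sym (P.eval-⊛ (remainder n k) (p i (n ℕ.+ s)) (x i))))
          (K.sym (P.eval-⊕ (p i k) (remainder n k K⟨σ⟩.⊛ p i (n ℕ.+ s)) (x i)))))) k)
    (reduce-eval n (λ i k → p i k K⟨σ⟩.⊕ remainder n k K⟨σ⟩.⊛ p i (n ℕ.+ s)) x k)

  -- A round adds remainder · `p (n + s)`, whose constant term is a product with second factor 0. As
  -- no constant term moves, the hypothesis survives to the next round.
  coeff₀-reduceσ : ∀ n p → (∀ k → s ℕ.≤ k → K⟨σ⟩.coeff (p k) 0 K.≈ K.0#) →
    ∀ k → K⟨σ⟩.coeff (reduceσ n p k) 0 K.≈ K⟨σ⟩.coeff (p k) 0
  coeff₀-reduceσ zero    p h k = K.refl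
  coeff₀-reduceσ (suc n) p h k = K.trans
    (coeff₀-reduceσ n _ (λ k s≤k → K.trans (same k) (h k s≤k)) k) (same k)
    where
    same : ∀ k → K⟨σ⟩.coeff (p k K⟨σ⟩.⊕ remainder n k K⟨σ⟩.⊛ p (n ℕ.+ s)) 0 K.≈ K⟨σ⟩.coeff (p k) 0
    same k = begin
      K⟨σ⟩.coeff (p k K⟨σ⟩.⊕ remainder n k K⟨σ⟩.⊛ p (n ℕ.+ s)) 0
        ≈⟨ K⟨σ⟩.coeff-⊕ (p k) _ 0 ⟩
      K⟨σ⟩.coeff (p k) 0 K.+ K⟨σ⟩.coeff (remainder n k K⟨σ⟩.⊛ p (n ℕ.+ s)) 0
        ≈⟨ K.+-congˡ (K.trans (σP.coeff₀-⊛ (remainder n k) (p (n ℕ.+ s)))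
             (K.trans (K.*-congˡ (h (n ℕ.+ s) (ℕ.m≤n+m s n))) (K.zeroʳ _))) ⟩
      K⟨σ⟩.coeff (p k) 0 K.+ K.0#
        ≈⟨ K.+-identityʳ _ ⟩
      K⟨σ⟩.coeff (p k) 0 ∎

  -- φ_t and ψ_t have the same constant term θ, so reduction does not touch the constant term.
  remainder-0 : ∀ n → remainder n 0 K⟨σ⟩.≋ []
  remainder-0 zero    = K⟨σ⟩.⊛-zeroˡ (σP.monomial 0 (φ-coeff 0) K⟨σ⟩.⊕ K⟨σ⟩.constant (K.- ψ-coeff 0))
    {K⟨σ⟩.constant (σ^ s w)} (K⟨σ⟩.0∷[]≋[]
    (K.trans (K.+-cong (coeff₀-⟨t⟩ φ) (K.-‿cong (coeff₀-⟨t⟩ ψ))) (K.-‿inverseʳ θ)) K⟨σ⟩.≋-refl)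
  remainder-0 (suc n) = K⟨σ⟩.≋-refl

  reduceσ-0 : ∀ n p → reduceσ n p 0 K⟨σ⟩.≋ p 0
  reduceσ-0 zero    p = K⟨σ⟩.≋-refl
  reduceσ-0 (suc n) p = K⟨σ⟩.≋-trans (reduceσ-0 n _)
    (K⟨σ⟩.≋-trans (K⟨σ⟩.⊕-congˡ (p 0) (K⟨σ⟩.⊛-zeroˡ (remainder n 0) (remainder-0 n))) (K⟨σ⟩.⊕-identityʳ (p 0)))

  -- τ^i y φ_t = Σ_n τ^n (φ-column i n)(y)
  φ-column : ℕ → ℕ → K⟨σ⟩.Poly
  φ-column i = shift [] i λ j → σP.monomial j (φ-coeff j)

  coeff-monomial-φ : ∀ i y n → coeff (τP.monomial i y ⊛ φₜ) n K.≈ τ^ n (P.eval (φ-column i n) y)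
  coeff-monomial-φ i y = shift-elim (λ n p → coeff (τP.monomial i y ⊛ φₜ) n K.≈ τ^ n (P.eval p y)) i
    (λ n n<i → K.trans (τP.coeff-monomial-⊛-< i y φₜ n<i) (K.sym (τ^.0#-homo n)))
    (λ j → begin
      coeff (τP.monomial i y ⊛ φₜ) (i ℕ.+ j)                ≈⟨ τP.coeff-monomial-⊛ i y φₜ j ⟩
      τ^ i (y K.* φ-coeff j)                                ≈⟨ τ^.⟦⟧-cong i (K.*-comm y _) ⟩
      τ^ i (φ-coeff j K.* y)                                ≈⟨ τ^.⟦⟧-cong i (τ^σ^ j _) ⟨
      τ^ i (τ^ j (σ^ j (φ-coeff j K.* y)))                  ≡⟨ τP.s^-+ i j _ ⟨
      τ^ (i ℕ.+ j) (σ^ j (φ-coeff j K.* y))                 ≈⟨ τ^.⟦⟧-cong (i ℕ.+ j) (eval-monomial j _ y) ⟨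
      τ^ (i ℕ.+ j) (P.eval (σP.monomial j (φ-coeff j)) y)   ∎)

  -- If i < s and i + j ≥ 2s then j ≥ s, so φ_j = 0. Hence x φ_t lives below τ^(2s) and s rounds
  -- suffice.
  eval-φ-column-≥ : ∀ {i} y → i ℕ.< s → ∀ n → s ℕ.+ s ℕ.≤ n → P.eval (φ-column i n) y K.≈ K.0#
  eval-φ-column-≥ {i} y i<s = shift-elim (λ n p → s ℕ.+ s ℕ.≤ n → P.eval p y K.≈ K.0#) i
    (λ _ _ _ → K.refl)
    (λ j 2s≤i+j → K.trans (eval-monomial j _ y) (K.trans (σ^.⟦⟧-cong j (K.trans
        (K.*-congʳ (φ-coeff-≥ (ℕ.≮⇒≥ λ j<s → ℕ.<⇒≱ (ℕ.+-mono-< i<s j<s) 2s≤i+j))) (K.zeroˡ y)))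
      (σ^.0#-homo j)))

  -- Column i holds the reduced coordinates of τ^i y φ_t as operators on y.
  matrix : Matσ.Mat s s
  matrix k i = reduceσ s (φ-column (toℕ i)) (toℕ k)

  matrix-≈ₑ : ∀ x → derivation (τP.embed (P.apply matrix x)) ≈ₑ derivation (ψₜ ⊛ τP.embed x)
  matrix-≈ₑ x = ER.begin
    derivation (τP.embed (P.apply matrix x))
      ER.≈⟨ derivation-cong (τP.embed-cong λ k → reduce-eval s (φ-column ∘ toℕ) x (toℕ k)) ⟨
    derivation (τP.truncate s (reduce s Z))
      ER.≈⟨ reduce-≈ₑ s Z ⟨
    derivation (τP.truncate (s ℕ.+ s) Z)
      ER.≈⟨ derivation-cong (τP.≋-truncate (τP.embed x ⊛ φₜ) (s ℕ.+ s) Z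
              (λ n 2s≤n → K.trans (S.sum-cong-≋ λ i → eval-φ-column-≥ (x i) (Fin.toℕ<n i) n 2s≤n) (S.sum-replicate-zero s))
              (λ n → K.trans (τP.coeff-embed-⊛ x φₜ n) (K.trans (S.sum-cong-≋ λ i → coeff-monomial-φ (toℕ i) (x i) n)
                (K.sym (τP.s^-sum n (λ i → P.eval (φ-column (toℕ i) n) (x i))))))) ⟨
    derivation (τP.embed x ⊛ φₜ)
      ER.≈⟨ derivation-commutator (τP.embed x) ⟩
    derivation (ψₜ ⊛ τP.embed x) ER.∎
    where
    module ER = Relation.Binary.Reasoning.Setoid E.≈ᴹ-setoid
    Z : ℕ → K.Carrier
    Z n = S.sum λ i → P.eval (φ-column (toℕ i) n) (x i)

  coeff₀-φ-column : ∀ i n → ¬ (n ≡ i) → K⟨σ⟩.coeff (φ-column i n) 0 K.≈ K.0#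
  coeff₀-φ-column zero    zero    n≢i = contradiction ≡.refl n≢i
  coeff₀-φ-column zero    (suc n) n≢i = K.refl
  coeff₀-φ-column (suc i) zero    n≢i = K.refl
  coeff₀-φ-column (suc i) (suc n) n≢i = coeff₀-φ-column i n (n≢i ∘ ≡.cong suc)

  -- Uniqueness and existence of reduced representatives

  private
    -- If deg U = N, the leading term of U φ_t − ψ_t U is −ψ_s τ^s(U_N) τ^(N+s).
    inner-injective : ∀ U h → (∀ n → s ℕ.≤ n → coeff h n K.≈ K.0#) →
      h ≋ (U ⊛ φₜ) ⊕ (⊖ (ψₜ ⊛ U)) → U ≋ []
    -- The length of the list is a degree bound at hand; each step lowers the bound by one, showing
    -- one more coefficient to be 0.
    inner-injective U h h-degree e = descend (length U) (τP.coeff-≥length U)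
      where
      descend : ∀ N → (∀ n → N ℕ.≤ n → coeff U n K.≈ K.0#) → U ≋ []
      descend zero    U-degree = mk≋ λ n → U-degree n z≤n
      descend (suc N) U-degree = descend N λ n N≤n → case-≤ n (ℕ.m≤n⇒m<n∨m≡n N≤n)
        where
        leading : ψ-coeff s K.* τ^ s (coeff U N) K.≈ ψ-coeff s K.* K.0#
        leading = begin
          ψ-coeff s K.* τ^ s (coeff U N)
            ≈⟨ τP.coeff-⊛-top ψₜ U s N (λ _ → ψ-coeff->) U-degree ⟨
          coeff (ψₜ ⊛ U) (s ℕ.+ N)
            ≡⟨ ≡.cong (coeff (ψₜ ⊛ U)) (ℕ.+-comm s N) ⟩
          coeff (ψₜ ⊛ U) (N ℕ.+ s)
            ≈⟨ KG.x∙y⁻¹≈ε⇒x≈y _ _ (K.trans (K.sym (K.trans (coeff-≈ e (N ℕ.+ s))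
                 (K.trans (coeff-⊕ (U ⊛ φₜ) _ (N ℕ.+ s)) (K.+-congˡ (coeff-⊖ (ψₜ ⊛ U) (N ℕ.+ s))))))
                 (h-degree (N ℕ.+ s) (ℕ.m≤n+m s N))) ⟨
          coeff (U ⊛ φₜ) (N ℕ.+ s)
            ≈⟨ τP.coeff-⊛-top U φₜ N s U-degree (λ _ s<n → φ-coeff-≥ (ℕ.<⇒≤ s<n)) ⟩
          coeff U N K.* τ^ N (φ-coeff s)
            ≈⟨ K.trans (K.*-congˡ (K.trans (τ^.⟦⟧-cong N (φ-coeff-≥ ℕ.≤-refl)) (τ^.0#-homo N))) (K.zeroʳ _) ⟩
          K.0#
            ≈⟨ K.zeroʳ _ ⟨
          ψ-coeff s K.* K.0# ∎
          where module KG = GroupProperties K.+-group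
        case-≤ : ∀ n → (N ℕ.< n) ⊎ (N ≡ n) → coeff U n K.≈ K.0#
        case-≤ n (inj₁ N<n)    = U-degree n N<n
        case-≤ n (inj₂ ≡.refl) = τP.s^-injective τ-injective s
          (K.trans (HK.#0-*-cancelˡ ψ-lead#0 leading) (K.sym (τ^.0#-homo s)))

  -- The difference of two reduced representatives has degree below s; if it is inner then its U is
  -- 0, and so is the difference.
  embed-class-injective : ∀ (x y : P.Vec s) → derivation (τP.embed x) ≈ₑ derivation (τP.embed y) → ∀ i → x i K.≈ y i
  embed-class-injective x y D≈D′ = τP.embed-injective τ-injective x y (PG.x∙y⁻¹≈ε⇒x≈y _ _
      (≋-trans h≋ (⊕-cong (⊛-zeroˡ U U≋[]) (⊖-cong (≋-trans (⊛-congʳ ψₜ U≋[]) (Ring.zeroʳ polyRing ψₜ))))))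
    where
    module PG = GroupProperties (Ring.+-group polyRing)
    h = τP.embed x ⊕ (⊖ τP.embed y)
    U = proj₁ (≈ₑ⇒inner D≈D′)
    h≋ : h ≋ (U ⊛ φₜ) ⊕ (⊖ (ψₜ ⊛ U))
    h≋ = ≋-trans (≋-sym (⊕-cong (derivation-t (τP.embed x)) (⊖-cong (derivation-t (τP.embed y)))))
      (proj₂ (≈ₑ⇒inner D≈D′))
    U≋[] : U ≋ []
    U≋[] = inner-injective U h (λ n s≤n → K.trans (coeff-⊕ (τP.embed x) _ n) (K.trans
      (K.+-cong (τP.coeff-embed-≥ x s≤n) (K.trans (coeff-⊖ (τP.embed y) n)
        (K.trans (K.-‿cong (τP.coeff-embed-≥ y s≤n)) KP.-0#≈0#))) (K.+-identityˡ _))) h≋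

  embed-class-surjective : ∀ D → ∃ λ (x : P.Vec s) → derivation (τP.embed x) ≈ₑ D
  -- L rounds lead from the bound L + s down to s. The bound is generous, as h has only L
  -- coefficients, but it avoids comparing L with s.
  embed-class-surjective D = reduce L y ∘ toℕ , (ER.begin
    derivation (τP.truncate s (reduce L y))
      ER.≈⟨ reduce-≈ₑ L y ⟨
    derivation (τP.truncate (L ℕ.+ s) y)
      ER.≈⟨ derivation-cong (τP.≋-truncate h (L ℕ.+ s) y
              (λ n L+s≤n → K.trans (σ^.⟦⟧-cong n (τP.coeff-≥length h n (ℕ.≤-trans (ℕ.m≤m+n L s) L+s≤n))) (σ^.0#-homo n))
              (λ n → K.sym (τ^σ^ n (coeff h n)))) ⟨
    derivation h
      ER.≈⟨ derivation-δ D ⟩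
    D ER.∎)
    where
    module ER = Relation.Binary.Reasoning.Setoid E.≈ᴹ-setoid
    h = δ D A.t
    L = length h
    y : ℕ → K.Carrier
    -- Moves the coefficient to the right of τ^n: h_n τ^n = τ^n σ^n(h_n).
    y n = σ^ n (coeff h n)

  ≈ₑ⇒coeff₀ : ∀ {D D′} → D ≈ₑ D′ → coeff (δ D A.t) 0 K.≈ coeff (δ D′ A.t) 0
  ≈ₑ⇒coeff₀ {D} {D′} D≈D′ = KG.x∙y⁻¹≈ε⇒x≈y _ _ (begin
    coeff (δ D A.t) 0 K.+ K.- coeff (δ D′ A.t) 0
      ≈⟨ K.trans (coeff-⊕ (δ D A.t) _ 0) (K.+-congˡ (coeff-⊖ (δ D′ A.t) 0)) ⟨
    coeff (δ D A.t ⊕ (⊖ δ D′ A.t)) 0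
      ≈⟨ coeff-≈ (proj₂ (≈ₑ⇒inner D≈D′)) 0 ⟩
    coeff ((U ⊛ φₜ) ⊕ (⊖ (ψₜ ⊛ U))) 0
      ≈⟨ K.trans (coeff-⊕ (U ⊛ φₜ) _ 0) (K.+-congˡ (coeff-⊖ (ψₜ ⊛ U) 0)) ⟩
    coeff (U ⊛ φₜ) 0 K.+ K.- coeff (ψₜ ⊛ U) 0
      ≈⟨ K.+-cong (K.trans (τP.coeff₀-⊛ U φₜ) (K.*-congˡ (coeff₀-⟨t⟩ φ)))
           (K.-‿cong (K.trans (τP.coeff₀-⊛ ψₜ U) (K.*-congʳ (coeff₀-⟨t⟩ ψ)))) ⟩
    coeff U 0 K.* θ K.+ K.- (θ K.* coeff U 0)
      ≈⟨ K.+-congˡ (K.-‿cong (K.*-comm θ _)) ⟩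
    coeff U 0 K.* θ K.+ K.- (coeff U 0 K.* θ)
      ≈⟨ K.-‿inverseʳ _ ⟩
    K.0# ∎)
    where
    module KG = GroupProperties K.+-group
    U = proj₁ (≈ₑ⇒inner D≈D′)

  -- Before reduction the diagonal entries are φ_0 = θ, and every other entry is 0 or σ^j φ_j with j
  -- ≥ 1; reduction leaves the constant terms alone.
  coeff₀-matrix : ∀ k i → K⟨σ⟩.coeff (matrix k i) 0 K.≈ Matₖ.scalar θ k i
  coeff₀-matrix k i = K.trans
    (coeff₀-reduceσ s (φ-column (toℕ i)) (λ n s≤n → coeff₀-φ-column (toℕ i) n (ℕ.<⇒≢ (ℕ.<-≤-trans (Fin.toℕ<n i) s≤n) ∘ ≡.sym))
      (toℕ k))
    (on-and-off k i)
    where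
    on-and-off : ∀ k i → K⟨σ⟩.coeff (φ-column (toℕ {s} i) (toℕ {s} k)) 0 K.≈ Matₖ.scalar θ k i
    on-and-off k i with k Fin.≟ i
    ... | no k≢i = coeff₀-φ-column (toℕ i) (toℕ k) (k≢i ∘ Fin.toℕ-injective)
    ... | yes ≡.refl = K.trans
      (K.reflexive (≡.cong (λ n → K⟨σ⟩.coeff (φ-column (toℕ i) n) 0) (≡.sym (ℕ.+-identityʳ (toℕ i)))))
      (K.trans (K.reflexive (≡.cong (λ p → K⟨σ⟩.coeff p 0) (shift-+ (toℕ i) 0))) (coeff₀-⟨t⟩ φ))

  open FromMatrix matrix coeff₀-matrix public using () renaming (tσModule to Ext-tσModule; ⟦t⟧ to Ext-⟦t⟧)

  Ext-≅ : MordellWeil Ext-tσModule ≅ Ext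
  Ext-≅ = record
    { to = derivation ∘ τP.embed
    ; isIsomorphism = record
      { isLeftModuleMonomorphism = record
        { isLeftModuleHomomorphism = mkIsLinearₜ (fieldRing 𝔽q) (MordellWeil Ext-tσModule) Ext (derivation ∘ τP.embed)
            (λ e → derivation-cong (τP.embed-cong e))
            (λ x y → E.≈ᴹ-trans (derivation-cong (τP.embed-+ x y)) (derivation-⊕ (τP.embed x) (τP.embed y)))
            (λ c x → E.≈ᴹ-trans
              (derivation-cong (≋-trans (τP.embed-cong (apply-constant Ext-tσModule c x))
                (≋-trans (τP.embed-constant-* (τ-ι₀ c) x)
                  (⊛-cong (≋-sym (TModule.𝔽q-linear ψ c zero zero)) ≋-refl))))
              (derivation-* (A.constant c) (τP.embed x)))
            (λ x → E.≈ᴹ-trans (derivation-cong (τP.embed-cong (P.apply-cong {x = x} Ext-⟦t⟧ (λ _ → K.refl))))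
              (E.≈ᴹ-trans (matrix-≈ₑ x) (derivation-* A.t (τP.embed x))))
        ; injective = embed-class-injective _ _ }
      ; surjective = λ D → let (x , e) = embed-class-surjective D in
          x , λ z≈x → E.≈ᴹ-trans (derivation-cong (τP.embed-cong z≈x)) e } }

-- Splitting off the coordinate of τ^0

module ExactSequence (𝒦 : PerfectAField f ℓf ℓf# k ℓk ℓk#) (φ ψ : TModules.DrinfeldModule 𝒦)
  {r s′ : ℕ} (φ-rank : TModules.HasRank 𝒦 φ r) (ψ-rank : TModules.HasRank 𝒦 ψ (suc s′)) (r<s : r ℕ.< suc s′) where

  open TModuleProperties 𝒦
  open DrinfeldProperties 𝒦
  open Extensions φ ψ
  open DerivationProperties φ ψ
  open Reduction 𝒦 φ ψ φ-rank ψ-rank r<s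
  private
    module E = LeftModule Ext
    module MR = MatrixRing K⟨σ⟩.polyRing
    module PσS = SemiringSum (Ring.semiring K⟨σ⟩.polyRing)
    module Kσ = Ring K⟨σ⟩.polyRing
    module P = Points K-algebra

  -- The first row of `matrix` is (θ, 0, ..., 0), so t preserves the vectors with y_0 = 0 and acts
  -- on them by this block.
  matrix₀ : Matσ.Mat s′ s′
  matrix₀ k i = matrix (suc k) (suc i)

  scalar-suc : ∀ {d} (k i : Fin d) → Matₖ.scalar θ (suc k) (suc i) K.≈ Matₖ.scalar θ k i
  scalar-suc k i with k Fin.≟ i
  ... | yes _ = K.refl
  ... | no  _ = K.refl

  open FromMatrix matrix₀ (λ k i → K.trans (coeff₀-matrix (suc k) (suc i)) (scalar-suc k i))
    public using () renaming (tσModule to Ext₀-tσModule; ⟦t⟧ to Ext₀-⟦t⟧)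

  -- Entries 0 and 1 are enough, as y_0 is itself a coordinate; on underlying groups the sequence is
  -- split, hence exact on points of every perfect algebra.
  includeMatrix : Matσ.Mat (suc s′) s′
  includeMatrix zero    j = []
  includeMatrix (suc k) j = Matσ.scalar (K⟨σ⟩.constant K.1#) k j

  projectMatrix : Matσ.Mat 1 (suc s′)
  projectMatrix _ zero    = K⟨σ⟩.constant K.1#
  projectMatrix _ (suc j) = []

  matrix-row-0 : ∀ j → matrix zero (suc j) K⟨σ⟩.≋ []
  matrix-row-0 j = reduceσ-0 (suc s′) (φ-column (suc (toℕ j)))

  matrix-corner : matrix zero zero K⟨σ⟩.≋ K⟨σ⟩.constant θ
  matrix-corner = K⟨σ⟩.≋-trans (reduceσ-0 (suc s′) (φ-column 0)) (K⟨σ⟩.∷-cong (coeff₀-⟨t⟩ φ) K⟨σ⟩.≋-refl)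

  include : Morphism Ext₀-tσModule Ext-tσModule
  include = record
    { matrix = includeMatrix
    ; commutes = commutes }
    where
    *-include : ∀ {d} (M : Matσ.Mat d (suc s′)) i j → (M Matσ.*ₘ includeMatrix) i j K⟨σ⟩.≋ M i (suc j)
    *-include M i j = Kσ.trans (Kσ.+-cong (Kσ.zeroʳ (M i zero))
      (MR.sum-*-scalar (K⟨σ⟩.constant K.1#) (M i ∘ suc) j)) (Kσ.*-identityʳ _)
    E₀ₜ = TσModule.⟦_⟧ Ext₀-tσModule A.t
    Eₜ = TσModule.⟦_⟧ Ext-tσModule A.t
    commutes : includeMatrix Matσ.*ₘ E₀ₜ Matσ.≈ₘ Eₜ Matσ.*ₘ includeMatrix
    commutes zero j = Kσ.trans (PσS.sum-replicate-zero s′)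
      (Kσ.sym (Kσ.trans (*-include Eₜ zero j) (Kσ.trans (Ext-⟦t⟧ zero (suc j)) (matrix-row-0 j))))
    commutes (suc k) j = Kσ.trans (MR.sum-scalar-* (K⟨σ⟩.constant K.1#) (λ l → E₀ₜ l j) k)
      (Kσ.trans (Kσ.*-identityˡ _) (Kσ.trans (Ext₀-⟦t⟧ k j)
        (Kσ.sym (Kσ.trans (*-include Eₜ (suc k) j) (Ext-⟦t⟧ (suc k) (suc j))))))

  project : Morphism Ext-tσModule 𝔾ₐ
  project = record
    { matrix = projectMatrix
    ; commutes = λ i j → Kσ.trans (project-* Eₜ j) (Kσ.trans (Ext-⟦t⟧ zero j) (column i j)) }
    where
    Eₜ = TσModule.⟦_⟧ Ext-tσModule A.t
    project-* : ∀ {d} (M : Matσ.Mat (suc s′) d) j → (projectMatrix Matσ.*ₘ M) zero j K⟨σ⟩.≋ M zero j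
    project-* M j = Kσ.trans (Kσ.+-cong (Kσ.*-identityˡ (M zero j)) (PσS.sum-replicate-zero s′)) (Kσ.+-identityʳ _)
    column : ∀ i j → matrix zero j K⟨σ⟩.≋ ((λ _ _ → K⟨σ⟩.constant θ) Matσ.*ₘ projectMatrix) i j
    column i zero    = Kσ.trans matrix-corner (Kσ.sym (Kσ.trans (Kσ.+-identityʳ _) (Kσ.*-identityʳ _)))
    column i (suc j) = Kσ.trans (matrix-row-0 j) (Kσ.sym (Kσ.trans (Kσ.+-identityʳ _) (Kσ.zeroʳ (K⟨σ⟩.constant θ))))

  module _ (R : PerfectAlgebra) where
    private
      module R = CommutativeRing (PerfectAlgebra.ring R)
      module Q = Points R
      module S = SemiringSum R.semiring

    apply-include-zero : ∀ x → Q.apply includeMatrix x zero R.≈ R.0#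
    apply-include-zero x = S.sum-replicate-zero s′

    apply-include-suc : ∀ x j → Q.apply includeMatrix x (suc j) R.≈ x j
    apply-include-suc x j = Q.apply-1 x j

    apply-project : ∀ y i → Q.apply projectMatrix y i R.≈ y zero
    apply-project y i = R.trans (R.+-cong (Q.eval-1 (y zero)) (S.sum-replicate-zero s′)) (R.+-identityʳ _)

    kernel⊆image : ∀ y → y zero R.≈ R.0# → Q.apply includeMatrix (y ∘ suc) Q.≈ᵥ y
    kernel⊆image y y₀≈0 zero    = R.trans (apply-include-zero (y ∘ suc)) (R.sym y₀≈0)
    kernel⊆image y y₀≈0 (suc j) = apply-include-suc (y ∘ suc) j

  isShortExact : IsShortExact include project
  isShortExact = record
    { injective = λ R e j → let module R = CommutativeRing (PerfectAlgebra.ring R) in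
        R.trans (R.sym (apply-include-suc R _ j)) (R.trans (e (suc j)) (apply-include-suc R _ j))
    ; exact = λ R y → let module R = CommutativeRing (PerfectAlgebra.ring R) in mk⇔
        (λ e → y ∘ suc , kernel⊆image R y (R.trans (R.sym (apply-project R y zero)) (e zero)))
        (λ (x , e) i → R.trans (apply-project R y i) (R.trans (R.sym (e zero)) (apply-include-zero R x)))
    ; surjective = λ R y → let module R = CommutativeRing (PerfectAlgebra.ring R) in
        -- Only coordinate 0 of the preimage matters, so a constant vector will do.
        (λ _ → y zero) , λ {z} e → λ { zero → R.trans (apply-project R z zero) (e zero) } }

  -- `Ext-≅` restricted along `include`: the representative of a vector with y_0 = 0 has no constant
  -- term.
  Ext₀-≅ : MordellWeil Ext₀-tσModule ≅ Ext₀
  Ext₀-≅ = record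
    { to = to₀
    ; isIsomorphism = record
      { isLeftModuleMonomorphism = record
        { isLeftModuleHomomorphism = mkIsLinear (MordellWeil Ext₀-tσModule) Ext₀ to₀
            (λ {x} {y} e → to-Ext₀ {to₀ x} {to₀ y} (α.⟦⟧-cong {ι′ x} {ι′ y} (include.⟦⟧-cong {x} {y} e)))
            (λ x y → to-Ext₀ (E.≈ᴹ-trans (α.⟦⟧-cong (include.+ᴹ-homo x y)) (α.+ᴹ-homo (ι′ x) (ι′ y))))
            (λ a x → to-Ext₀ (E.≈ᴹ-trans (α.⟦⟧-cong (include.*ₗ-homo a x)) (α.*ₗ-homo a (ι′ x))))
        ; injective = λ e → IsShortExact.injective isShortExact K-algebra (α.injective (from-Ext₀ e)) }
      ; surjective = surjective } }
    where
    module α where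
      open _≅_ Ext-≅ public
      open ModuleMorphisms.LeftModuleMorphisms.IsLeftModuleIsomorphism isIsomorphism public
    module include = ModuleMorphisms.LeftModuleMorphisms.IsLeftModuleHomomorphism (apply-Morphism-isLinear include)
    module E₀ = LeftModule Ext₀
    ι′ : P.Vec s′ → P.Vec (suc s′)
    ι′ = P.apply includeMatrix
    to₀ : P.Vec s′ → E₀.Carrierᴹ
    to₀ x = α.to (ι′ x)
      , K.trans (K⟨τ⟩.coeff-≈ (derivation-t (τP.embed (ι′ x))) 0) (apply-include-zero K-algebra x)
    -- Both relations say that the difference is inner; only the record wrapping the proof changes.
    to-Ext₀ : ∀ {D D′ : E₀.Carrierᴹ} → proj₁ D ≈ₑ proj₁ D′ → D E₀.≈ᴹ D′
    to-Ext₀ (mk~ e) = mk~ e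
    from-Ext₀ : ∀ {D D′ : E₀.Carrierᴹ} → D E₀.≈ᴹ D′ → proj₁ D ≈ₑ proj₁ D′
    from-Ext₀ (mk~ e) = mk~ e
    surjective : ∀ D → ∃ λ x → ∀ {z} → z P.≈ᵥ x → to₀ z E₀.≈ᴹ D
    surjective (D , D₀≈0) = x ∘ suc , λ z≈ → to-Ext₀ (E.≈ᴹ-trans (α.⟦⟧-cong
        (λ i → K.trans (include.⟦⟧-cong z≈ i) (kernel⊆image K-algebra x x₀≈0 i))) αx≈D)
      where
      x = proj₁ (embed-class-surjective D)
      αx≈D = proj₂ (embed-class-surjective D)
      -- The constant term at t is a class invariant: it is x_0 for the reduced representative and 0
      -- for D.
      x₀≈0 : x zero K.≈ K.0#
      x₀≈0 = K.trans (K.sym (K⟨τ⟩.coeff-≈ (derivation-t (τP.embed x)) 0)) (K.trans (≈ₑ⇒coeff₀ αx≈D) D₀≈0)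

theorem7p5 : {f ℓf ℓf# k ℓk ℓk# : Level} (𝒦 : PerfectAField f ℓf ℓf# k ℓk ℓk#) →
    let open TModules 𝒦 in
    (φ ψ : DrinfeldModule) (r s : ℕ) → HasRank φ r → HasRank ψ s → r < s →
    let open Extensions φ ψ in
    ∃₂ λ e d → Σ (TσModule e) λ E₀ → Σ (TσModule d) λ E →
    Σ (MordellWeil E₀ ≅ Ext₀) λ α₀ → Σ (MordellWeil E ≅ Ext) λ α →
    Σ (Morphism E₀ E) λ i → Σ (Morphism E 𝔾ₐ) λ π →
    IsShortExact i π
    × (∀ x → LeftModule._≈ᴹ_ Ext
    (_≅_.to α (Points.apply K-algebra (Morphism.matrix i) x))
    (inclusion (_≅_.to α₀ x)))
theorem7p5 𝒦 φ ψ r (suc s′) φ-rank ψ-rank r<s =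
  s′ , suc s′ , Ext₀-tσModule , Ext-tσModule , Ext₀-≅ , Ext-≅ , include , project , isShortExact ,
  -- The square commutes by definition, since `to₀` is `Ext-≅` after `include`, paired with a proof
  -- that `inclusion` forgets.
  λ x → LeftModule.≈ᴹ-refl Ext {_≅_.to Ext-≅ (Points.apply K-algebra includeMatrix x)}
  where
  open TModules 𝒦 using (K-algebra; module Points)
  open TModules.Extensions 𝒦 φ ψ using (Ext)
  open Reduction 𝒦 φ ψ φ-rank ψ-rank r<s using (Ext-tσModule; Ext-≅)
  open ExactSequence 𝒦 φ ψ φ-rank ψ-rank r<s
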